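{- Let $p\geq 3$ be a prime number. Then $c_p(A,B)\equiv \ell_p(A,B)\pmod{p}$, i.e. $c_p(A,B)-\ell_p(A,B)\in p\,\mathbb{Z}[A,B]$.
   Context: Let $A,B$ be indeterminates. Define polynomials $\psi_m$ by $\psi_0=0$, $\psi_1=1$, $\psi_2=2y$, $\psi_3=3x^4+6Ax^2+12Bx-A^2$, $\psi_4=2y\left(2x^6+10Ax^4+40Bx^3-10A^2x^2-8ABx-2(A^3+8B^2)\right)$, and for $m\ge 2$ recursively $\psi_{2m+1}=\psi_{m+2}\psi_m^3-\psi_{m-1}\psi_{m+1}^3$ and $2y\,\psi_{2m}=\psi_{m-1}^2\psi_m\psi_{m+2}-\psi_{m-2}\psi_m\psi_{m+1}^2$, where every expression is reduced using the relation $y^2=x^3+Ax+B$. For odd $m$, $\psi_m$ lies in $\mathbb{Z}[x,A,B]$; write $\psi_p(x,A,B)\in\mathbb{Z}[x,A,B]$ for the $p$-th one (the $p$-th division polynomial of $y^2=x^3+Ax+B$). Let $\ell_p(A,B)\in\mathbb{Z}[A,B]$ be the coefficient of $x^{\frac12 p(p-1)}$ in $\psi_p(x,A,B)$, viewed as a polynomial in $x$. Let $c_p(A,B)\in\mathbb{Z}[A,B]$ be the coefficient of $x^{p-1}$ in $(x^3+Ax+B)^{\frac12(p-1)}$. -}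

module Defs where

open import Data.Nat as ℕ using (ℕ; zero; suc; _∸_; _≤_)
open import Data.Nat.DivMod using (_/_)
open import Data.Integer as ℤ using (ℤ; +_)
open import Data.List using (List; []; _∷_; map)
open import Data.Product using (_×_; _,_; proj₁; proj₂)
open import Relation.Binary.PropositionalEquality using (_≡_)

-- Dense univariate polynomials over a coefficient type C, as coefficient
-- lists (lowest degree first).  Trailing zeros are allowed; equality of
-- polynomials is always taken coefficientwise (via `coeff`).
module PolyOps {C : Set} (0# : C) (_+_ _*_ : C → C → C) (-_ : C → C) where

  Poly : Set
  Poly = List C

  _⊕_ : Poly → Poly → Poly
  [] ⊕ q = q
  (a ∷ p) ⊕ [] = a ∷ p
  (a ∷ p) ⊕ (b ∷ q) = (a + b) ∷ (p ⊕ q)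

  neg : Poly → Poly
  neg = map -_

  scale : C → Poly → Poly
  scale c = map (c *_)

  _⊗_ : Poly → Poly → Poly
  [] ⊗ q = []
  (a ∷ p) ⊗ q = scale a q ⊕ (0# ∷ (p ⊗ q))

  coeff : Poly → ℕ → C
  coeff [] _ = 0#
  coeff (a ∷ p) zero = a
  coeff (a ∷ p) (suc n) = coeff p n

-- ℤ[B]
module P1 = PolyOps (+ 0) ℤ._+_ ℤ._*_ ℤ.-_
-- ℤ[B][A]
module P2 = PolyOps {P1.Poly} [] P1._⊕_ P1._⊗_ P1.neg
-- ℤ[B][A][x]  =  ℤ[x,A,B]
module P3 = PolyOps {P2.Poly} [] P2._⊕_ P2._⊗_ P2.neg

-- polynomials in A,B (outer variable A, inner variable B)
PolyAB : Set
PolyAB = P2.Poly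

PolyxAB : Set
PolyxAB = P3.Poly

coeffAB : PolyAB → ℕ → ℕ → ℤ
coeffAB f j k = P1.coeff (P2.coeff f j) k

coeffxAB : PolyxAB → ℕ → ℕ → ℕ → ℤ
coeffxAB f i j k = coeffAB (P3.coeff f i) j k

constP : ℤ → PolyxAB
constP n = ((n ∷ []) ∷ []) ∷ []

xP AP BP : PolyxAB
xP = [] ∷ constP (+ 1)
AP = ([] ∷ ((+ 1) ∷ []) ∷ []) ∷ []
BP = (((+ 0) ∷ (+ 1) ∷ []) ∷ []) ∷ []

fP : PolyxAB
fP = (xP P3.⊗ (xP P3.⊗ xP)) P3.⊕ ((AP P3.⊗ xP) P3.⊕ BP)

powP : PolyxAB → ℕ → PolyxAB
powP g zero = constP (+ 1)
powP g (suc n) = g P3.⊗ powP g n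

-- The ring ℤ[x,A,B][y]/(y^2 - (x^3 + A x + B)); a pair (a , b) stands for a + b y.
E : Set
E = PolyxAB × PolyxAB

infixl 6 _+ᴱ_ _-ᴱ_
infixl 7 _*ᴱ_

_+ᴱ_ : E → E → E
(a , b) +ᴱ (c , d) = (a P3.⊕ c , b P3.⊕ d)

-ᴱ_ : E → E
-ᴱ (a , b) = (P3.neg a , P3.neg b)

_-ᴱ_ : E → E → E
u -ᴱ v = u +ᴱ (-ᴱ v)

-- (a + b y)(c + d y) = (a c + f b d) + (a d + b c) y, using y^2 = f
_*ᴱ_ : E → E → E
(a , b) *ᴱ (c , d) = ((a P3.⊗ c) P3.⊕ (fP P3.⊗ (b P3.⊗ d)) , (a P3.⊗ d) P3.⊕ (b P3.⊗ c))

_^ᴱ_ : E → ℕ → E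
u ^ᴱ zero = (constP (+ 1) , [])
u ^ᴱ suc n = u *ᴱ (u ^ᴱ n)

κ : ℤ → E
κ n = (constP n , [])

xE AE BE yE : E
xE = (xP , [])
AE = (AP , [])
BE = (BP , [])
yE = ([] , constP (+ 1))

infix 4 _≈ᴱ_
_≈ᴱ_ : E → E → Set
(a , b) ≈ᴱ (c , d) =
  (∀ i j k → coeffxAB a i j k ≡ coeffxAB c i j k) ×
  (∀ i j k → coeffxAB b i j k ≡ coeffxAB d i j k)

ψ3def : E
ψ3def = κ (+ 3) *ᴱ xE ^ᴱ 4 +ᴱ κ (+ 6) *ᴱ AE *ᴱ xE ^ᴱ 2 +ᴱ κ (+ 12) *ᴱ BE *ᴱ xE -ᴱ AE ^ᴱ 2

ψ4def : E
ψ4def = κ (+ 2) *ᴱ yE *ᴱ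
  ( κ (+ 2) *ᴱ xE ^ᴱ 6 +ᴱ κ (+ 10) *ᴱ AE *ᴱ xE ^ᴱ 4 +ᴱ κ (+ 40) *ᴱ BE *ᴱ xE ^ᴱ 3
    -ᴱ κ (+ 10) *ᴱ AE ^ᴱ 2 *ᴱ xE ^ᴱ 2 -ᴱ κ (+ 8) *ᴱ AE *ᴱ BE *ᴱ xE
    -ᴱ κ (+ 2) *ᴱ (AE ^ᴱ 3 +ᴱ κ (+ 8) *ᴱ BE ^ᴱ 2) )

-- ψ is the sequence of division polynomials of y^2 = x^3 + A x + B:
-- it satisfies the initial values and the two recursions (the even one
-- determines ψ_{2m} uniquely since the ring is an integral domain).
record IsDivisionPolySeq (ψ : ℕ → E) : Set where
  field
    ψ0 : ψ 0 ≈ᴱ κ (+ 0)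
    ψ1 : ψ 1 ≈ᴱ κ (+ 1)
    ψ2 : ψ 2 ≈ᴱ κ (+ 2) *ᴱ yE
    ψ3 : ψ 3 ≈ᴱ ψ3def
    ψ4 : ψ 4 ≈ᴱ ψ4def
    ψodd : ∀ m → 2 ≤ m →
      ψ (suc (2 ℕ.* m)) ≈ᴱ ψ (m ℕ.+ 2) *ᴱ ψ m ^ᴱ 3 -ᴱ ψ (m ∸ 1) *ᴱ ψ (m ℕ.+ 1) ^ᴱ 3
    ψeven : ∀ m → 2 ≤ m →
      κ (+ 2) *ᴱ yE *ᴱ ψ (2 ℕ.* m) ≈ᴱ
        ψ (m ∸ 1) ^ᴱ 2 *ᴱ ψ m *ᴱ ψ (m ℕ.+ 2) -ᴱ ψ (m ∸ 2) *ᴱ ψ m *ᴱ ψ (m ℕ.+ 1) ^ᴱ 2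

-- ℓ_p : coefficient of x^{p(p-1)/2} in ψ_p (ψ_p for odd p lies in ℤ[x,A,B],
-- i.e. it is the y-free component of ψ p)
ℓ : (ℕ → E) → ℕ → PolyAB
ℓ ψ p = P3.coeff (proj₁ (ψ p)) ((p ℕ.* (p ∸ 1)) / 2)

c : ℕ → PolyAB
c p = P3.coeff (powP fP ((p ∸ 1) / 2)) (p ∸ 1)

{-# OPTIONS --safe #-}
-- Parametrise the curve by x = ℘(z), y = -℘′(z)/2, so that ψₙ = σ(nz)/σ(z)^(n²), and use the local
-- parameter t = 1/√x at infinity. With w = y t³ one has w² = 1 + At⁴ + Bt⁶, dt/dz = w and
-- dw/dz = 2At³ + 3Bt⁵, so t, w and σ are exponential generating series in z with coefficients in ℤ[A,B].
-- That σ(nz)/σ(z)^(n²) satisfies the recursions follows from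
--   σ(u+v)σ(u-v) = σ(u)²Q(v) - σ(v)²Q(u),  Q = σ²℘,
-- which holds because the logarithms of both sides solve the wave equation with the same Cauchy data at v = 0.
-- For a prime p = 2h + 1, comparing modulo p² the coefficients of z^p/p! in
--   t^(p²) ψ_p(1/t²) = t^(p²) σ(pz)/σ(z)^(p²)
-- and modulo p the coefficients of z^(p-1)/(p-1)! in
--   w t^(6h) f(1/t²)^h = w^p,  f = x³ + Ax + B,
-- gives (p-1)! ℓ_p + w_{p-1} ≡ 0 and (p-1)! c_p + w_{p-1} ≡ 0 modulo p, where w_{p-1} is the value
-- of d^(p-1)w/dz^(p-1) at z = 0.
module Submission where

open import Defs
open import Data.Nat using (ℕ; _≤_)
open import Data.Nat.Primality using (Prime)
open import Data.Integer using (+_)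
open import Algebra.Bundles using (CommutativeRing; RawRing)
open import Algebra.Solver.Ring.AlmostCommutativeRing using (fromCommutativeRing; _-Raw-AlmostCommutative⟶_)
open import Data.Empty using (⊥-elim)
open import Data.Fin using (Fin)
open import Data.Fin.Patterns using (0F; 1F; 2F; 3F; 4F; 5F; 6F)
open import Data.Integer as ℤ using (ℤ; -[1+_])
open import Data.List using ([]; _∷_; length)
open import Data.Maybe using (Maybe; just; nothing)
open import Data.Nat as ℕ using (zero; suc; _<_; s≤s; z≤n; _!)
open import Data.Nat.Coprimality using (Coprime; prime⇒coprime; coprime-Bézout)
open import Data.Nat.GCD using (module Bézout)
open import Data.Nat.Induction using (<-rec)
open import Data.Nat.Primality using (euclidsLemma; ¬prime[0]; ¬prime[1]; prime⇒irreducible)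
open import Data.Product using (_,_; ∃; proj₁; proj₂)
open import Data.Sum using (_⊎_; inj₁; inj₂)
open import Data.Vec using (Vec; []; _∷_; lookup; tabulate)
open import Data.Vec.Properties using (lookup∘tabulate)
open import Level using (_⊔_)
open import Relation.Binary.PropositionalEquality as ≡ using (_≡_)
open import Relation.Nullary using (yes; no)
import Algebra.Properties.CommutativeSemigroup as CommutativeSemigroupProperties
import Algebra.Properties.CommutativeSemiring.Exp as CommutativeSemiringExp
import Algebra.Properties.Ring as RingProperties
import Algebra.Properties.Semiring.Exp as SemiringExp
import Algebra.Properties.Semiring.Mult as SemiringMult
import Algebra.Solver.Ring as RingSolver
import Data.Integer.Divisibility.Signed as Signed
import Data.Integer.Properties as ℤₚ
import Data.Nat.Divisibility as ℕ∣
import Data.Nat.Properties as ℕₚ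
import Data.Nat.Solver
import Relation.Binary.Reasoning.Setoid as SetoidReasoning

-- Exponential generating series keep everything integral: d/dz is a shift, and a differential
-- equation is solved by iterating a derivation, without dividing by n!. The price is that every
-- quotient of the classical theory becomes a cancellation: of integers by torsion-freeness, of w by
-- its constant term 1, of t and σ by their leading term z. Since x = 1/t² and y = w/t³ have poles,
-- they live in the localisation at t, and identities return to series once denominators are
-- cleared. The first comparison must be made modulo p² because modulo p it is empty: σ(pz) is
-- divisible by p, and so is the factor p! in front of ℓ_p. The leading coefficient of ψ_p is p, and
-- each coefficient strictly between it and ℓ_p is divisible by p and multiplies some t^m with 1 < m
-- < p, whose coefficient at z^p/p! supplies another p. So only p! ℓ_p and p t_p = p w_{p-1}
-- survive. In the second comparison the same w_{p-1} comes from the leading coefficient 1 of f^h.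
-- Both wanted coefficients lie h places below the top, which is why the two computations run in
-- parallel.

module ℕS = Data.Nat.Solver.+-*-Solver

-- Integers in a commutative ring

module FromIntegers {c ℓ} (R : CommutativeRing c ℓ) where
  open CommutativeRing R
  open RingProperties ring
  open SemiringMult semiring
  open SetoidReasoning setoid

  #_ : ℕ → Carrier
  # n = n × 1#

  infix 9 #_

  fromℤ : ℤ → Carrier
  fromℤ (+ n) = # n
  fromℤ -[1+ n ] = - # suc n

  #-+ : ∀ m n → # (m ℕ.+ n) ≈ # m + # n
  #-+ = ×-homo-+ 1#

  #-* : ∀ m n → # (m ℕ.* n) ≈ # m * # n
  #-* = ×1-homo-*

  #1≈1 : # 1 ≈ 1#
  #1≈1 = +-identityʳ 1#

  private
    cancel-suc : ∀ x y → x - y ≈ (1# + x) - (1# + y)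
    cancel-suc x y = sym (begin
      (1# + x) - (1# + y)       ≈⟨ +-congˡ (-‿+-comm 1# y) ⟨
      (1# + x) + (- 1# + - y)   ≈⟨ +-congʳ (+-comm 1# x) ⟩
      (x + 1#) + (- 1# + - y)   ≈⟨ +-assoc x 1# _ ⟩
      x + (1# + (- 1# + - y))   ≈⟨ +-congˡ (+-assoc 1# _ _) ⟨
      x + ((1# + - 1#) + - y)   ≈⟨ +-congˡ (trans (+-congʳ (-‿inverseʳ 1#)) (+-identityˡ _)) ⟩
      x - y                     ∎)

  fromℤ-⊖ : ∀ m n → fromℤ (m ℤ.⊖ n) ≈ # m - # n
  fromℤ-⊖ zero zero = sym (-‿inverseʳ 0#)
  fromℤ-⊖ zero (suc n) = sym (+-identityˡ _)
  fromℤ-⊖ (suc m) zero = sym (trans (+-congˡ -0#≈0#) (+-identityʳ _))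
  fromℤ-⊖ (suc m) (suc n) = begin
    fromℤ (suc m ℤ.⊖ suc n) ≡⟨ ≡.cong fromℤ (ℤₚ.[1+m]⊖[1+n]≡m⊖n m n) ⟩
    fromℤ (m ℤ.⊖ n)         ≈⟨ fromℤ-⊖ m n ⟩
    # m - # n               ≈⟨ cancel-suc (# m) (# n) ⟩
    # suc m - # suc n       ∎

  fromℤ-+ : ∀ i j → fromℤ (i ℤ.+ j) ≈ fromℤ i + fromℤ j
  fromℤ-+ (+ m) (+ n) = #-+ m n
  fromℤ-+ (+ m) -[1+ n ] = fromℤ-⊖ m (suc n)
  fromℤ-+ -[1+ m ] (+ n) = trans (fromℤ-⊖ n (suc m)) (+-comm _ _)
  fromℤ-+ -[1+ m ] -[1+ n ] = begin
    - # suc (suc (m ℕ.+ n))     ≡⟨ ≡.cong (λ k → - # suc k) (ℕₚ.+-suc m n) ⟨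
    - # (suc m ℕ.+ suc n)       ≈⟨ -‿cong (#-+ (suc m) (suc n)) ⟩
    - (# suc m + # suc n)       ≈⟨ -‿+-comm _ _ ⟨
    - # suc m + - # suc n       ∎

  fromℤ-neg : ∀ i → fromℤ (ℤ.- i) ≈ - fromℤ i
  fromℤ-neg (+ zero) = sym -0#≈0#
  fromℤ-neg (+ suc n) = refl
  fromℤ-neg -[1+ n ] = sym (-‿involutive _)

  private
    pos*neg : ∀ m n → fromℤ (+ m ℤ.* -[1+ n ]) ≈ # m * - # suc n
    pos*neg m n = begin
      fromℤ (+ m ℤ.* -[1+ n ])     ≡⟨ ≡.cong fromℤ (ℤₚ.neg-distribʳ-* (+ m) (+ suc n)) ⟨
      fromℤ (ℤ.- (+ m ℤ.* + suc n)) ≈⟨ fromℤ-neg (+ m ℤ.* + suc n) ⟩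
      - fromℤ (+ m ℤ.* + suc n)    ≡⟨ ≡.cong (λ k → - fromℤ k) (ℤₚ.pos-* m (suc n)) ⟨
      - # (m ℕ.* suc n)            ≈⟨ -‿cong (#-* m (suc n)) ⟩
      - (# m * # suc n)            ≈⟨ -‿distribʳ-* _ _ ⟩
      # m * - # suc n              ∎

  fromℤ-* : ∀ i j → fromℤ (i ℤ.* j) ≈ fromℤ i * fromℤ j
  fromℤ-* (+ m) (+ n) = trans (reflexive (≡.cong fromℤ (≡.sym (ℤₚ.pos-* m n)))) (#-* m n)
  fromℤ-* (+ m) -[1+ n ] = pos*neg m n
  fromℤ-* -[1+ m ] (+ n) =
    trans (reflexive (≡.cong fromℤ (ℤₚ.*-comm -[1+ m ] (+ n)))) (trans (pos*neg n m) (*-comm _ _))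
  fromℤ-* -[1+ m ] -[1+ n ] = begin
    # (suc m ℕ.* suc n)          ≈⟨ #-* (suc m) (suc n) ⟩
    # suc m * # suc n            ≈⟨ -‿involutive _ ⟨
    - (- (# suc m * # suc n))    ≈⟨ -‿cong (-‿distribʳ-* _ _) ⟩
    - (# suc m * - # suc n)      ≈⟨ -‿distribˡ-* _ _ ⟩
    - # suc m * - # suc n        ∎

  private
    ℤ-rawRing : RawRing _ _
    ℤ-rawRing = CommutativeRing.rawRing ℤₚ.+-*-commutativeRing

    homomorphism : ℤ-rawRing -Raw-AlmostCommutative⟶ fromCommutativeRing R
    homomorphism = record
      { ⟦_⟧ = fromℤ ; +-homo = fromℤ-+ ; *-homo = fromℤ-* ; -‿homo = fromℤ-neg
      ; 0-homo = refl ; 1-homo = #1≈1 }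

    coefficient≟ : ∀ i j → Maybe (fromℤ i ≈ fromℤ j)
    coefficient≟ i j with i ℤ.≟ j
    ... | yes i≡j = just (reflexive (≡.cong fromℤ i≡j))
    ... | no _ = nothing

  -- Integer coefficients have decidable equality, so identities can be normalised in rings whose
  -- own equality is undecidable.
  module Solver = RingSolver ℤ-rawRing (fromCommutativeRing R) homomorphism coefficient≟

-- Derivations, power series and exponential generating series

record Hom {a ℓa b ℓb} (A : CommutativeRing a ℓa) (B : CommutativeRing b ℓb) : Set (a ⊔ ℓa ⊔ b ⊔ ℓb) where
  private
    module A = CommutativeRing A
    module B = CommutativeRing B
    module FA = FromIntegers A
    module FB = FromIntegers B
    open RingProperties B.ring
    open SemiringExp A.semiring using () renaming (_^_ to _^A_)
    open SemiringExp B.semiring using () renaming (_^_ to _^B_)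
  field
    ⟦_⟧ : A.Carrier → B.Carrier
    ⟦⟧-cong : ∀ {x y} → x A.≈ y → ⟦ x ⟧ B.≈ ⟦ y ⟧
    +-homo : ∀ x y → ⟦ x A.+ y ⟧ B.≈ ⟦ x ⟧ B.+ ⟦ y ⟧
    *-homo : ∀ x y → ⟦ x A.* y ⟧ B.≈ ⟦ x ⟧ B.* ⟦ y ⟧
    1-homo : ⟦ A.1# ⟧ B.≈ B.1#

  0-homo : ⟦ A.0# ⟧ B.≈ B.0#
  0-homo = +-cancelˡ ⟦ A.0# ⟧ _ _
    (B.trans (B.sym (+-homo A.0# A.0#)) (B.trans (⟦⟧-cong (A.+-identityʳ A.0#)) (B.sym (B.+-identityʳ _))))

  neg-homo : ∀ x → ⟦ A.- x ⟧ B.≈ B.- ⟦ x ⟧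
  neg-homo x = +-cancelˡ ⟦ x ⟧ _ _
    (B.trans (B.sym (+-homo x (A.- x))) (B.trans (⟦⟧-cong (A.-‿inverseʳ x)) (B.trans 0-homo (B.sym (B.-‿inverseʳ _)))))

  minus-homo : ∀ x y → ⟦ x A.- y ⟧ B.≈ ⟦ x ⟧ B.- ⟦ y ⟧
  minus-homo x y = B.trans (+-homo x (A.- y)) (B.+-congˡ (neg-homo y))

  #-homo : ∀ n → ⟦ FA.# n ⟧ B.≈ FB.# n
  #-homo zero = 0-homo
  #-homo (suc n) = B.trans (+-homo A.1# (FA.# n)) (B.+-cong 1-homo (#-homo n))

  fromℤ-homo : ∀ z → ⟦ FA.fromℤ z ⟧ B.≈ FB.fromℤ z
  fromℤ-homo (+ n) = #-homo n
  fromℤ-homo -[1+ n ] = B.trans (neg-homo _) (B.-‿cong (#-homo (suc n)))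

  ^-homo : ∀ x n → ⟦ x ^A n ⟧ B.≈ ⟦ x ⟧ ^B n
  ^-homo x zero = 1-homo
  ^-homo x (suc n) = B.trans (*-homo x (x ^A n)) (B.*-congˡ (^-homo x n))

  image-* : ∀ {x y x′ y′} → ⟦ x ⟧ B.≈ x′ → ⟦ y ⟧ B.≈ y′ → ⟦ x A.* y ⟧ B.≈ x′ B.* y′
  image-* p q = B.trans (*-homo _ _) (B.*-cong p q)

  image-minus : ∀ {x y x′ y′} → ⟦ x ⟧ B.≈ x′ → ⟦ y ⟧ B.≈ y′ → ⟦ x A.- y ⟧ B.≈ x′ B.- y′
  image-minus p q = B.trans (minus-homo _ _) (B.+-cong p (B.-‿cong q))

  image-+ : ∀ {x y x′ y′} → ⟦ x ⟧ B.≈ x′ → ⟦ y ⟧ B.≈ y′ → ⟦ x A.+ y ⟧ B.≈ x′ B.+ y′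
  image-+ p q = B.trans (+-homo _ _) (B.+-cong p q)

id-hom : ∀ {a ℓ} (A : CommutativeRing a ℓ) → Hom A A
id-hom A = record { ⟦_⟧ = λ x → x ; ⟦⟧-cong = λ e → e ; +-homo = λ _ _ → refl ; *-homo = λ _ _ → refl ; 1-homo = refl }
  where open CommutativeRing A

infixr 9 _∘-hom_
_∘-hom_ : ∀ {a ℓa b ℓb c ℓc} {A : CommutativeRing a ℓa} {B : CommutativeRing b ℓb} {C : CommutativeRing c ℓc} →
          Hom B C → Hom A B → Hom A C
_∘-hom_ {C = C} g f = record
  { ⟦_⟧ = λ x → G.⟦ F.⟦ x ⟧ ⟧
  ; ⟦⟧-cong = λ e → G.⟦⟧-cong (F.⟦⟧-cong e)
  ; +-homo = λ x y → trans (G.⟦⟧-cong (F.+-homo x y)) (G.+-homo _ _)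
  ; *-homo = λ x y → trans (G.⟦⟧-cong (F.*-homo x y)) (G.*-homo _ _)
  ; 1-homo = trans (G.⟦⟧-cong F.1-homo) G.1-homo }
  where
  open CommutativeRing C
  module F = Hom f
  module G = Hom g

record Derivation {c ℓ} (R : CommutativeRing c ℓ) : Set (c ⊔ ℓ) where
  open CommutativeRing R
  open RingProperties ring
  open FromIntegers R
  open SemiringExp semiring
  open SetoidReasoning setoid
  field
    ∂ : Carrier → Carrier
    ∂-cong : ∀ {x y} → x ≈ y → ∂ x ≈ ∂ y
    ∂-+ : ∀ x y → ∂ (x + y) ≈ ∂ x + ∂ y
    ∂-* : ∀ x y → ∂ (x * y) ≈ ∂ x * y + x * ∂ y

  ∂-0 : ∂ 0# ≈ 0#
  ∂-0 = +-cancelˡ (∂ 0#) _ _ (trans (sym (∂-+ 0# 0#)) (trans (∂-cong (+-identityʳ 0#)) (sym (+-identityʳ _))))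

  ∂-neg : ∀ x → ∂ (- x) ≈ - ∂ x
  ∂-neg x = +-cancelˡ (∂ x) _ _
    (trans (sym (∂-+ x (- x))) (trans (∂-cong (-‿inverseʳ x)) (trans ∂-0 (sym (-‿inverseʳ _)))))

  ∂-minus : ∀ x y → ∂ (x - y) ≈ ∂ x - ∂ y
  ∂-minus x y = trans (∂-+ x (- y)) (+-congˡ (∂-neg y))

  ∂-1 : ∂ 1# ≈ 0#
  ∂-1 = +-cancelˡ (∂ 1#) _ _ (begin
    ∂ 1# + ∂ 1#             ≈⟨ +-cong (sym (*-identityʳ _)) (sym (*-identityˡ _)) ⟩
    ∂ 1# * 1# + 1# * ∂ 1#   ≈⟨ ∂-* 1# 1# ⟨
    ∂ (1# * 1#)             ≈⟨ ∂-cong (*-identityʳ 1#) ⟩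
    ∂ 1#                    ≈⟨ +-identityʳ _ ⟨
    ∂ 1# + 0#               ∎)

  ∂-# : ∀ n → ∂ (# n) ≈ 0#
  ∂-# zero = ∂-0
  ∂-# (suc n) = trans (∂-+ 1# (# n)) (trans (+-cong ∂-1 (∂-# n)) (+-identityʳ 0#))

  ∂-constˡ : ∀ {k} → ∂ k ≈ 0# → ∀ x → ∂ (k * x) ≈ k * ∂ x
  ∂-constˡ {k} ∂k≈0 x = begin
    ∂ (k * x)           ≈⟨ ∂-* k x ⟩
    ∂ k * x + k * ∂ x   ≈⟨ +-congʳ (trans (*-congʳ ∂k≈0) (zeroˡ x)) ⟩
    0# + k * ∂ x        ≈⟨ +-identityˡ _ ⟩
    k * ∂ x             ∎

  ∂-^ : ∀ x n → ∂ (x ^ suc n) ≈ # suc n * (x ^ n * ∂ x)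
  ∂-^ x zero = trans (∂-cong (*-identityʳ x)) (sym (trans (*-congʳ #1≈1) (trans (*-identityˡ _) (*-identityˡ _))))
  ∂-^ x (suc n) = begin
    ∂ (x * x ^ suc n)                                   ≈⟨ ∂-* x (x ^ suc n) ⟩
    ∂ x * x ^ suc n + x * ∂ (x ^ suc n)                 ≈⟨ +-congˡ (*-congˡ (∂-^ x n)) ⟩
    ∂ x * (x * x ^ n) + x * (# suc n * (x ^ n * ∂ x))   ≈⟨ solve 4 (λ d x p k → d :* (x :* p) :+ x :* (k :* (p :* d)) := (con (+ 1) :+ k) :* ((x :* p) :* d)) refl (∂ x) x (x ^ n) (# suc n) ⟩
    (# 1 + # suc n) * (x ^ suc n * ∂ x)                 ≈⟨ *-congʳ (+-congʳ #1≈1) ⟩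
    # suc (suc n) * (x ^ suc n * ∂ x)                   ∎
    where open Solver using (solve; _:=_; con; _:+_; _:*_)

module _ {c ℓ} {R : CommutativeRing c ℓ} where
  open CommutativeRing R
  open FromIntegers R
  open Solver using (solve; _:=_; _:+_; _:*_)
  open Derivation

  infixl 7 _·ᵈ_
  infixl 6 _+ᵈ_

  _·ᵈ_ : Carrier → Derivation R → Derivation R
  k ·ᵈ d = record
    { ∂ = λ x → k * ∂ d x
    ; ∂-cong = λ e → *-congˡ (∂-cong d e)
    ; ∂-+ = λ x y → trans (*-congˡ (∂-+ d x y)) (distribˡ k _ _)
    ; ∂-* = λ x y → trans (*-congˡ (∂-* d x y))
        (solve 5 (λ k x y dx dy → k :* (dx :* y :+ x :* dy) := (k :* dx) :* y :+ x :* (k :* dy)) refl k x y _ _) }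

  _+ᵈ_ : Derivation R → Derivation R → Derivation R
  d +ᵈ e = record
    { ∂ = λ x → ∂ d x + ∂ e x
    ; ∂-cong = λ q → +-cong (∂-cong d q) (∂-cong e q)
    ; ∂-+ = λ x y → trans (+-cong (∂-+ d x y) (∂-+ e x y))
        (solve 4 (λ a b c d → (a :+ b) :+ (c :+ d) := (a :+ c) :+ (b :+ d)) refl _ _ _ _)
    ; ∂-* = λ x y → trans (+-cong (∂-* d x y) (∂-* e x y))
        (solve 6 (λ x y a b c d → (a :* y :+ x :* b) :+ (c :* y :+ x :* d) := (a :+ c) :* y :+ x :* (b :+ d)) refl x y _ _ _ _) }

module Sequences {c ℓ} (C : CommutativeRing c ℓ) where
  open CommutativeRing C

  Sequence : Set c
  Sequence = ℕ → Carrier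

  infix 4 _≋_
  -- A record rather than a plain function type, so that the two sequences can be inferred from the
  -- type of an equation.
  record _≋_ (f g : Sequence) : Set ℓ where
    constructor pointwise
    field at : ∀ n → f n ≈ g n
  open _≋_ public

  tail : Sequence → Sequence
  tail f n = f (suc n)

  tail-cong : ∀ {f g} → f ≋ g → tail f ≋ tail g
  tail-cong e = pointwise (λ n → at e (suc n))

  infixl 6 _⊞_
  _⊞_ : Sequence → Sequence → Sequence
  (f ⊞ g) n = f n + g n

  unit : Carrier → Sequence
  unit a zero = a
  unit a (suc n) = 0#

  -- The two products on sequences used below share their additive structure, so only the
  -- multiplicative laws are asked for.
  sequenceRing : (_⊠_ : Sequence → Sequence → Sequence) →
    (∀ {f f′ g g′} → f ≋ f′ → g ≋ g′ → f ⊠ g ≋ f′ ⊠ g′) →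
    (∀ f g h → (f ⊠ g) ⊠ h ≋ f ⊠ (g ⊠ h)) →
    (∀ f g → f ⊠ g ≋ g ⊠ f) →
    (∀ f → unit 1# ⊠ f ≋ f) →
    (∀ f g h → f ⊠ (g ⊞ h) ≋ (f ⊠ g) ⊞ (f ⊠ h)) →
    CommutativeRing c ℓ
  sequenceRing _⊠_ ⊠-cong ⊠-assoc ⊠-comm ⊠-identityˡ ⊠-distribˡ = record
    { Carrier = Sequence
    ; _≈_ = _≋_
    ; _+_ = _⊞_
    ; _*_ = _⊠_
    ; -_ = λ f n → - f n
    ; 0# = λ _ → 0#
    ; 1# = unit 1#
    ; isCommutativeRing = record
      { isRing = record
        { +-isAbelianGroup = record
          { isGroup = record
            { isMonoid = record
              { isSemigroup = record
                { isMagma = record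
                  { isEquivalence = record
                    { refl = pointwise (λ _ → refl)
                    ; sym = λ p → pointwise (λ n → sym (at p n))
                    ; trans = ≋-trans }
                  ; ∙-cong = ⊞-cong }
                ; assoc = λ f g h → pointwise (λ n → +-assoc _ _ _) }
              ; identity = (λ f → pointwise (λ n → +-identityˡ _)) , (λ f → pointwise (λ n → +-identityʳ _)) }
            ; inverse = (λ f → pointwise (λ n → -‿inverseˡ _)) , (λ f → pointwise (λ n → -‿inverseʳ _))
            ; ⁻¹-cong = λ p → pointwise (λ n → -‿cong (at p n)) }
          ; comm = λ f g → pointwise (λ n → +-comm _ _) }
        ; *-cong = ⊠-cong
        ; *-assoc = ⊠-assoc
        ; *-identity = ⊠-identityˡ , (λ f → ≋-trans (⊠-comm f _) (⊠-identityˡ f))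
        ; distrib = ⊠-distribˡ , (λ f g h →
            ≋-trans (⊠-comm _ f) (≋-trans (⊠-distribˡ f g h) (⊞-cong (⊠-comm f g) (⊠-comm f h)))) }
      ; *-comm = ⊠-comm } }
    where
    ≋-trans : ∀ {f g h} → f ≋ g → g ≋ h → f ≋ h
    ≋-trans p q = pointwise (λ n → trans (at p n) (at q n))
    ⊞-cong : ∀ {f f′ g g′} → f ≋ f′ → g ≋ g′ → f ⊞ g ≋ f′ ⊞ g′
    ⊞-cong p q = pointwise (λ n → +-cong (at p n) (at q n))

module PowerSeries {c ℓ} (C : CommutativeRing c ℓ) where
  open CommutativeRing C
  open Sequences C
  open CommutativeSemigroupProperties +-commutativeSemigroup using (interchange)
  open SetoidReasoning setoid

  infixl 7 _⊠_
  _⊠_ : Sequence → Sequence → Sequence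
  (f ⊠ g) zero = f 0 * g 0
  (f ⊠ g) (suc n) = f 0 * g (suc n) + (tail f ⊠ g) n

  private
    cong-at : ∀ {f f′ g g′} → f ≋ f′ → g ≋ g′ → ∀ n → (f ⊠ g) n ≈ (f′ ⊠ g′) n
    cong-at p q zero = *-cong (at p 0) (at q 0)
    cong-at p q (suc n) = +-cong (*-cong (at p 0) (at q (suc n))) (cong-at (tail-cong p) q n)

    -- The same product peeled from the other end; commutativity compares the two ends.
    suc-right : ∀ f g n → (f ⊠ g) (suc n) ≈ (f ⊠ tail g) n + f (suc n) * g 0
    suc-right f g zero = refl
    suc-right f g (suc n) = trans (+-congˡ (suc-right (tail f) g n)) (sym (+-assoc _ _ _))

    comm-at : ∀ f g n → (f ⊠ g) n ≈ (g ⊠ f) n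
    comm-at f g zero = *-comm _ _
    comm-at f g (suc n) = begin
      f 0 * g (suc n) + (tail f ⊠ g) n   ≈⟨ +-cong (*-comm _ _) (comm-at (tail f) g n) ⟩
      g (suc n) * f 0 + (g ⊠ tail f) n   ≈⟨ +-comm _ _ ⟩
      (g ⊠ tail f) n + g (suc n) * f 0   ≈⟨ suc-right g f n ⟨
      (g ⊠ f) (suc n)                    ∎

    distrib-at : ∀ f g h n → (f ⊠ (g ⊞ h)) n ≈ (f ⊠ g) n + (f ⊠ h) n
    distrib-at f g h zero = distribˡ _ _ _
    distrib-at f g h (suc n) = trans (+-cong (distribˡ _ _ _) (distrib-at (tail f) g h n)) (interchange _ _ _ _)

    distribʳ-at : ∀ f g h n → ((g ⊞ h) ⊠ f) n ≈ (g ⊠ f) n + (h ⊠ f) n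
    distribʳ-at f g h n = trans (comm-at _ f n) (trans (distrib-at f g h n) (+-cong (comm-at f g n) (comm-at f h n)))

    scalar-at : ∀ a f g n → ((λ i → a * f i) ⊠ g) n ≈ a * (f ⊠ g) n
    scalar-at a f g zero = *-assoc _ _ _
    scalar-at a f g (suc n) = trans (+-cong (*-assoc _ _ _) (scalar-at a (tail f) g n)) (sym (distribˡ _ _ _))

    assoc-at : ∀ f g h n → ((f ⊠ g) ⊠ h) n ≈ (f ⊠ (g ⊠ h)) n
    assoc-at f g h zero = *-assoc _ _ _
    assoc-at f g h (suc n) = begin
      (f 0 * g 0) * h (suc n) + (tail (f ⊠ g) ⊠ h) n
        ≈⟨ +-cong (*-assoc _ _ _) (distribʳ-at h (λ i → f 0 * g (suc i)) (tail f ⊠ g) n) ⟩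
      f 0 * (g 0 * h (suc n)) + (((λ i → f 0 * g (suc i)) ⊠ h) n + ((tail f ⊠ g) ⊠ h) n)
        ≈⟨ +-congˡ (+-cong (scalar-at (f 0) (tail g) h n) (assoc-at (tail f) g h n)) ⟩
      f 0 * (g 0 * h (suc n)) + (f 0 * (tail g ⊠ h) n + (tail f ⊠ (g ⊠ h)) n)
        ≈⟨ +-assoc _ _ _ ⟨
      (f 0 * (g 0 * h (suc n)) + f 0 * (tail g ⊠ h) n) + (tail f ⊠ (g ⊠ h)) n
        ≈⟨ +-congʳ (distribˡ _ _ _) ⟨
      f 0 * (g ⊠ h) (suc n) + (tail f ⊠ (g ⊠ h)) n ∎

    zero-at : ∀ f n → ((λ _ → 0#) ⊠ f) n ≈ 0#
    zero-at f zero = zeroˡ _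
    zero-at f (suc n) = trans (+-cong (zeroˡ _) (zero-at f n)) (+-identityˡ 0#)

  scalar-⊠ : ∀ a f n → (unit a ⊠ f) n ≈ a * f n
  scalar-⊠ a f zero = refl
  scalar-⊠ a f (suc n) = trans (+-congˡ (zero-at f n)) (+-identityʳ _)

  powerSeriesRing : CommutativeRing c ℓ
  powerSeriesRing = sequenceRing _⊠_ (λ p q → pointwise (cong-at p q))
    (λ f g h → pointwise (assoc-at f g h)) (λ f g → pointwise (comm-at f g))
    (λ f → pointwise (λ n → trans (scalar-⊠ 1# f n) (*-identityˡ _)))
    (λ f g h → pointwise (distrib-at f g h))

-- A sequence f stands for the exponential generating series Σ fₙ zⁿ/n!, so that the shift is d/dz.
module Hurwitz {c ℓ} (C : CommutativeRing c ℓ) where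
  private module C = CommutativeRing C
  open CommutativeRing C
  open Sequences C public
  open CommutativeSemigroupProperties +-commutativeSemigroup using (interchange)
  open SetoidReasoning setoid

  infixl 7 _⊠_
  -- The Leibniz rule is taken as the definition, so the shift is a derivation by `refl` and no
  -- binomial coefficient has to be handled until a single coefficient is studied.
  _⊠_ : Sequence → Sequence → Sequence
  (f ⊠ g) zero = f 0 * g 0
  (f ⊠ g) (suc n) = (tail f ⊠ g) n + (f ⊠ tail g) n

  private
    cong-at : ∀ {f f′ g g′} → f ≋ f′ → g ≋ g′ → ∀ n → (f ⊠ g) n ≈ (f′ ⊠ g′) n
    cong-at p q zero = *-cong (at p 0) (at q 0)
    cong-at p q (suc n) = +-cong (cong-at (tail-cong p) q n) (cong-at p (tail-cong q) n)

    comm-at : ∀ f g n → (f ⊠ g) n ≈ (g ⊠ f) n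
    comm-at f g zero = *-comm _ _
    comm-at f g (suc n) = trans (+-cong (comm-at (tail f) g n) (comm-at f (tail g) n)) (+-comm _ _)

    distrib-at : ∀ f g h n → (f ⊠ (g ⊞ h)) n ≈ (f ⊠ g) n + (f ⊠ h) n
    distrib-at f g h zero = distribˡ _ _ _
    distrib-at f g h (suc n) =
      trans (+-cong (distrib-at (tail f) g h n) (distrib-at f (tail g) (tail h) n)) (interchange _ _ _ _)

    distribʳ-at : ∀ f g h n → ((g ⊞ h) ⊠ f) n ≈ (g ⊠ f) n + (h ⊠ f) n
    distribʳ-at f g h n = trans (comm-at _ f n) (trans (distrib-at f g h n) (+-cong (comm-at f g n) (comm-at f h n)))

    assoc-at : ∀ f g h n → ((f ⊠ g) ⊠ h) n ≈ (f ⊠ (g ⊠ h)) n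
    assoc-at f g h zero = *-assoc _ _ _
    assoc-at f g h (suc n) = begin
      (tail (f ⊠ g) ⊠ h) n + ((f ⊠ g) ⊠ tail h) n
        ≈⟨ +-congʳ (distribʳ-at h (tail f ⊠ g) (f ⊠ tail g) n) ⟩
      (((tail f ⊠ g) ⊠ h) n + ((f ⊠ tail g) ⊠ h) n) + ((f ⊠ g) ⊠ tail h) n
        ≈⟨ +-cong (+-cong (assoc-at (tail f) g h n) (assoc-at f (tail g) h n)) (assoc-at f g (tail h) n) ⟩
      ((tail f ⊠ (g ⊠ h)) n + (f ⊠ (tail g ⊠ h)) n) + (f ⊠ (g ⊠ tail h)) n
        ≈⟨ +-assoc _ _ _ ⟩
      (tail f ⊠ (g ⊠ h)) n + ((f ⊠ (tail g ⊠ h)) n + (f ⊠ (g ⊠ tail h)) n)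
        ≈⟨ +-congˡ (distrib-at f (tail g ⊠ h) (g ⊠ tail h) n) ⟨
      (tail f ⊠ (g ⊠ h)) n + (f ⊠ tail (g ⊠ h)) n ∎

    zero-at : ∀ f n → ((λ _ → 0#) ⊠ f) n ≈ 0#
    zero-at f zero = zeroˡ _
    zero-at f (suc n) = trans (+-cong (zero-at f n) (zero-at (tail f) n)) (+-identityˡ 0#)

  scalar-⊠ : ∀ a f n → (unit a ⊠ f) n ≈ a * f n
  scalar-⊠ a f zero = refl
  scalar-⊠ a f (suc n) = trans (+-cong (zero-at f n) (scalar-⊠ a (tail f) n)) (+-identityˡ _)

  hurwitzRing : CommutativeRing c ℓ
  hurwitzRing = sequenceRing _⊠_ (λ p q → pointwise (cong-at p q))
    (λ f g h → pointwise (assoc-at f g h)) (λ f g → pointwise (comm-at f g))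
    (λ f → pointwise (λ n → trans (scalar-⊠ 1# f n) (*-identityˡ _)))
    (λ f g h → pointwise (distrib-at f g h))

  shift : Derivation hurwitzRing
  shift = record
    { ∂ = tail
    ; ∂-cong = tail-cong
    ; ∂-+ = λ f g → pointwise (λ n → refl)
    ; ∂-* = λ f g → pointwise (λ n → refl) }

  -- The shift forgets nothing but the constant term. Identities between solutions of differential
  -- equations are proved by differentiating both sides.
  ≋-by-∂ : ∀ {f g} → f 0 ≈ g 0 → tail f ≋ tail g → f ≋ g
  ≋-by-∂ p q = pointwise (λ { zero → p ; (suc n) → at q n })

  head : Hom hurwitzRing C
  head = record
    { ⟦_⟧ = λ f → f 0 ; ⟦⟧-cong = λ e → at e 0
    ; +-homo = λ f g → refl ; *-homo = λ f g → refl ; 1-homo = refl }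

  constant : Hom C hurwitzRing
  constant = record
    { ⟦_⟧ = unit
    ; ⟦⟧-cong = λ e → pointwise (λ { zero → e ; (suc n) → refl })
    ; +-homo = λ a b → pointwise (λ { zero → refl ; (suc n) → sym (+-identityˡ 0#) })
    ; *-homo = λ a b → pointwise (λ { zero → refl ; (suc n) → sym (trans (scalar-⊠ a (unit b) (suc n)) (zeroʳ a)) })
    ; 1-homo = pointwise (λ n → refl) }

  open FromIntegers C using (#_)
  open FromIntegers hurwitzRing using () renaming (#_ to #ᴴ_)

  #-at : ∀ k f n → (#ᴴ k ⊠ f) n ≈ # k * f n
  #-at k f n = trans (cong-at (CommutativeRing.sym hurwitzRing (Hom.#-homo constant k)) (CommutativeRing.refl hurwitzRing {f}) n) (scalar-⊠ (# k) f n)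

  -- For series in v whose coefficients are series in u this is the derivative in u.
  pointwiseDerivation : Derivation C → Derivation hurwitzRing
  pointwiseDerivation d = record
    { ∂ = λ f n → ∂ d (f n)
    ; ∂-cong = λ e → pointwise (λ n → ∂-cong d (at e n))
    ; ∂-+ = λ f g → pointwise (λ n → ∂-+ d _ _)
    ; ∂-* = λ f g → pointwise (product-rule f g) }
    where
    open Derivation
    product-rule : ∀ f g n → ∂ d ((f ⊠ g) n) ≈ ((λ i → ∂ d (f i)) ⊠ g) n + (f ⊠ (λ i → ∂ d (g i))) n
    product-rule f g zero = ∂-* d _ _
    product-rule f g (suc n) = trans (∂-+ d _ _)
      (trans (+-cong (product-rule (tail f) g n) (product-rule f (tail g) n)) (interchange _ _ _ _))

  -- The Taylor expansion b ↦ Σ ε(∂ⁿ b) zⁿ/n! along a derivation.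
  module Taylor {b ℓb} (B : CommutativeRing b ℓb) (d : Derivation B) (ε : Hom B C) where
    private
      module B = CommutativeRing B
      module ε = Hom ε
    open Derivation d

    expand : B.Carrier → Sequence
    expand x zero = ε.⟦ x ⟧
    expand x (suc n) = expand (∂ x) n

    private
      exp-cong : ∀ n {x y} → x B.≈ y → expand x n ≈ expand y n
      exp-cong zero e = ε.⟦⟧-cong e
      exp-cong (suc n) e = exp-cong n (∂-cong e)

      exp-+ : ∀ n x y → expand (x B.+ y) n ≈ expand x n + expand y n
      exp-+ zero x y = ε.+-homo x y
      exp-+ (suc n) x y = trans (exp-cong n (∂-+ x y)) (exp-+ n _ _)

      exp-* : ∀ n x y → expand (x B.* y) n ≈ (expand x ⊠ expand y) n
      exp-* zero x y = ε.*-homo x y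
      exp-* (suc n) x y = trans (exp-cong n (∂-* x y)) (trans (exp-+ n _ _) (+-cong (exp-* n (∂ x) y) (exp-* n x (∂ y))))

      exp-0 : ∀ n → expand B.0# n ≈ 0#
      exp-0 zero = ε.0-homo
      exp-0 (suc n) = trans (exp-cong n ∂-0) (exp-0 n)

      exp-1 : ∀ n → expand B.1# n ≈ unit 1# n
      exp-1 zero = ε.1-homo
      exp-1 (suc n) = trans (exp-cong n ∂-1) (exp-0 n)

    -- Multiplicativity holds because `_⊠_` obeys the same Leibniz recursion as the iterated
    -- derivation.
    hom : Hom B hurwitzRing
    hom = record
      { ⟦_⟧ = expand
      ; ⟦⟧-cong = λ e → pointwise (λ n → exp-cong n e)
      ; +-homo = λ x y → pointwise (λ n → exp-+ n x y)
      ; *-homo = λ x y → pointwise (λ n → exp-* n x y)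
      ; 1-homo = pointwise exp-1 }

-- Divisibility by integers and coefficients of products

-- binomial i j is the binomial coefficient (i + j choose i).
binomial : ℕ → ℕ → ℕ
binomial zero j = 1
binomial (suc i) zero = 1
binomial (suc i) (suc j) = binomial i (suc j) ℕ.+ binomial (suc i) j

-- The two absorption identities are proved by mutual recursion: Pascal's rule splits each into one
-- instance of either kind.
binomial-sucˡ : ∀ i j → suc i ℕ.* binomial (suc i) j ≡ suc (i ℕ.+ j) ℕ.* binomial i j
binomial-sucʳ : ∀ i j → suc j ℕ.* binomial i (suc j) ≡ suc (i ℕ.+ j) ℕ.* binomial i j

binomial-sucˡ i zero = ≡.cong₂ (λ a b → suc a ℕ.* b) (≡.sym (ℕₚ.+-identityʳ i)) (binomial-zeroʳ i)
  where
  binomial-zeroʳ : ∀ i → 1 ≡ binomial i 0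
  binomial-zeroʳ zero = ≡.refl
  binomial-zeroʳ (suc i) = ≡.refl
binomial-sucˡ i (suc j) = begin
  suc i ℕ.* (b ℕ.+ binomial (suc i) j)          ≡⟨ ℕₚ.*-distribˡ-+ (suc i) b _ ⟩
  suc i ℕ.* b ℕ.+ suc i ℕ.* binomial (suc i) j  ≡⟨ ≡.cong (suc i ℕ.* b ℕ.+_) (≡.trans (binomial-sucˡ i j) (≡.sym (binomial-sucʳ i j))) ⟩
  suc i ℕ.* b ℕ.+ suc j ℕ.* b                   ≡⟨ ℕₚ.*-distribʳ-+ b (suc i) (suc j) ⟨
  suc (i ℕ.+ suc j) ℕ.* b                       ∎
  where
  open ≡.≡-Reasoning
  b = binomial i (suc j)
binomial-sucʳ zero j = ≡.refl
binomial-sucʳ (suc i) j = begin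
  suc j ℕ.* (binomial i (suc j) ℕ.+ b)          ≡⟨ ℕₚ.*-distribˡ-+ (suc j) (binomial i (suc j)) b ⟩
  suc j ℕ.* binomial i (suc j) ℕ.+ suc j ℕ.* b  ≡⟨ ≡.cong (ℕ._+ suc j ℕ.* b) (≡.trans (binomial-sucʳ i j) (≡.sym (binomial-sucˡ i j))) ⟩
  suc i ℕ.* b ℕ.+ suc j ℕ.* b                   ≡⟨ ℕₚ.*-distribʳ-+ b (suc i) (suc j) ⟨
  (suc i ℕ.+ suc j) ℕ.* b                       ≡⟨ ≡.cong (ℕ._* b) (ℕₚ.+-suc (suc i) j) ⟩
  suc (suc i ℕ.+ j) ℕ.* b                       ∎
  where
  open ≡.≡-Reasoning
  b = binomial (suc i) j

-- Absorption makes (i + 1) times the binomial coefficient a multiple of p, and p does not divide i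
-- + 1 < p.
prime∣binomial : ∀ {p} → Prime p → ∀ i j → suc i ℕ.+ suc j ≡ p → p ℕ∣.∣ binomial (suc i) (suc j)
prime∣binomial {p} p-prime i j ≡.refl with euclidsLemma (suc i) (binomial (suc i) (suc j)) p-prime
  (ℕ∣.divides (binomial i (suc j)) (≡.trans (binomial-sucˡ i (suc j)) (ℕₚ.*-comm p _)))
... | inj₂ p∣b = p∣b
... | inj₁ p∣1+i = ⊥-elim (ℕₚ.<⇒≱ (ℕₚ.m<m+n (suc i) (s≤s z≤n)) (ℕ∣.∣⇒≤ p∣1+i))

module Divisibility {c ℓ} (R : CommutativeRing c ℓ) where
  open CommutativeRing R
  open FromIntegers R
  open Solver using (solve; _:=_; con; _:+_; _:*_; _:-_; :-_)
  open SetoidReasoning setoid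

  infix 4 _∣#_
  infixr 3 _by_
  record _∣#_ (n : ℕ) (x : Carrier) : Set (c ⊔ ℓ) where
    constructor _by_
    field
      quotient : Carrier
      equality : x ≈ # n * quotient

  ∣#-resp : ∀ {n x y} → x ≈ y → n ∣# x → n ∣# y
  ∣#-resp e (z by q) = z by trans (sym e) q

  ∣#-0 : ∀ {n} → n ∣# 0#
  ∣#-0 = 0# by sym (zeroʳ _)

  ∣#-+ : ∀ {n x y} → n ∣# x → n ∣# y → n ∣# (x + y)
  ∣#-+ (a by p) (b by q) = a + b by trans (+-cong p q) (sym (distribˡ _ a b))

  ∣#-*ʳ : ∀ {n x} y → n ∣# x → n ∣# (x * y)
  ∣#-*ʳ y (a by p) = a * y by trans (*-congʳ p) (*-assoc _ a y)

  ∣#-*ˡ : ∀ {n x} y → n ∣# x → n ∣# (y * x)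
  ∣#-*ˡ y d = ∣#-resp (*-comm _ y) (∣#-*ʳ y d)

  ∣#-neg : ∀ {n x} → n ∣# x → n ∣# (- x)
  ∣#-neg {n} {x} (a by p) = - a by trans (-‿cong p) (solve 2 (λ n a → :- (n :* a) := n :* (:- a)) refl (# n) a)

  ∣#-minus : ∀ {n x y} → n ∣# x → n ∣# y → n ∣# (x - y)
  ∣#-minus p q = ∣#-+ p (∣#-neg q)

  ∣#-self : ∀ n → n ∣# # n
  ∣#-self n = 1# by sym (*-identityʳ _)

  ∣⇒∣# : ∀ {m n} → m ℕ∣.∣ n → m ∣# # n
  ∣⇒∣# {m} (ℕ∣.divides q ≡.refl) = # q by trans (#-* q m) (*-comm _ _)

  coprime-∣#-cancel : ∀ {n k x} → Coprime n k → n ∣# # k * x → n ∣# x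
  coprime-∣#-cancel {n} {k} {x} coprime n∣kx with coprime-Bézout coprime
  -- Bézout expresses 1 as an integer combination of n and k, hence x as one of n x and k x, both
  -- divisible by n. This works in any commutative ring.
  ... | Bézout.+- u v 1+vk≡un = ∣#-resp {x = # u * (# n * x) - # v * (# k * x)} lemma
          (∣#-minus (∣#-*ˡ (# u) (∣#-*ʳ x (∣#-self n))) (∣#-*ˡ (# v) n∣kx))
    where
    lemma : # u * (# n * x) - # v * (# k * x) ≈ x
    lemma = begin
      # u * (# n * x) - # v * (# k * x)                 ≈⟨ +-congʳ (trans (sym (*-assoc _ _ x)) (*-congʳ (trans (sym (#-* u n)) (trans (reflexive (≡.cong #_ (≡.sym 1+vk≡un))) (+-congˡ (#-* v k)))))) ⟩
      (1# + # v * # k) * x - # v * (# k * x)            ≈⟨ +-congʳ (*-congʳ (+-congʳ #1≈1)) ⟨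
      (# 1 + # v * # k) * x - # v * (# k * x)           ≈⟨ solve 3 (λ v k x → (con (+ 1) :+ v :* k) :* x :- v :* (k :* x) := con (+ 1) :* x) refl (# v) (# k) x ⟩
      # 1 * x                                           ≈⟨ trans (*-congʳ #1≈1) (*-identityˡ x) ⟩
      x                                                 ∎
  ... | Bézout.-+ u v 1+un≡vk = ∣#-resp {x = # v * (# k * x) - # u * (# n * x)} lemma
          (∣#-minus (∣#-*ˡ (# v) n∣kx) (∣#-*ˡ (# u) (∣#-*ʳ x (∣#-self n))))
    where
    lemma : # v * (# k * x) - # u * (# n * x) ≈ x
    lemma = begin
      # v * (# k * x) - # u * (# n * x)                 ≈⟨ +-congʳ (trans (sym (*-assoc _ _ x)) (*-congʳ (trans (sym (#-* v k)) (trans (reflexive (≡.cong #_ (≡.sym 1+un≡vk))) (+-congˡ (#-* u n)))))) ⟩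
      (1# + # u * # n) * x - # u * (# n * x)            ≈⟨ +-congʳ (*-congʳ (+-congʳ #1≈1)) ⟨
      (# 1 + # u * # n) * x - # u * (# n * x)           ≈⟨ solve 3 (λ v k x → (con (+ 1) :+ v :* k) :* x :- v :* (k :* x) := con (+ 1) :* x) refl (# u) (# n) x ⟩
      # 1 * x                                           ≈⟨ trans (*-congʳ #1≈1) (*-identityˡ x) ⟩
      x                                                 ∎

  module _ {p} (p-prime : Prime p) where
    prime-∣#-cancel : ∀ {k x} → suc k < p → p ∣# # suc k * x → p ∣# x
    prime-∣#-cancel {k} 1+k<p = coprime-∣#-cancel (prime⇒coprime p-prime 1+k<p)

    prime-∣#-cancel-! : ∀ k {x} → k < p → p ∣# # (k !) * x → p ∣# x
    prime-∣#-cancel-! zero _ d = ∣#-resp (trans (*-congʳ #1≈1) (*-identityˡ _)) d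
    prime-∣#-cancel-! (suc k) {x} 1+k<p d = prime-∣#-cancel-! k (ℕₚ.<-trans (ℕₚ.n<1+n k) 1+k<p)
      (prime-∣#-cancel 1+k<p (∣#-resp (trans (*-congʳ (#-* (suc k) (k !))) (*-assoc _ _ x)) d))

  TorsionFree : Set _
  TorsionFree = ∀ n {x} → # suc n * x ≈ 0# → x ≈ 0#

module HurwitzCoefficients {c ℓ} (C : CommutativeRing c ℓ) where
  open CommutativeRing C
  open Hurwitz C
  open FromIntegers C
  open Divisibility C
  open SetoidReasoning setoid
  private module H = CommutativeRing hurwitzRing
  open SemiringExp H.semiring using (_^_)

  Below : ℕ → Sequence → Set _
  Below n f = ∀ j → j < n → f j ≈ 0#

  below-tail : ∀ {n f} → Below (suc n) f → Below n (tail f)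
  below-tail b j j<n = b (suc j) (s≤s j<n)

  below-weaken : ∀ {m n f} → m ≤ n → Below n f → Below m f
  below-weaken m≤n b j j<m = b j (ℕₚ.<-≤-trans j<m m≤n)

  below-⊠ : ∀ {n f} g → Below n f → Below n (f ⊠ g)
  below-⊠ g b zero 0<n = trans (*-congʳ (b 0 0<n)) (zeroˡ _)
  below-⊠ {suc n} {f} g b (suc j) (s≤s j<n) = trans
    (+-cong (below-⊠ g (below-tail {f = f} b) j j<n)
            (below-⊠ {f = f} (tail g) (below-weaken {f = f} (ℕₚ.n≤1+n n) b) j j<n)) (+-identityˡ 0#)

  ⊠-at : ∀ n {f} g → Below n f → (f ⊠ g) n ≈ f n * g 0
  ⊠-at zero g b = refl
  ⊠-at (suc n) {f} g b = trans
    (+-cong (⊠-at n g (below-tail {f = f} b)) (below-⊠ {f = f} (tail g) b n (ℕₚ.n<1+n n))) (+-identityʳ _)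

  -- The integer factor comes from the exponential normalisation: z · zⁿ/n! = (n + 1) zⁿ⁺¹/(n + 1)!.
  ⊠-at-suc : ∀ n {f} g → g 0 ≈ 0# → Below n f → (f ⊠ g) (suc n) ≈ # suc n * (f n * g 1)
  ⊠-at-suc zero {f} g g₀≈0 b = begin
    f 1 * g 0 + f 0 * g 1  ≈⟨ +-cong (trans (*-congˡ g₀≈0) (zeroʳ _)) (sym (*-identityˡ _)) ⟩
    0# + 1# * (f 0 * g 1)  ≈⟨ +-identityˡ _ ⟩
    1# * (f 0 * g 1)       ≈⟨ *-congʳ #1≈1 ⟨
    # 1 * (f 0 * g 1)      ∎
  ⊠-at-suc (suc n) {f} g g₀≈0 b = begin
    (tail f ⊠ g) (suc n) + (f ⊠ tail g) (suc n)        ≈⟨ +-cong (⊠-at-suc n g g₀≈0 (below-tail {f = f} b)) (⊠-at (suc n) (tail g) b) ⟩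
    # suc n * x + x                                    ≈⟨ +-comm _ _ ⟩
    x + # suc n * x                                    ≈⟨ +-congʳ (*-identityˡ x) ⟨
    1# * x + # suc n * x                               ≈⟨ distribʳ x 1# _ ⟨
    # suc (suc n) * x                                  ∎
    where x = f (suc n) * g 1

  below-suc-⊠ : ∀ {n f} g → g 0 ≈ 0# → Below n f → Below (suc n) (f ⊠ g)
  below-suc-⊠ {n} {f} g g₀≈0 b j (s≤s j≤n) with ℕₚ.m≤n⇒m<n∨m≡n j≤n
  ... | inj₁ j<n = below-⊠ g b j j<n
  ... | inj₂ ≡.refl = trans (⊠-at n g b) (trans (*-congˡ g₀≈0) (zeroʳ _))

  -- Complete induction on the order. In this form a leading coefficient argument shows that a
  -- series is a non-zero-divisor.
  regular-by-below : ∀ {f} → (∀ n → Below n f → f n ≈ 0#) → f ≋ H.0#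
  regular-by-below {f} step = pointwise (λ n → all (suc n) n (ℕₚ.n<1+n n))
    where
    all : ∀ n → Below n f
    all (suc n) j (s≤s j≤n) with ℕₚ.m≤n⇒m<n∨m≡n j≤n
    ... | inj₁ j<n = all n j j<n
    ... | inj₂ ≡.refl = step j (all j)

  below-^ : ∀ {t} → t 0 ≈ 0# → ∀ n → Below n (t ^ n)
  below-^ t₀≈0 zero j ()
  below-^ {t} t₀≈0 (suc n) j j<1+n = trans (at (H.*-comm t (t ^ n)) j) (below-suc-⊠ {f = t ^ n} t t₀≈0 (below-^ t₀≈0 n) j j<1+n)

  -- t^n = z^n + ..., and z^n has exponential coefficient n!.
  ^-at : ∀ {t} → t 0 ≈ 0# → t 1 ≈ 1# → ∀ n → (t ^ n) n ≈ # (n !)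
  ^-at t₀≈0 t₁≈1 zero = sym #1≈1
  ^-at {t} t₀≈0 t₁≈1 (suc n) = begin
    (t ⊠ t ^ n) (suc n)         ≈⟨ at (H.*-comm t (t ^ n)) (suc n) ⟩
    (t ^ n ⊠ t) (suc n)         ≈⟨ ⊠-at-suc n t t₀≈0 (below-^ t₀≈0 n) ⟩
    # suc n * ((t ^ n) n * t 1) ≈⟨ *-congˡ (*-cong (^-at t₀≈0 t₁≈1 n) t₁≈1) ⟩
    # suc n * (# (n !) * 1#)    ≈⟨ *-congˡ (*-identityʳ _) ⟩
    # suc n * # (n !)           ≈⟨ #-* (suc n) (n !) ⟨
    # (suc n !)                 ∎

  antidiagonal : ℕ → (ℕ → ℕ → Carrier) → Carrier
  antidiagonal zero h = h 0 0
  antidiagonal (suc n) h = h 0 (suc n) + antidiagonal n (λ i j → h (suc i) j)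

  private
    antidiagonal-cong : ∀ n {h h′} → (∀ i j → h i j ≈ h′ i j) → antidiagonal n h ≈ antidiagonal n h′
    antidiagonal-cong zero e = e 0 0
    antidiagonal-cong (suc n) e = +-cong (e 0 (suc n)) (antidiagonal-cong n (λ i j → e (suc i) j))

    antidiagonal-+ : ∀ n h h′ → antidiagonal n (λ i j → h i j + h′ i j) ≈ antidiagonal n h + antidiagonal n h′
    antidiagonal-+ zero h h′ = refl
    antidiagonal-+ (suc n) h h′ = trans (+-congˡ (antidiagonal-+ n _ _))
      (solve 4 (λ a b c d → (a :+ b) :+ (c :+ d) := (a :+ c) :+ (b :+ d)) refl _ _ _ _)
      where open Solver using (solve; _:=_; _:+_)

  antidiagonal-last : ∀ n h → antidiagonal (suc n) h ≈ antidiagonal n (λ i j → h i (suc j)) + h (suc n) 0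
  antidiagonal-last zero h = refl
  antidiagonal-last (suc n) h = trans (+-congˡ (antidiagonal-last n (λ i j → h (suc i) j))) (sym (+-assoc _ _ _))

  private
    weighted : (ℕ → ℕ → Carrier) → ℕ → ℕ → Carrier
    weighted k i j = # binomial i j * k i j

    -- Pascal's rule splits the inner terms between the two sums; the end terms, with binomial
    -- coefficient 1, go whole to one sum each.
    pascal : ∀ n k → antidiagonal (suc n) (weighted k) ≈
      antidiagonal n (λ i j → # binomial i j * k (suc i) j) + antidiagonal n (λ i j → # binomial i j * k i (suc j))
    pascal zero k = +-comm _ _
    pascal (suc n) k = begin
      a + antidiagonal (suc n) (λ i j → weighted k (suc i) j)
        ≈⟨ +-congˡ (antidiagonal-last n (λ i j → weighted k (suc i) j)) ⟩
      a + (antidiagonal n (λ i j → weighted k (suc i) (suc j)) + z)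
        ≈⟨ +-congˡ (+-congʳ (trans (antidiagonal-cong n (λ i j → trans (*-congʳ (#-+ (binomial i (suc j)) _)) (distribʳ _ _ _))) (antidiagonal-+ n _ _))) ⟩
      a + ((u + v) + z)
        ≈⟨ solve 4 (λ a u v z → a :+ ((u :+ v) :+ z) := (u :+ z) :+ (a :+ v)) refl a u v z ⟩
      (u + z) + (a + v)
        ≈⟨ +-congʳ (antidiagonal-last n (λ i j → # binomial i j * k (suc i) j)) ⟨
      antidiagonal (suc n) (λ i j → # binomial i j * k (suc i) j) + antidiagonal (suc n) (λ i j → # binomial i j * k i (suc j)) ∎
      where
      open Solver using (solve; _:=_; _:+_)
      a = weighted k 0 (suc (suc n))
      z = weighted k (suc (suc n)) 0
      u = antidiagonal n (λ i j → # binomial i (suc j) * k (suc i) (suc j))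
      v = antidiagonal n (λ i j → # binomial (suc i) j * k (suc i) (suc j))

  ⊠-binomial : ∀ n f g → (f ⊠ g) n ≈ antidiagonal n (λ i j → # binomial i j * (f i * g j))
  ⊠-binomial zero f g = sym (trans (*-congʳ #1≈1) (*-identityˡ _))
  ⊠-binomial (suc n) f g = trans (+-cong (⊠-binomial n (tail f) g) (⊠-binomial n f (tail g)))
    (sym (pascal n (λ i j → f i * g j)))

  antidiagonal-∣# : ∀ {m} n h → (∀ i j → i ℕ.+ j ≡ n → m ∣# h i j) → m ∣# antidiagonal n h
  antidiagonal-∣# zero h d = d 0 0 ≡.refl
  antidiagonal-∣# (suc n) h d = ∣#-+ (d 0 (suc n) ≡.refl) (antidiagonal-∣# n _ (λ i j e → d (suc i) j (≡.cong suc e)))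

  -- Modulo p only the outer terms of the binomial formula for the p-th coefficient survive.
  ⊠-at-prime : ∀ {p} → Prime p → ∀ f g → p ∣# (f 0 * g p + f p * g 0) → p ∣# (f ⊠ g) p
  ⊠-at-prime {zero} p-prime f g d = ⊥-elim (¬prime[0] p-prime)
  ⊠-at-prime {suc zero} p-prime f g d = ⊥-elim (¬prime[1] p-prime)
  ⊠-at-prime {p@(suc (suc n))} p-prime f g d = ∣#-resp (sym expansion) (∣#-+ d inner)
    where
    open Solver using (solve; _:=_; _:+_)
    h : ℕ → ℕ → Carrier
    h i j = # binomial i j * (f i * g j)
    expansion : (f ⊠ g) p ≈ (f 0 * g p + f p * g 0) + antidiagonal n (λ i j → h (suc i) (suc j))
    expansion = begin
      (f ⊠ g) p                  ≈⟨ ⊠-binomial p f g ⟩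
      h 0 p + antidiagonal (suc n) (λ i j → h (suc i) j)
        ≈⟨ +-congˡ (antidiagonal-last n (λ i j → h (suc i) j)) ⟩
      h 0 p + (antidiagonal n (λ i j → h (suc i) (suc j)) + h p 0)
        ≈⟨ solve 3 (λ a b c → a :+ (b :+ c) := (a :+ c) :+ b) refl _ _ _ ⟩
      (h 0 p + h p 0) + antidiagonal n (λ i j → h (suc i) (suc j))
        ≈⟨ +-congʳ (+-cong (trans (*-congʳ #1≈1) (*-identityˡ _)) (trans (*-congʳ #1≈1) (*-identityˡ _))) ⟩
      (f 0 * g p + f p * g 0) + antidiagonal n (λ i j → h (suc i) (suc j)) ∎
    inner : p ∣# antidiagonal n (λ i j → h (suc i) (suc j))
    inner = antidiagonal-∣# n _ (λ i j e → ∣#-*ʳ _ (∣⇒∣# (prime∣binomial p-prime i j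
      (≡.trans (≡.cong suc (ℕₚ.+-suc i j)) (≡.cong (λ k → suc (suc k)) e)))))

-- The differential system and the wave equation

infixl 6 _⟨+⟩_
infixl 7 _⟨*⟩_
-- Polynomials are kept as syntax so that derivatives are computed by `diff`, after which identities
-- between them are decided by comparing normal forms.
data Expr (n : ℕ) : Set where
  int : ℤ → Expr n
  var : Fin n → Expr n
  _⟨+⟩_ _⟨*⟩_ : Expr n → Expr n → Expr n

infixl 6 _⟨-⟩_
_⟨-⟩_ : ∀ {n} → Expr n → Expr n → Expr n
e ⟨-⟩ f = e ⟨+⟩ int -[1+ 0 ] ⟨*⟩ f

infixr 8 _⟨^⟩_
_⟨^⟩_ : ∀ {n} → Expr n → ℕ → Expr n
e ⟨^⟩ zero = int (+ 1)
-- A clause of its own for exponent 1 leaves no trailing factor 1 in evaluated powers.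
e ⟨^⟩ suc zero = e
e ⟨^⟩ suc (suc k) = e ⟨*⟩ e ⟨^⟩ suc k

diff : ∀ {n} → (Fin n → Expr n) → Expr n → Expr n
diff δ (int z) = int (+ 0)
diff δ (var i) = δ i
diff δ (e ⟨+⟩ f) = diff δ e ⟨+⟩ diff δ f
diff δ (e ⟨*⟩ f) = diff δ e ⟨*⟩ f ⟨+⟩ e ⟨*⟩ diff δ f

module Evaluation {c ℓ} (R : CommutativeRing c ℓ) where
  open CommutativeRing R
  open FromIntegers R
  open Solver using (Polynomial; op; [+]; [*]; con; ⟦_⟧; ⟦_⟧↓; prove)

  polynomial : ∀ {n} → Expr n → Polynomial n
  polynomial (int z) = con z
  polynomial (var i) = Solver.var i
  polynomial (e ⟨+⟩ f) = op [+] (polynomial e) (polynomial f)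
  polynomial (e ⟨*⟩ f) = op [*] (polynomial e) (polynomial f)

  eval : ∀ {n} → Vec Carrier n → Expr n → Carrier
  eval ρ e = ⟦ polynomial e ⟧ ρ

  -- The two normal forms agree by computation, so call sites discharge this obligation with `refl`.
  SameNormalForm : ∀ {n} → Vec Carrier n → Expr n → Expr n → Set _
  SameNormalForm ρ e f = ⟦ polynomial e ⟧↓ ρ ≈ ⟦ polynomial f ⟧↓ ρ

  identity : ∀ {n} (ρ : Vec Carrier n) e f → SameNormalForm ρ e f → eval ρ e ≈ eval ρ f
  identity ρ e f = prove ρ (polynomial e) (polynomial f)

  fromℤ-∂ : ∀ (d : Derivation R) z → Derivation.∂ d (fromℤ z) ≈ 0#
  fromℤ-∂ d (+ n) = Derivation.∂-# d n
  fromℤ-∂ d -[1+ n ] = trans (∂-neg _) (trans (-‿cong (∂-# (suc n))) -0#≈0#)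
    where
    open Derivation d
    open RingProperties (CommutativeRing.ring R) using (-0#≈0#)

  ∂-eval : ∀ {n} (d : Derivation R) (ρ : Vec Carrier n) δ →
    (∀ i → Derivation.∂ d (lookup ρ i) ≈ eval ρ (δ i)) → ∀ e → Derivation.∂ d (eval ρ e) ≈ eval ρ (diff δ e)
  ∂-eval d ρ δ h (int z) = fromℤ-∂ d z
  ∂-eval d ρ δ h (var i) = h i
  ∂-eval d ρ δ h (e ⟨+⟩ f) = trans (∂-+ _ _) (+-cong (∂-eval d ρ δ h e) (∂-eval d ρ δ h f))
    where open Derivation d
  ∂-eval d ρ δ h (e ⟨*⟩ f) = trans (∂-* _ _) (+-cong (*-congʳ (∂-eval d ρ δ h e)) (*-congˡ (∂-eval d ρ δ h f)))
    where open Derivation d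

-- The coordinates are A, B, t, w, r, χ, 1/χ: with x = ℘(z) and y = -℘′(z)/2 for the curve
-- y² = x³ + Ax + B we have t = 1/√x, w = y t³, χ = σ(z)/t and r = χ′/χ.
system : Fin 7 → Expr 7
system 0F = int (+ 0)
system 1F = int (+ 0)
system 2F = var 3F
system 3F = int (+ 2) ⟨*⟩ (var 0F ⟨*⟩ var 2F ⟨^⟩ 3) ⟨+⟩ int (+ 3) ⟨*⟩ (var 1F ⟨*⟩ var 2F ⟨^⟩ 5)
-- From r = ζ - w/t and ζ′ = -℘ = -1/t² the poles cancel: r′ = -1/t² - w′/t + w²/t² = -(At² + 2Bt⁴).
system 4F = int -[1+ 0 ] ⟨*⟩ (var 0F ⟨*⟩ var 2F ⟨^⟩ 2 ⟨+⟩ int (+ 2) ⟨*⟩ (var 1F ⟨*⟩ var 2F ⟨^⟩ 4))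
system 5F = var 4F ⟨*⟩ var 5F
system 6F = int -[1+ 0 ] ⟨*⟩ (var 4F ⟨*⟩ var 6F)

curve : Expr 7
curve = int (+ 1) ⟨+⟩ var 0F ⟨*⟩ var 2F ⟨^⟩ 4 ⟨+⟩ var 1F ⟨*⟩ var 2F ⟨^⟩ 6

relation : Expr 7
relation = var 3F ⟨*⟩ var 3F ⟨-⟩ curve

module _ {c ℓ} (R : CommutativeRing c ℓ) (d : Derivation R) where
  open CommutativeRing R
  open FromIntegers R
  open Derivation d
  open Evaluation R

  -- Put S = σ² and Q = σ²℘. Then `SS` is (log S)″ = -2℘, `QQ` is (log Q)″ = -2a/℘ - 4b/℘², and `SQ`
  -- is ℘″ = 6℘² + 2a in the presence of `SS`, all cleared of denominators. These are the brackets
  -- that appear when F F″ - F′² is expanded for F = S₁Q₂ - S₂Q₁.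
  record Bilinear (a b S Q : Carrier) : Set ℓ where
    field
      SS : S * ∂ (∂ S) + # 2 * (S * Q) ≈ ∂ S * ∂ S
      SQ : S * ∂ (∂ Q) + Q * ∂ (∂ S) ≈ # 2 * (∂ S * ∂ Q) + # 2 * (Q * Q + a * (S * S))
      QQ : Q * ∂ (∂ Q) + (# 2 * (a * (S * Q)) + # 4 * (b * (S * S))) ≈ ∂ Q * ∂ Q

  record IsSystem (ρ : Vec Carrier 7) : Set ℓ where
    field
      ∂-var : ∀ i → ∂ (lookup ρ i) ≈ eval ρ (system i)
      w²≈ : eval ρ relation ≈ 0#
      χχ⁻¹≈1 : lookup ρ 5F * lookup ρ 6F ≈ 1#

    D : Expr 7 → Expr 7
    D = diff system

    ∂≈ : ∀ e → ∂ (eval ρ e) ≈ eval ρ (D e)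
    ∂≈ = ∂-eval d ρ system ∂-var

    ∂∂≈ : ∀ e → ∂ (∂ (eval ρ e)) ≈ eval ρ (D (D e))
    ∂∂≈ e = trans (∂-cong (∂≈ e)) (∂≈ (D e))

    -- The equation of the curve is not an identity of polynomials. The caller supplies the cofactor
    -- `g` of `relation`, and what remains is decided by normalisation.
    modulo-relation : ∀ e f g → SameNormalForm ρ e (f ⟨+⟩ g ⟨*⟩ relation) → eval ρ e ≈ eval ρ f
    modulo-relation e f g h = trans (identity ρ e (f ⟨+⟩ g ⟨*⟩ relation) h)
      (trans (+-congˡ (trans (*-congˡ w²≈) (zeroʳ _))) (+-identityʳ _))

    σᵉ Sᵉ Qᵉ : Expr 7
    σᵉ = var 2F ⟨*⟩ var 5F
    Sᵉ = σᵉ ⟨*⟩ σᵉ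
    Qᵉ = var 5F ⟨*⟩ var 5F

    bilinear : Bilinear (lookup ρ 0F) (lookup ρ 1F) (eval ρ Sᵉ) (eval ρ Qᵉ)
    bilinear = record
      { SS = trans (+-congʳ (*-congˡ (∂∂≈ Sᵉ))) (trans
          (modulo-relation (Sᵉ ⟨*⟩ D (D Sᵉ) ⟨+⟩ int (+ 2) ⟨*⟩ (Sᵉ ⟨*⟩ Qᵉ)) (D Sᵉ ⟨*⟩ D Sᵉ) (int -[1+ 1 ] ⟨*⟩ (Sᵉ ⟨*⟩ Qᵉ)) refl)
          (*-cong (sym (∂≈ Sᵉ)) (sym (∂≈ Sᵉ))))
      ; SQ = trans (+-cong (*-congˡ (∂∂≈ Qᵉ)) (*-congˡ (∂∂≈ Sᵉ))) (trans
          (modulo-relation (Sᵉ ⟨*⟩ D (D Qᵉ) ⟨+⟩ Qᵉ ⟨*⟩ D (D Sᵉ))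
            (int (+ 2) ⟨*⟩ (D Sᵉ ⟨*⟩ D Qᵉ) ⟨+⟩ int (+ 2) ⟨*⟩ (Qᵉ ⟨*⟩ Qᵉ ⟨+⟩ var 0F ⟨*⟩ (Sᵉ ⟨*⟩ Sᵉ)))
            (int (+ 2) ⟨*⟩ (Qᵉ ⟨*⟩ Qᵉ)) refl)
          (+-congʳ (*-congˡ (*-cong (sym (∂≈ Sᵉ)) (sym (∂≈ Qᵉ))))))
      ; QQ = trans (+-congʳ (*-congˡ (∂∂≈ Qᵉ))) (trans
          (identity ρ (Qᵉ ⟨*⟩ D (D Qᵉ) ⟨+⟩ (int (+ 2) ⟨*⟩ (var 0F ⟨*⟩ (Sᵉ ⟨*⟩ Qᵉ)) ⟨+⟩ int (+ 4) ⟨*⟩ (var 1F ⟨*⟩ (Sᵉ ⟨*⟩ Sᵉ))))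
            (D Qᵉ ⟨*⟩ D Qᵉ) refl)
          (*-cong (sym (∂≈ Qᵉ)) (sym (∂≈ Qᵉ)))) }

module _ {c ℓ} (R : CommutativeRing c ℓ) where
  open CommutativeRing R
  open FromIntegers R
  open Solver using (solve; _:=_; con; _:+_; _:*_)
  open Evaluation R

  -- w² - 1 - At⁴ - Bt⁶ is a first integral of `system` for arbitrary values of the variables, so
  -- the equation of the curve need only be checked at z = 0.
  relation-constant : ∀ ρ → eval ρ (diff system relation) ≈ 0#
  relation-constant ρ = identity ρ (diff system relation) (int (+ 0)) refl

  χχ⁻¹-constant : ∀ ρ → eval ρ (diff system (var 5F ⟨*⟩ var 6F)) ≈ 0#
  χχ⁻¹-constant ρ = identity ρ (diff system (var 5F ⟨*⟩ var 6F)) (int (+ 0)) refl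

  relation-initial : ∀ A B → eval (A ∷ B ∷ # 0 ∷ # 1 ∷ # 0 ∷ # 1 ∷ # 1 ∷ []) relation ≈ 0#
  relation-initial = solve 2 (λ A B → let z = con (+ 0) in
    con (+ 1) :* con (+ 1) :+ con -[1+ 0 ] :* (con (+ 1) :+ A :* (z :* (z :* (z :* z))) :+ B :* (z :* (z :* (z :* (z :* (z :* z)))))) := z) refl

module _ {c ℓ c′ ℓ′} {R : CommutativeRing c ℓ} {R′ : CommutativeRing c′ ℓ′}
  {d : Derivation R} {d′ : Derivation R′} (j : Hom R R′) where
  private
    module R = CommutativeRing R
    module R′ = CommutativeRing R′
  open Hom j
  open Derivation d
  open Derivation d′ using () renaming (∂ to ∂′; ∂-cong to ∂′-cong)

  -- Carries the one-variable equations to two-variable series, where `j` embeds a series as a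
  -- function of u or of v.
  transport : (∀ x → ∂′ ⟦ x ⟧ R′.≈ ⟦ ∂ x ⟧) →
    ∀ {a b S Q a′ b′} → ⟦ a ⟧ R′.≈ a′ → ⟦ b ⟧ R′.≈ b′ → Bilinear R d a b S Q → Bilinear R′ d′ a′ b′ ⟦ S ⟧ ⟦ Q ⟧
  transport commute {a} {b} {S} {Q} {a′} {b′} a≈ b≈ B = record
    { SS = R′.trans (R′.+-cong (x∂∂y S S) (R′.sym (R′.trans (*-homo _ _) (R′.*-cong (#-homo 2) (*-homo S Q)))))
        (R′.trans (R′.sym (+-homo _ _)) (R′.trans (⟦⟧-cong SS) (∂x∂y S S)))
    ; SQ = R′.trans (R′.+-cong (x∂∂y S Q) (x∂∂y Q S)) (R′.trans (R′.sym (+-homo _ _)) (R′.trans (⟦⟧-cong SQ)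
        (R′.trans (+-homo _ _) (R′.+-cong (R′.trans (*-homo _ _) (R′.*-cong (#-homo 2) (∂x∂y S Q)))
          (R′.trans (*-homo _ _) (R′.*-cong (#-homo 2) (R′.trans (+-homo _ _) (R′.+-cong (*-homo Q Q)
            (R′.trans (*-homo _ _) (R′.*-cong a≈ (*-homo S S)))))))))))
    ; QQ = R′.trans (R′.+-cong (x∂∂y Q Q) (R′.sym (R′.trans (+-homo _ _) (R′.+-cong
        (R′.trans (*-homo _ _) (R′.*-cong (#-homo 2) (R′.trans (*-homo _ _) (R′.*-cong a≈ (*-homo S Q)))))
        (R′.trans (*-homo _ _) (R′.*-cong (#-homo 4) (R′.trans (*-homo _ _) (R′.*-cong b≈ (*-homo S S)))))))))
        (R′.trans (R′.sym (+-homo _ _)) (R′.trans (⟦⟧-cong QQ) (∂x∂y Q Q))) }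
    where
    open Bilinear B
    x∂∂y : ∀ x y → ⟦ x ⟧ R′.* ∂′ (∂′ ⟦ y ⟧) R′.≈ ⟦ x R.* ∂ (∂ y) ⟧
    x∂∂y x y = R′.trans (R′.*-congˡ (R′.trans (∂′-cong (commute y)) (commute (∂ y)))) (R′.sym (*-homo _ _))
    ∂x∂y : ∀ x y → ⟦ ∂ x R.* ∂ y ⟧ R′.≈ ∂′ ⟦ x ⟧ R′.* ∂′ ⟦ y ⟧
    ∂x∂y x y = R′.trans (*-homo _ _) (R′.*-cong (R′.sym (commute x)) (R′.sym (commute y)))

-- The last three are σ^(n²) ψ_n(x, y) for n = 2, 3, 4, with x = 1/t², y = w/t³ and σ = tχ. `q₂ᵉ` is
-- t⁸ times the numerator x⁴ - 2Ax² - 8Bx + A² of the x-coordinate of a doubled point, so that χ⁸ q₂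
-- is σ(2z)²℘(2z).
q₂ᵉ σ₂ᵉ σ₃ᵉ σ₄ᵉ : Expr 7
q₂ᵉ = int (+ 1) ⟨-⟩ int (+ 2) ⟨*⟩ (var 0F ⟨*⟩ var 2F ⟨^⟩ 4) ⟨-⟩ int (+ 8) ⟨*⟩ (var 1F ⟨*⟩ var 2F ⟨^⟩ 6) ⟨+⟩ var 0F ⟨^⟩ 2 ⟨*⟩ var 2F ⟨^⟩ 8
σ₂ᵉ = int (+ 2) ⟨*⟩ (var 2F ⟨*⟩ var 3F) ⟨*⟩ var 5F ⟨^⟩ 4
σ₃ᵉ = var 2F ⟨*⟩ (int (+ 3) ⟨+⟩ int (+ 6) ⟨*⟩ (var 0F ⟨*⟩ var 2F ⟨^⟩ 4) ⟨+⟩ int (+ 12) ⟨*⟩ (var 1F ⟨*⟩ var 2F ⟨^⟩ 6) ⟨-⟩ var 0F ⟨^⟩ 2 ⟨*⟩ var 2F ⟨^⟩ 8) ⟨*⟩ var 5F ⟨^⟩ 9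
σ₄ᵉ = int (+ 4) ⟨*⟩ (var 2F ⟨*⟩ var 3F) ⟨*⟩
  (int (+ 1) ⟨+⟩ int (+ 5) ⟨*⟩ (var 0F ⟨*⟩ var 2F ⟨^⟩ 4) ⟨+⟩ int (+ 20) ⟨*⟩ (var 1F ⟨*⟩ var 2F ⟨^⟩ 6)
    ⟨-⟩ int (+ 5) ⟨*⟩ (var 0F ⟨^⟩ 2 ⟨*⟩ var 2F ⟨^⟩ 8) ⟨-⟩ int (+ 4) ⟨*⟩ (var 0F ⟨*⟩ var 1F ⟨*⟩ var 2F ⟨^⟩ 10)
    ⟨-⟩ (var 0F ⟨^⟩ 3 ⟨+⟩ int (+ 8) ⟨*⟩ var 1F ⟨^⟩ 2) ⟨*⟩ var 2F ⟨^⟩ 12) ⟨*⟩ var 5F ⟨^⟩ 16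

module _ {c ℓ} (R : CommutativeRing c ℓ) (d : Derivation R) where
  open CommutativeRing R

  module SmallMultiples {ρ : Vec Carrier 7} (sys : IsSystem R d ρ) where
    open Evaluation R
    open IsSystem sys

    -- ℘ = -(log σ)″, multiplied by σ².
    Q≈ : eval ρ Qᵉ ≈ eval ρ (D σᵉ ⟨*⟩ D σᵉ ⟨-⟩ σᵉ ⟨*⟩ D (D σᵉ))
    Q≈ = sym (modulo-relation (D σᵉ ⟨*⟩ D σᵉ ⟨-⟩ σᵉ ⟨*⟩ D (D σᵉ)) Qᵉ Qᵉ refl)

    σ₂≈ : eval ρ (D Sᵉ ⟨*⟩ Qᵉ ⟨-⟩ Sᵉ ⟨*⟩ D Qᵉ) ≈ eval ρ σ₂ᵉ
    σ₂≈ = identity ρ (D Sᵉ ⟨*⟩ Qᵉ ⟨-⟩ Sᵉ ⟨*⟩ D Qᵉ) σ₂ᵉ refl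

    -- ℘ = -(log σ)″ at 2z: two differentiations of σ(2z) in z bring the factor 4.
    4Q₂≈ : eval ρ (D σ₂ᵉ ⟨*⟩ D σ₂ᵉ ⟨-⟩ σ₂ᵉ ⟨*⟩ D (D σ₂ᵉ)) ≈ eval ρ (int (+ 4) ⟨*⟩ (var 5F ⟨^⟩ 8 ⟨*⟩ q₂ᵉ))
    4Q₂≈ = modulo-relation (D σ₂ᵉ ⟨*⟩ D σ₂ᵉ ⟨-⟩ σ₂ᵉ ⟨*⟩ D (D σ₂ᵉ)) (int (+ 4) ⟨*⟩ (var 5F ⟨^⟩ 8 ⟨*⟩ q₂ᵉ))
      (int (+ 4) ⟨*⟩ (var 5F ⟨^⟩ 8 ⟨*⟩ (var 3F ⟨*⟩ var 3F ⟨+⟩ int (+ 1) ⟨-⟩ int (+ 3) ⟨*⟩ (var 0F ⟨*⟩ var 2F ⟨^⟩ 4) ⟨-⟩ int (+ 9) ⟨*⟩ (var 1F ⟨*⟩ var 2F ⟨^⟩ 6)))) refl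

    σ₃σ≈ : eval ρ (σ₂ᵉ ⟨*⟩ σ₂ᵉ ⟨*⟩ Qᵉ ⟨-⟩ Sᵉ ⟨*⟩ (var 5F ⟨^⟩ 8 ⟨*⟩ q₂ᵉ)) ≈ eval ρ (σ₃ᵉ ⟨*⟩ σᵉ)
    σ₃σ≈ = modulo-relation (σ₂ᵉ ⟨*⟩ σ₂ᵉ ⟨*⟩ Qᵉ ⟨-⟩ Sᵉ ⟨*⟩ (var 5F ⟨^⟩ 8 ⟨*⟩ q₂ᵉ)) (σ₃ᵉ ⟨*⟩ σᵉ)
      (int (+ 4) ⟨*⟩ (var 2F ⟨^⟩ 2 ⟨*⟩ var 5F ⟨^⟩ 10)) refl

    2σ₄≈ : eval ρ (D (σ₂ᵉ ⟨*⟩ σ₂ᵉ) ⟨*⟩ (var 5F ⟨^⟩ 8 ⟨*⟩ q₂ᵉ) ⟨-⟩ σ₂ᵉ ⟨*⟩ σ₂ᵉ ⟨*⟩ D (var 5F ⟨^⟩ 8 ⟨*⟩ q₂ᵉ)) ≈ eval ρ (int (+ 2) ⟨*⟩ σ₄ᵉ)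
    2σ₄≈ = modulo-relation (D (σ₂ᵉ ⟨*⟩ σ₂ᵉ) ⟨*⟩ (var 5F ⟨^⟩ 8 ⟨*⟩ q₂ᵉ) ⟨-⟩ σ₂ᵉ ⟨*⟩ σ₂ᵉ ⟨*⟩ D (var 5F ⟨^⟩ 8 ⟨*⟩ q₂ᵉ)) (int (+ 2) ⟨*⟩ σ₄ᵉ)
      (var 5F ⟨^⟩ 16 ⟨*⟩ (int (+ 8) ⟨*⟩ (var 2F ⟨*⟩ var 3F ⟨*⟩ q₂ᵉ) ⟨-⟩
        int (+ 4) ⟨*⟩ (var 2F ⟨^⟩ 2 ⟨*⟩ var 3F ⟨*⟩ (int -[1+ 7 ] ⟨*⟩ (var 0F ⟨*⟩ var 2F ⟨^⟩ 3) ⟨-⟩ int (+ 48) ⟨*⟩ (var 1F ⟨*⟩ var 2F ⟨^⟩ 5) ⟨+⟩ int (+ 8) ⟨*⟩ (var 0F ⟨^⟩ 2 ⟨*⟩ var 2F ⟨^⟩ 7))))) refl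

module _ {c ℓ} (R : CommutativeRing c ℓ) (d : Derivation R) where
  open CommutativeRing R
  open Derivation d

  module Separated {a b S₁ Q₁ S₂ Q₂ : Carrier} (bilinear : Bilinear R d a b S₁ Q₁) (∂S₂≈0 : ∂ S₂ ≈ 0#) (∂Q₂≈0 : ∂ Q₂ ≈ 0#) where
    open FromIntegers R
    open Solver using (solve; _:=_; con; _:+_; _:*_; _:-_; :-_)
    open SetoidReasoning setoid
    open Bilinear bilinear

    ∂-separated : ∀ x y → ∂ (x * Q₂ - S₂ * y) ≈ ∂ x * Q₂ - S₂ * ∂ y
    ∂-separated x y = trans (∂-minus _ _) (+-cong
      (trans (∂-cong (*-comm x Q₂)) (trans (∂-constˡ ∂Q₂≈0 x) (*-comm Q₂ _))) (-‿cong (∂-constˡ ∂S₂≈0 y)))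

    -- The three bilinear equations remove all derivatives. What remains is symmetric under
    -- exchanging the indices 1 and 2, and this symmetry is the reason why F solves the wave
    -- equation.
    separated-bracket : let F = S₁ * Q₂ - S₂ * Q₁ in F * ∂ (∂ F) - ∂ F * ∂ F ≈
      - (# 2 * ((Q₂ * Q₂) * (S₁ * Q₁) + (Q₂ * S₂) * (Q₁ * Q₁ + a * (S₁ * S₁)) + (S₂ * S₂) * (a * (S₁ * Q₁) + # 2 * (b * (S₁ * S₁)))))
    separated-bracket = begin
      F * ∂ (∂ F) - ∂ F * ∂ F
        ≈⟨ +-cong (*-congˡ (trans (∂-cong (∂-separated S₁ Q₁)) (∂-separated _ _))) (-‿cong (*-cong (∂-separated S₁ Q₁) (∂-separated S₁ Q₁))) ⟩
      F * (S″ * Q₂ - S₂ * Q″) - (S′ * Q₂ - S₂ * Q′) * (S′ * Q₂ - S₂ * Q′)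
        ≈⟨ solve 8 (λ S S′ S″ Q Q′ Q″ S₂ Q₂ →
             (S :* Q₂ :- S₂ :* Q) :* (S″ :* Q₂ :- S₂ :* Q″) :- (S′ :* Q₂ :- S₂ :* Q′) :* (S′ :* Q₂ :- S₂ :* Q′) :=
             (Q₂ :* Q₂) :* (S :* S″ :- S′ :* S′)
             :- (Q₂ :* S₂) :* ((S :* Q″ :+ Q :* S″) :- con (+ 2) :* (S′ :* Q′))
             :+ (S₂ :* S₂) :* (Q :* Q″ :- Q′ :* Q′)) refl S₁ S′ S″ Q₁ Q′ Q″ S₂ Q₂ ⟩
      (Q₂ * Q₂) * (S₁ * S″ - S′ * S′) - (Q₂ * S₂) * ((S₁ * Q″ + Q₁ * S″) - # 2 * (S′ * Q′)) + (S₂ * S₂) * (Q₁ * Q″ - Q′ * Q′)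
        ≈⟨ +-cong (+-cong (*-congˡ (+-congˡ (-‿cong (sym SS)))) (-‿cong (*-congˡ (+-congʳ SQ)))) (*-congˡ (+-congˡ (-‿cong (sym QQ)))) ⟩
      _ ≈⟨ solve 10 (λ S S′ S″ Q Q′ Q″ S₂ Q₂ a b →
             (Q₂ :* Q₂) :* (S :* S″ :- (S :* S″ :+ con (+ 2) :* (S :* Q)))
             :- (Q₂ :* S₂) :* ((con (+ 2) :* (S′ :* Q′) :+ con (+ 2) :* (Q :* Q :+ a :* (S :* S))) :- con (+ 2) :* (S′ :* Q′))
             :+ (S₂ :* S₂) :* (Q :* Q″ :- (Q :* Q″ :+ (con (+ 2) :* (a :* (S :* Q)) :+ con (+ 4) :* (b :* (S :* S))))) :=
             :- (con (+ 2) :* ((Q₂ :* Q₂) :* (S :* Q) :+ (Q₂ :* S₂) :* (Q :* Q :+ a :* (S :* S)) :+ (S₂ :* S₂) :* (a :* (S :* Q) :+ con (+ 2) :* (b :* (S :* S))))))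
             refl S₁ S′ S″ Q₁ Q′ Q″ S₂ Q₂ a b ⟩
      - (# 2 * ((Q₂ * Q₂) * (S₁ * Q₁) + (Q₂ * S₂) * (Q₁ * Q₁ + a * (S₁ * S₁)) + (S₂ * S₂) * (a * (S₁ * Q₁) + # 2 * (b * (S₁ * S₁))))) ∎
      where
      F = S₁ * Q₂ - S₂ * Q₁
      S′ = ∂ S₁
      S″ = ∂ (∂ S₁)
      Q′ = ∂ Q₁
      Q″ = ∂ (∂ Q₁)

-- The wave equation for log F, cleared of denominators.
module Wave {c ℓ} (R : CommutativeRing c ℓ) (d₁ d₂ : Derivation R) where
  open CommutativeRing R
  open FromIntegers R
  open Solver using (solve; _:=_; con; _:+_; _:*_; _:-_; :-_)
  open Derivation d₁ using () renaming (∂ to ∂₁; ∂-cong to ∂₁-cong; ∂-* to ∂₁-*; ∂-+ to ∂₁-+)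
  open Derivation d₂ using () renaming (∂ to ∂₂; ∂-cong to ∂₂-cong; ∂-* to ∂₂-*; ∂-+ to ∂₂-+; ∂-neg to ∂₂-neg)
  open SetoidReasoning setoid

  WaveEquation : Carrier → Set ℓ
  WaveEquation F = F * ∂₁ (∂₁ F) - ∂₁ F * ∂₁ F ≈ F * ∂₂ (∂₂ F) - ∂₂ F * ∂₂ F

  private
    bracket-congʳ : ∀ F {F′ F″ G′ G″} → F′ ≈ G′ → F″ ≈ G″ → F * F″ - F′ * F′ ≈ F * G″ - G′ * G′
    bracket-congʳ F p q = +-cong (*-congˡ q) (-‿cong (*-cong p p))

  -- d'Alembert's solution: log P depends on u + v and log M on u - v. The last two hypotheses are
  -- the first two for the derivatives in u.
  travelling : ∀ {P M} → ∂₂ P ≈ ∂₁ P → ∂₂ M ≈ - ∂₁ M → ∂₂ (∂₁ P) ≈ ∂₁ (∂₁ P) → ∂₂ (∂₁ M) ≈ - ∂₁ (∂₁ M) →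
               WaveEquation (P * M)
  travelling {P} {M} P₂ M₂ P₁₂ M₁₂ = begin
    F * ∂₁ (∂₁ F) - ∂₁ F * ∂₁ F
      ≈⟨ bracket-congʳ F (∂₁-* P M) F₁₁ ⟩
    F * ((P″ * M + P′ * M′) + (P′ * M′ + P * M″)) - (P′ * M + P * M′) * (P′ * M + P * M′)
      ≈⟨ solve 6 (λ P P′ P″ M M′ M″ →
           (P :* M) :* ((P″ :* M :+ P′ :* M′) :+ (P′ :* M′ :+ P :* M″)) :- (P′ :* M :+ P :* M′) :* (P′ :* M :+ P :* M′)
           := (P :* M) :* ((P″ :* M :+ P′ :* (:- M′)) :+ (P′ :* (:- M′) :+ P :* (:- (:- M″))))
              :- (P′ :* M :+ P :* (:- M′)) :* (P′ :* M :+ P :* (:- M′)))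
           refl P P′ P″ M M′ M″ ⟩
    F * ((P″ * M + P′ * (- M′)) + (P′ * (- M′) + P * (- (- M″)))) - (P′ * M + P * (- M′)) * (P′ * M + P * (- M′))
      ≈⟨ bracket-congʳ F F₂ F₂₂ ⟨
    F * ∂₂ (∂₂ F) - ∂₂ F * ∂₂ F ∎
    where
    F = P * M
    P′ = ∂₁ P
    P″ = ∂₁ (∂₁ P)
    M′ = ∂₁ M
    M″ = ∂₁ (∂₁ M)
    F₁₁ : ∂₁ (∂₁ F) ≈ (P″ * M + P′ * M′) + (P′ * M′ + P * M″)
    F₁₁ = trans (∂₁-cong (∂₁-* P M)) (trans (∂₁-+ _ _) (+-cong (∂₁-* P′ M) (∂₁-* P M′)))
    F₂ : ∂₂ F ≈ P′ * M + P * (- M′)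
    F₂ = trans (∂₂-* P M) (+-cong (*-congʳ P₂) (*-congˡ M₂))
    F₂₂ : ∂₂ (∂₂ F) ≈ (P″ * M + P′ * (- M′)) + (P′ * (- M′) + P * (- (- M″)))
    F₂₂ = begin
      ∂₂ (∂₂ F)                                ≈⟨ ∂₂-cong F₂ ⟩
      ∂₂ (P′ * M + P * (- M′))                 ≈⟨ trans (∂₂-+ _ _) (+-cong (∂₂-* P′ M) (∂₂-* P (- M′))) ⟩
      (∂₂ P′ * M + P′ * ∂₂ M) + (∂₂ P * (- M′) + P * ∂₂ (- M′))
        ≈⟨ +-cong (+-cong (*-congʳ P₁₂) (*-congˡ M₂)) (+-cong (*-congʳ P₂) (*-congˡ (trans (∂₂-neg M′) (-‿cong M₁₂)))) ⟩
      (P″ * M + P′ * (- M′)) + (P′ * (- M′) + P * (- (- M″))) ∎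


  -- Exchanging the two variables changes F only by a sign, which the quadratic expression F F″ -
  -- F′² does not see, and the reduced bracket is symmetric.
  separated : ∀ {a b S₁ Q₁ S₂ Q₂} → Bilinear R d₁ a b S₁ Q₁ → Bilinear R d₂ a b S₂ Q₂ →
    ∂₁ S₂ ≈ 0# → ∂₁ Q₂ ≈ 0# → ∂₂ S₁ ≈ 0# → ∂₂ Q₁ ≈ 0# → WaveEquation (S₁ * Q₂ - S₂ * Q₁)
  separated {a} {b} {S₁} {Q₁} {S₂} {Q₂} B₁ B₂ s₂ q₂ s₁ q₁ = begin
    F * ∂₁ (∂₁ F) - ∂₁ F * ∂₁ F
      ≈⟨ Separated.separated-bracket R d₁ B₁ s₂ q₂ ⟩
    - (# 2 * ((Q₂ * Q₂) * (S₁ * Q₁) + (Q₂ * S₂) * (Q₁ * Q₁ + a * (S₁ * S₁)) + (S₂ * S₂) * (a * (S₁ * Q₁) + # 2 * (b * (S₁ * S₁)))))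
      ≈⟨ solve 6 (λ a b S₁ Q₁ S₂ Q₂ →
           :- (con (+ 2) :* ((Q₂ :* Q₂) :* (S₁ :* Q₁) :+ (Q₂ :* S₂) :* (Q₁ :* Q₁ :+ a :* (S₁ :* S₁)) :+ (S₂ :* S₂) :* (a :* (S₁ :* Q₁) :+ con (+ 2) :* (b :* (S₁ :* S₁))))) :=
           :- (con (+ 2) :* ((Q₁ :* Q₁) :* (S₂ :* Q₂) :+ (Q₁ :* S₁) :* (Q₂ :* Q₂ :+ a :* (S₂ :* S₂)) :+ (S₁ :* S₁) :* (a :* (S₂ :* Q₂) :+ con (+ 2) :* (b :* (S₂ :* S₂))))))
           refl a b S₁ Q₁ S₂ Q₂ ⟩
    - (# 2 * ((Q₁ * Q₁) * (S₂ * Q₂) + (Q₁ * S₁) * (Q₂ * Q₂ + a * (S₂ * S₂)) + (S₁ * S₁) * (a * (S₂ * Q₂) + # 2 * (b * (S₂ * S₂)))))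
      ≈⟨ Separated.separated-bracket R d₂ B₂ s₁ q₁ ⟨
    G * ∂₂ (∂₂ G) - ∂₂ G * ∂₂ G
      ≈⟨ solve 3 (λ G G′ G″ → G :* G″ :- G′ :* G′ := (:- G) :* (:- G″) :- (:- G′) :* (:- G′)) refl G (∂₂ G) (∂₂ (∂₂ G)) ⟩
    (- G) * (- ∂₂ (∂₂ G)) - (- ∂₂ G) * (- ∂₂ G)
      ≈⟨ +-cong (*-cong F≈-G (trans (∂₂-cong (trans (∂₂-cong F≈-G) (∂₂-neg G))) (∂₂-neg _))) (-‿cong (*-cong ∂F ∂F)) ⟨
    F * ∂₂ (∂₂ F) - ∂₂ F * ∂₂ F ∎
    where
    F = S₁ * Q₂ - S₂ * Q₁
    G = S₂ * Q₁ - S₁ * Q₂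
    F≈-G : F ≈ - G
    F≈-G = solve 4 (λ S₁ Q₁ S₂ Q₂ → S₁ :* Q₂ :- S₂ :* Q₁ := :- (S₂ :* Q₁ :- S₁ :* Q₂)) refl S₁ Q₁ S₂ Q₂
    ∂F : ∂₂ F ≈ - ∂₂ G
    ∂F = trans (∂₂-cong F≈-G) (∂₂-neg G)

module WaveUniqueness {c ℓ} (C : CommutativeRing c ℓ) (d : Derivation C) where
  open Hurwitz C
  open HurwitzCoefficients C
  private
    module C = CommutativeRing C
    module H = CommutativeRing hurwitzRing
    module d = Derivation d
  open Wave hurwitzRing (pointwiseDerivation d) shift
  open FromIntegers hurwitzRing
  open Solver using (solve; _:=_; _:+_; _:*_; _:-_; :-_)
  open Derivation (pointwiseDerivation d)

  -- The Cauchy problem is solved order by order in v. If the coefficients agree below order n + 2,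
  -- then order n of the difference of the two equations gives the next difference times `G 0`.
  -- Regularity of `G 0` suffices, which matters because it will be σ(u)², not a unit.
  unique : ∀ {F G} → WaveEquation F → WaveEquation G → F 0 C.≈ G 0 → F 1 C.≈ G 1 →
    (∀ {x} → x C.* G 0 C.≈ C.0# → x C.≈ C.0#) → F ≋ G
  unique {F} {G} waveF waveG e₀ e₁ regular = pointwise (λ n → CG.x∙y⁻¹≈ε⇒x≈y _ _ (at Δ≋0 n))
    where
    module CG = RingProperties C.ring
    module HG = RingProperties H.ring
    Δ = F H.- G
    u = (tail F H.- tail G) H.* (tail F H.+ tail G)
    v = Δ H.* (∂ (∂ F) H.- tail (tail F))
    y = (∂ (∂ F) H.- ∂ (∂ G)) H.* G
    z = (∂ F H.- ∂ G) H.* (∂ F H.+ ∂ G)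
    -- The difference of the two equations, arranged so that every term on the right contains F - G,
    -- its first derivative in v, or a derivative of it in u; none of these reaches order n + 2 of F
    -- - G.
    linearised : (tail (tail F) H.- tail (tail G)) H.* G ≋ (u H.+ v) H.+ (y H.- z)
    linearised = H.trans
      (solve 10 (λ F F₁ F₁₁ F₂ F₂₂ G G₁ G₁₁ G₂ G₂₂ → (F₂₂ :- G₂₂) :* G :=
        (((F₂ :- G₂) :* (F₂ :+ G₂) :+ (F :- G) :* (F₁₁ :- F₂₂)) :+ ((F₁₁ :- G₁₁) :* G :- (F₁ :- G₁) :* (F₁ :+ G₁)))
        :+ (((G :* G₁₁ :- G₁ :* G₁) :- (G :* G₂₂ :- G₂ :* G₂)) :- ((F :* F₁₁ :- F₁ :* F₁) :- (F :* F₂₂ :- F₂ :* F₂))))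
        H.refl F (∂ F) (∂ (∂ F)) (tail F) (tail (tail F)) G (∂ G) (∂ (∂ G)) (tail G) (tail (tail G)))
      (H.trans (H.+-congˡ (H.trans (H.+-cong (HG.x≈y⇒x∙y⁻¹≈ε waveG) (H.-‿cong (HG.x≈y⇒x∙y⁻¹≈ε waveF))) (H.-‿inverseʳ H.0#)))
        (H.+-identityʳ _))
    vanish : ∀ {n} f g → Below (suc n) f → (f H.* g) n C.≈ C.0#
    vanish {n} f g b = below-⊠ g b n (ℕₚ.n<1+n n)
    step : ∀ n → Below n Δ → Δ n C.≈ C.0#
    step zero _ = CG.x≈y⇒x∙y⁻¹≈ε e₀
    step (suc zero) _ = CG.x≈y⇒x∙y⁻¹≈ε e₁
    step (suc (suc n)) b = regular (C.trans (C.sym (⊠-at n G (λ j j<n → b (suc (suc j)) (s≤s (s≤s j<n)))))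
      (C.trans (at linearised n) sum-vanishes))
      where
      agree : ∀ j → j < suc n → F j C.≈ G j
      agree j j<1+n = CG.x∙y⁻¹≈ε⇒x≈y _ _ (b j (ℕₚ.m<n⇒m<1+n j<1+n))
      sum-vanishes : ((u H.+ v) H.+ (y H.- z)) n C.≈ C.0#
      sum-vanishes = C.trans (C.+-cong
        (C.+-cong (vanish (tail F H.- tail G) _ (λ j j<1+n → b (suc j) (s≤s j<1+n)))
                  (vanish Δ _ (λ j j<1+n → b j (ℕₚ.m<n⇒m<1+n j<1+n))))
        (C.+-cong (vanish (∂ (∂ F) H.- ∂ (∂ G)) G (λ j j<1+n → CG.x≈y⇒x∙y⁻¹≈ε (d.∂-cong (d.∂-cong (agree j j<1+n)))))
          (C.-‿cong (vanish (∂ F H.- ∂ G) _ (λ j j<1+n → CG.x≈y⇒x∙y⁻¹≈ε (d.∂-cong (agree j j<1+n)))))))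
        (C.trans (C.+-cong (C.+-identityʳ _) (C.-‿inverseʳ _)) (C.+-identityʳ _))
    Δ≋0 : Δ ≋ H.0#
    Δ≋0 = regular-by-below step

-- The addition formula for σ

module Sigma {c ℓ} (R : CommutativeRing c ℓ) (torsionFree : Divisibility.TorsionFree R) (A B : CommutativeRing.Carrier R) where
  private
    module R = CommutativeRing R
    module ER = Evaluation R
    module FR = FromIntegers R
  open Hurwitz R
  open HurwitzCoefficients R
  H : CommutativeRing c ℓ
  H = hurwitzRing
  private
    module HH = Hurwitz H
    module FH = FromIntegers H
    module EH = Evaluation H
  open CommutativeRing H
  open Derivation shift

  ρ₀ : Vec R.Carrier 7
  ρ₀ = A ∷ B ∷ FR.# 0 ∷ FR.# 1 ∷ FR.# 0 ∷ FR.# 1 ∷ FR.# 1 ∷ []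

  -- The coefficient of order n is the n-fold derivative along the system, computed on polynomials
  -- and evaluated at the initial point. This solves the differential equation without dividing by
  -- n!.
  solution : Expr 7 → Sequence
  solution e zero = ER.eval ρ₀ e
  solution e (suc n) = solution (diff system e) n

  ρ : Vec Sequence 7
  ρ = tabulate (λ i → solution (var i))

  private
    solution-+ : ∀ n e f → solution (e ⟨+⟩ f) n R.≈ solution e n R.+ solution f n
    solution-+ zero e f = R.refl
    solution-+ (suc n) e f = solution-+ n _ _

    solution-* : ∀ n e f → solution (e ⟨*⟩ f) n R.≈ (solution e ⊠ solution f) n
    solution-* zero e f = R.refl
    solution-* (suc n) e f = R.trans (solution-+ n _ _) (R.+-cong (solution-* n _ _) (solution-* n _ _))

    solution-0 : ∀ n → solution (int (+ 0)) n R.≈ R.0#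
    solution-0 zero = R.refl
    solution-0 (suc n) = solution-0 n

    solution-int : ∀ z → solution (int z) ≋ FH.fromℤ z
    solution-int z = trans (pointwise (λ { zero → R.refl ; (suc n) → solution-0 n })) (Hom.fromℤ-homo constant z)

  solution-eval : ∀ e → solution e ≋ EH.eval ρ e
  solution-eval (int z) = solution-int z
  solution-eval (var i) = reflexive (≡.sym (lookup∘tabulate (λ j → solution (var j)) i))
  solution-eval (e ⟨+⟩ f) = trans (pointwise (λ n → solution-+ n e f)) (+-cong (solution-eval e) (solution-eval f))
  solution-eval (e ⟨*⟩ f) = trans (pointwise (λ n → solution-* n e f)) (*-cong (solution-eval e) (solution-eval f))

  eval-at-0 : ∀ e → EH.eval ρ e 0 R.≈ ER.eval ρ₀ e
  eval-at-0 e = R.sym (at (solution-eval e) 0)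

  private
    ∂-var : ∀ i → ∂ (lookup ρ i) ≋ EH.eval ρ (system i)
    ∂-var i = trans (∂-cong (reflexive (lookup∘tabulate (λ j → solution (var j)) i))) (solution-eval (system i))

    ∂-eval : ∀ e → ∂ (EH.eval ρ e) ≋ EH.eval ρ (diff system e)
    ∂-eval = EH.∂-eval shift ρ system ∂-var

  isSystem : IsSystem H shift ρ
  isSystem = record
    { ∂-var = ∂-var
    ; w²≈ = ≋-by-∂ (R.trans (eval-at-0 relation) (relation-initial R A B))
        (trans (∂-eval relation) (relation-constant H ρ))
    ; χχ⁻¹≈1 = ≋-by-∂ (R.trans (R.*-cong FR.#1≈1 FR.#1≈1) (R.*-identityˡ _))
        (trans (∂-eval (var 5F ⟨*⟩ var 6F)) (χχ⁻¹-constant H ρ)) }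

  open IsSystem isSystem using (σᵉ; Sᵉ; Qᵉ; D; ∂≈; bilinear) public

  t w χ χ⁻¹ σ S Q : Sequence
  t = lookup ρ 2F
  w = lookup ρ 3F
  χ = lookup ρ 5F
  χ⁻¹ = lookup ρ 6F
  σ = t * χ
  S = σ * σ
  Q = χ * χ

  variable-0 : lookup ρ 0F ≋ unit A
  variable-0 = ≋-by-∂ R.refl (pointwise solution-0)

  variable-1 : lookup ρ 1F ≋ unit B
  variable-1 = ≋-by-∂ R.refl (pointwise solution-0)

  unit-cong : ∀ {a b} → a R.≈ b → unit a ≋ unit b
  unit-cong = Hom.⟦⟧-cong constant

  unit-0 : ∀ {a} → a R.≈ R.0# → unit a ≋ 0#
  unit-0 e = trans (unit-cong e) (Hom.0-homo constant)

  regular-w : ∀ {f} → f * w ≋ 0# → f ≋ 0#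
  regular-w {f} fw≈0 = regular-by-below (λ n b → R.trans (R.sym (R.trans (⊠-at n w b)
    (R.trans (R.*-congˡ FR.#1≈1) (R.*-identityʳ _)))) (at fw≈0 n))

  -- t = z + ..., and multiplication by z multiplies exponential coefficients by positive integers;
  -- torsion-freeness cancels them.
  regular-t : ∀ {f} → f * t ≋ 0# → f ≋ 0#
  regular-t {f} ft≈0 = regular-by-below (λ n b → torsionFree n (R.trans
    (R.sym (R.trans (⊠-at-suc n t R.refl b) (R.*-congˡ (R.trans (R.*-congˡ FR.#1≈1) (R.*-identityʳ _))))) (at ft≈0 (suc n))))

  regular-χ : ∀ {f} → f * χ ≋ 0# → f ≋ 0#
  regular-χ {f} fχ≈0 = begin
    f                ≈⟨ *-identityʳ f ⟨
    f * 1#           ≈⟨ *-congˡ (IsSystem.χχ⁻¹≈1 isSystem) ⟨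
    f * (χ * χ⁻¹)    ≈⟨ *-assoc f χ χ⁻¹ ⟨
    (f * χ) * χ⁻¹    ≈⟨ *-congʳ fχ≈0 ⟩
    0# * χ⁻¹         ≈⟨ zeroˡ χ⁻¹ ⟩
    0#               ∎
    where open SetoidReasoning setoid

  regular-σ : ∀ {f} → f * σ ≋ 0# → f ≋ 0#
  regular-σ {f} e = regular-t (regular-χ (trans (*-assoc f t χ) e))

  torsionFreeᴴ : Divisibility.TorsionFree H
  torsionFreeᴴ n {f} e = pointwise (λ i → torsionFree n (R.trans (R.sym (#-at (suc n) f i)) (at e i)))

  opaque
    -- f(Z) ↦ f(zZ) as the Taylor homomorphism of the derivation z d/dZ, so that multiplicativity
    -- comes with the construction.
    scale : ℤ → Hom H H
    scale z = Taylor.hom H (FH.fromℤ z ·ᵈ shift) head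

  infixl 9 _⟪_⟫
  _⟪_⟫ : Sequence → ℤ → Sequence
  f ⟪ z ⟫ = Hom.⟦ scale z ⟧ f

  -- An algebra embedding j of H along which ∂ becomes z times d/dz turns into f ↦ f(zZ) under Taylor expansion.
  module _ {b ℓb} (B : CommutativeRing b ℓb) (d : Derivation B) (ε : Hom B R) (j : Hom H B) (z : ℤ) where
    private
      module B = CommutativeRing B
      module T = Taylor B d ε
      module j = Hom j
      module FB = FromIntegers B

    opaque
      unfolding scale

      expand-scaled : (∀ f → Derivation.∂ d j.⟦ f ⟧ B.≈ FB.fromℤ z B.* j.⟦ tail f ⟧) →
        (∀ f → Hom.⟦ ε ⟧ j.⟦ f ⟧ R.≈ f 0) → ∀ f → T.expand j.⟦ f ⟧ ≋ f ⟪ z ⟫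
      expand-scaled p q f = pointwise (λ n → go n f)
        where
        go : ∀ n f → T.expand j.⟦ f ⟧ n R.≈ (f ⟪ z ⟫) n
        go zero f = q f
        go (suc n) f = R.trans
          (at (Hom.⟦⟧-cong T.hom (B.trans (p f) (B.trans (B.*-congʳ (B.sym (j.fromℤ-homo z))) (B.sym (j.*-homo _ _))))) n)
          (go n (FH.fromℤ z * tail f))

  opaque
    unfolding scale

    scale-tail : ∀ z f → tail (f ⟪ z ⟫) ≋ FH.fromℤ z * tail f ⟪ z ⟫
    scale-tail z f = trans (Hom.*-homo (scale z) _ _) (*-congʳ (Hom.fromℤ-homo (scale z) z))

    scale-at-0 : ∀ z f → (f ⟪ z ⟫) 0 R.≈ f 0
    scale-at-0 z f = R.refl

    scale-scale : ∀ y z f → f ⟪ z ⟫ ⟪ y ⟫ ≋ f ⟪ y ℤ.* z ⟫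
    scale-scale y z = expand-scaled H (FH.fromℤ y ·ᵈ shift) head (scale z) (y ℤ.* z)
      (λ f → trans (*-congˡ (scale-tail z f)) (trans (sym (*-assoc _ _ _)) (*-congʳ (sym (FH.fromℤ-* y z)))))
      (λ f → scale-at-0 z f)

  scale-1 : ∀ f → f ⟪ + 1 ⟫ ≋ f
  scale-1 f = sym (trans (pointwise (λ n → go n f)) (expand-scaled H shift head (id-hom H) (+ 1)
    (λ g → sym (trans (*-congʳ FH.#1≈1) (*-identityˡ _))) (λ g → R.refl) f))
    where
    go : ∀ n f → f n R.≈ Taylor.expand H shift head f n
    go zero f = R.refl
    go (suc n) f = go n (tail f)

  scale-0 : ∀ f → f ⟪ + 0 ⟫ ≋ unit (f 0)
  scale-0 f = ≋-by-∂ (scale-at-0 (+ 0) f) (trans (scale-tail (+ 0) f) (zeroˡ _))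

  -- Two-variable series: the inner variable is u, the outer one v.
  private
    HHᴿ = HH.hurwitzRing
    module HHᴿ = CommutativeRing HHᴿ
    module FHH = FromIntegers HHᴿ
    ∂ᵘ = HH.pointwiseDerivation shift
    module ∂ᵘ = Derivation ∂ᵘ
    open Wave HHᴿ ∂ᵘ HH.shift using (WaveEquation; travelling; separated)

    -- f(u + zv)
    translate : ℤ → Hom H HHᴿ
    translate z = HH.Taylor.hom H (FH.fromℤ z ·ᵈ shift) (id-hom H)

    translate-∂ᵘ : ∀ z f → ∂ᵘ.∂ (Hom.⟦ translate z ⟧ f) HHᴿ.≈ Hom.⟦ translate z ⟧ (tail f)
    translate-∂ᵘ z f = HH.pointwise (λ n → go n f)
      where
      go : ∀ n f → tail (Hom.⟦ translate z ⟧ f n) ≋ Hom.⟦ translate z ⟧ (tail f) n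
      go zero f = refl
      go (suc n) f = trans (go n (FH.fromℤ z * tail f))
        (HH.at (Hom.⟦⟧-cong (translate z) (Derivation.∂-constˡ shift (EH.fromℤ-∂ shift z) (tail f))) n)

    translate-∂ᵛ : ∀ z f → HH.tail (Hom.⟦ translate z ⟧ f) HHᴿ.≈ FHH.fromℤ z HHᴿ.* Hom.⟦ translate z ⟧ (tail f)
    translate-∂ᵛ z f = HHᴿ.trans (Hom.*-homo (translate z) _ _) (HHᴿ.*-congʳ (Hom.fromℤ-homo (translate z) z))

    -- f(v)
    outer : Hom H HHᴿ
    outer = HH.Taylor.hom H shift (constant ∘-hom head)

    outer-∂ᵘ : ∀ f → ∂ᵘ.∂ (Hom.⟦ outer ⟧ f) HHᴿ.≈ HHᴿ.0#
    outer-∂ᵘ f = HH.pointwise (λ n → go n f)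
      where
      go : ∀ n f → tail (Hom.⟦ outer ⟧ f n) ≋ 0#
      go zero f = pointwise (λ i → R.refl)
      go (suc n) f = go n (tail f)

    inner : Hom H HHᴿ
    inner = HH.constant

    inner-∂ᵘ : ∀ f → ∂ᵘ.∂ (Hom.⟦ inner ⟧ f) HHᴿ.≈ Hom.⟦ inner ⟧ (tail f)
    inner-∂ᵘ f = HH.pointwise (λ { zero → refl ; (suc n) → pointwise (λ i → R.refl) })

    inner-∂ᵛ : ∀ f → HH.tail (Hom.⟦ inner ⟧ f) HHᴿ.≈ HHᴿ.0#
    inner-∂ᵛ f = HH.pointwise (λ n → refl)

    -- A and B are constant series, so they are the same elements whether placed in u or in v; the
    -- bilinear equations in both variables must share their coefficients.
    outer≈inner : ∀ f → (∀ n → f (suc n) R.≈ R.0#) → Hom.⟦ outer ⟧ f HHᴿ.≈ Hom.⟦ inner ⟧ f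
    outer≈inner f c = HH.≋-by-∂ (pointwise (λ { zero → R.refl ; (suc n) → R.sym (c n) }))
      (HHᴿ.trans (Hom.⟦⟧-cong outer {y = 0#} (pointwise c)) (HHᴿ.trans (Hom.0-homo outer) (HH.pointwise (λ n → refl))))

    σ₊ σ₋ S₁ Q₁ S₂ Q₂ Φ Ψ : HHᴿ.Carrier
    σ₊ = Hom.⟦ translate (+ 1) ⟧ σ
    σ₋ = Hom.⟦ translate -[1+ 0 ] ⟧ σ
    S₁ = Hom.⟦ inner ⟧ S
    Q₁ = Hom.⟦ inner ⟧ Q
    S₂ = Hom.⟦ outer ⟧ S
    Q₂ = Hom.⟦ outer ⟧ Q
    Φ = σ₊ HHᴿ.* σ₋
    Ψ = S₁ HHᴿ.* Q₂ HHᴿ.- S₂ HHᴿ.* Q₁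

    translate-1 : ∀ f → HH.tail (Hom.⟦ translate (+ 1) ⟧ f) HHᴿ.≈ Hom.⟦ translate (+ 1) ⟧ (tail f)
    translate-1 f = HHᴿ.trans (translate-∂ᵛ (+ 1) f) (HHᴿ.trans (HHᴿ.*-congʳ FHH.#1≈1) (HHᴿ.*-identityˡ _))

    translate--1 : ∀ f → HH.tail (Hom.⟦ translate -[1+ 0 ] ⟧ f) HHᴿ.≈ HHᴿ.- Hom.⟦ translate -[1+ 0 ] ⟧ (tail f)
    translate--1 f = HHᴿ.trans (translate-∂ᵛ -[1+ 0 ] f)
      (HHᴿ.trans (HHᴿ.*-congʳ (HHᴿ.-‿cong FHH.#1≈1)) (RingProperties.-1*x≈-x HHᴿ.ring _))

    wave-Φ : WaveEquation Φ
    wave-Φ = travelling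
      (HHᴿ.trans (translate-1 σ) (HHᴿ.sym (translate-∂ᵘ (+ 1) σ)))
      (HHᴿ.trans (translate--1 σ) (HHᴿ.-‿cong (HHᴿ.sym (translate-∂ᵘ -[1+ 0 ] σ))))
      (HHᴿ.trans (HH.tail-cong (translate-∂ᵘ (+ 1) σ))
        (HHᴿ.trans (translate-1 (tail σ)) (HHᴿ.sym (HHᴿ.trans (∂ᵘ.∂-cong (translate-∂ᵘ (+ 1) σ)) (translate-∂ᵘ (+ 1) (tail σ))))))
      (HHᴿ.trans (HH.tail-cong (translate-∂ᵘ -[1+ 0 ] σ))
        (HHᴿ.trans (translate--1 (tail σ)) (HHᴿ.-‿cong (HHᴿ.sym (HHᴿ.trans (∂ᵘ.∂-cong (translate-∂ᵘ -[1+ 0 ] σ)) (translate-∂ᵘ -[1+ 0 ] (tail σ)))))))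

    wave-Ψ : WaveEquation Ψ
    wave-Ψ = separated
      (transport inner inner-∂ᵘ HHᴿ.refl HHᴿ.refl bilinear)
      (transport outer (λ f → HHᴿ.refl)
        (outer≈inner (lookup ρ 0F) solution-0) (outer≈inner (lookup ρ 1F) solution-0) bilinear)
      (outer-∂ᵘ S) (outer-∂ᵘ Q) (inner-∂ᵛ S) (inner-∂ᵛ Q)

    σ≈₀ : σ 0 R.≈ R.0#
    σ≈₀ = R.zeroˡ _

    S≈₀ : S 0 R.≈ R.0#
    S≈₀ = R.trans (R.*-congˡ σ≈₀) (R.zeroʳ _)

    Q≈₀ : Q 0 R.≈ R.1#
    Q≈₀ = R.trans (R.*-cong FR.#1≈1 FR.#1≈1) (R.*-identityˡ _)

    S′≈₀ : tail S 0 R.≈ R.0#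
    S′≈₀ = R.trans (R.+-cong (R.trans (R.*-congˡ σ≈₀) (R.zeroʳ _)) (R.trans (R.*-congʳ σ≈₀) (R.zeroˡ _))) (R.+-identityˡ _)

    Q′≈₀ : tail Q 0 R.≈ R.0#
    Q′≈₀ = R.trans (R.+-cong (R.trans (R.*-congʳ (R.zeroˡ _)) (R.zeroˡ _)) (R.trans (R.*-congˡ (R.zeroˡ _)) (R.zeroʳ _))) (R.+-identityˡ _)

    Ψ≈₀ : Ψ 0 ≋ S
    Ψ≈₀ = trans (+-cong (trans (*-congˡ (trans (unit-cong Q≈₀) (Hom.1-homo constant))) (*-identityʳ S))
        (trans (-‿cong (trans (*-congʳ (unit-0 S≈₀)) (zeroˡ Q))) -0#≈0#)) (+-identityʳ S)
      where open RingProperties (CommutativeRing.ring H) using (-0#≈0#)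

    Ψ≈₁ : Ψ 1 ≋ 0#
    Ψ≈₁ = trans (+-cong
        (trans (+-cong (zeroˡ _) (trans (*-congˡ (unit-0 Q′≈₀)) (zeroʳ S))) (+-identityʳ 0#))
        (trans (-‿cong (trans (+-cong (trans (*-congʳ (unit-0 S′≈₀)) (zeroˡ Q)) (zeroʳ _)) (+-identityʳ 0#))) -0#≈0#)) (+-identityʳ 0#)
      where open RingProperties (CommutativeRing.ring H) using (-0#≈0#)

    Φ≈₁ : Φ 1 ≋ 0#
    Φ≈₁ = solve 2 (λ s s′ → (con (+ 1) :* s′) :* s :+ s :* (con -[1+ 0 ] :* s′) := con (+ 0)) refl σ (tail σ)
      where open FH.Solver using (solve; _:=_; con; _:+_; _:*_)

    -- At v = 0 both sides equal σ(u)², and both first derivatives in v vanish: S′(0) = Q′(0) = 0 on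
    -- one side, and the two halves of the derivative of σ(u+v)σ(u-v) cancel on the other.
    Φ≈Ψ : Φ HHᴿ.≈ Ψ
    Φ≈Ψ = WaveUniqueness.unique H shift wave-Φ wave-Ψ (sym Ψ≈₀) (trans Φ≈₁ (sym Ψ≈₁))
      (λ e → regular-σ (regular-σ (trans (*-assoc _ σ σ) (trans (*-congˡ (sym Ψ≈₀)) e))))

    module _ (y z : ℤ) where
      direction : Derivation HHᴿ
      direction = FHH.fromℤ y ·ᵈ ∂ᵘ +ᵈ FHH.fromℤ z ·ᵈ HH.shift

      -- Restriction to the line (u , v) = (y Z , z Z).
      line : Hom HHᴿ H
      line = Taylor.hom HHᴿ direction (head ∘-hom HH.head)

      line-translate : ∀ x f → Hom.⟦ line ⟧ (Hom.⟦ translate x ⟧ f) ≋ f ⟪ y ℤ.+ z ℤ.* x ⟫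
      line-translate x = expand-scaled HHᴿ direction (head ∘-hom HH.head) (translate x) (y ℤ.+ z ℤ.* x)
        (λ f → HHᴿ.trans (HHᴿ.+-cong (HHᴿ.*-congˡ (translate-∂ᵘ x f)) (HHᴿ.*-congˡ (translate-∂ᵛ x f)))
          (HHᴿ.trans (HHᴿ.+-congˡ (HHᴿ.sym (HHᴿ.*-assoc _ _ _))) (HHᴿ.trans (HHᴿ.sym (HHᴿ.distribʳ _ _ _))
            (HHᴿ.*-congʳ (HHᴿ.sym (HHᴿ.trans (FHH.fromℤ-+ y (z ℤ.* x)) (HHᴿ.+-congˡ (FHH.fromℤ-* z x))))))))
        (λ f → R.refl)

      line-inner : ∀ f → Hom.⟦ line ⟧ (Hom.⟦ inner ⟧ f) ≋ f ⟪ y ⟫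
      line-inner = expand-scaled HHᴿ direction (head ∘-hom HH.head) inner y
        (λ f → HHᴿ.trans (HHᴿ.+-cong (HHᴿ.*-congˡ (inner-∂ᵘ f)) (HHᴿ.trans (HHᴿ.*-congˡ (inner-∂ᵛ f)) (HHᴿ.zeroʳ _))) (HHᴿ.+-identityʳ _))
        (λ f → R.refl)

      line-outer : ∀ f → Hom.⟦ line ⟧ (Hom.⟦ outer ⟧ f) ≋ f ⟪ z ⟫
      line-outer = expand-scaled HHᴿ direction (head ∘-hom HH.head) outer z
        (λ f → HHᴿ.trans (HHᴿ.+-congʳ (HHᴿ.trans (HHᴿ.*-congˡ (outer-∂ᵘ f)) (HHᴿ.zeroʳ _))) (HHᴿ.+-identityˡ _))
        (λ f → R.refl)

  -- ℘(v) - ℘(u) = σ(u + v) σ(u - v) / (σ(u) σ(v))² at u = y z, v = x z.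
  addition : ∀ y x {i j} → y ℤ.+ x ℤ.* + 1 ≡ i → y ℤ.+ x ℤ.* -[1+ 0 ] ≡ j →
    σ ⟪ i ⟫ * σ ⟪ j ⟫ ≋ S ⟪ y ⟫ * Q ⟪ x ⟫ - S ⟪ x ⟫ * Q ⟪ y ⟫
  addition y x ≡.refl ≡.refl = trans (sym left) (trans (ℓ.⟦⟧-cong {Φ} {Ψ} Φ≈Ψ) right)
    where
    module ℓ = Hom (line y x)
    left : ℓ.⟦ Φ ⟧ ≋ σ ⟪ y ℤ.+ x ℤ.* + 1 ⟫ * σ ⟪ y ℤ.+ x ℤ.* -[1+ 0 ] ⟫
    left = ℓ.image-* {σ₊} {σ₋} (line-translate y x (+ 1) σ) (line-translate y x -[1+ 0 ] σ)
    right : ℓ.⟦ Ψ ⟧ ≋ S ⟪ y ⟫ * Q ⟪ x ⟫ - S ⟪ x ⟫ * Q ⟪ y ⟫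
    right = ℓ.image-minus {S₁ HHᴿ.* Q₂} {S₂ HHᴿ.* Q₁}
      (ℓ.image-* {S₁} {Q₂} (line-inner y x S) (line-outer y x Q))
      (ℓ.image-* {S₂} {Q₁} (line-outer y x S) (line-inner y x Q))

  -- The limit u = v of the addition formula, obtained by differentiating it in v.
  duplication : σ ⟪ + 2 ⟫ ≋ tail S * Q - S * tail Q
  duplication = begin
    σ ⟪ + 2 ⟫
      ≈⟨ solve 2 (λ a c → a := :- (c :* con (+ 0) :+ a :* (:- con (+ 1)))) refl (σ ⟪ + 2 ⟫) (tail σ ⟪ + 2 ⟫) ⟩
    -- On the diagonal the derivative in v of σ(u+v)σ(u-v) is σ′(2z)σ(0) - σ(2z)σ′(0), where σ(0) =
    -- 0 and σ′(0) = 1.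
    - (tail σ ⟪ + 2 ⟫ * # 0 + σ ⟪ + 2 ⟫ * (- # 1))
      ≈⟨ -‿cong (+-cong (*-congˡ σ⟪0⟫) (*-congˡ (-‿cong σ′⟪0⟫))) ⟨
    - (tail σ ⟪ + 2 ⟫ * σ ⟪ + 0 ⟫ + σ ⟪ + 2 ⟫ * (- (tail σ ⟪ + 0 ⟫)))
      ≈⟨ -‿cong left ⟨
    - ℓ.⟦ HH.tail Φ ⟧        ≈⟨ -‿cong (ℓ.⟦⟧-cong {HH.tail Φ} {HH.tail Ψ} (HH.tail-cong Φ≈Ψ)) ⟩
    - ℓ.⟦ HH.tail Ψ ⟧        ≈⟨ -‿cong right ⟩
    - ((# 0 * Q + S * tail Q) - (tail S * Q + S * # 0))
      ≈⟨ solve 4 (λ S Q S′ Q′ → :- ((con (+ 0) :* Q :+ S :* Q′) :- (S′ :* Q :+ S :* con (+ 0))) := S′ :* Q :- S :* Q′) refl S Q (tail S) (tail Q) ⟩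
    tail S * Q - S * tail Q ∎
    where
    open SetoidReasoning setoid
    open FH using (#_)
    open FH.Solver using (solve; _:=_; con; _:+_; _:*_; _:-_; :-_)
    module ℓ = Hom (line (+ 1) (+ 1))
    σ⟪0⟫ : σ ⟪ + 0 ⟫ ≋ # 0
    σ⟪0⟫ = trans (scale-0 σ) (unit-0 σ≈₀)
    σ′⟪0⟫ : tail σ ⟪ + 0 ⟫ ≋ # 1
    σ′⟪0⟫ = trans (scale-0 (tail σ)) (trans (unit-cong (R.trans (R.+-cong (R.trans (R.*-cong FR.#1≈1 FR.#1≈1) (R.*-identityˡ _)) (R.zeroˡ _)) (R.+-identityʳ _)))
      (trans (Hom.1-homo constant) (sym FH.#1≈1)))
    left : ℓ.⟦ HH.tail Φ ⟧ ≋ tail σ ⟪ + 2 ⟫ * σ ⟪ + 0 ⟫ + σ ⟪ + 2 ⟫ * (- (tail σ ⟪ + 0 ⟫))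
    left = ℓ.image-+ {HH.tail σ₊ HHᴿ.* σ₋} {σ₊ HHᴿ.* HH.tail σ₋}
      (ℓ.image-* {HH.tail σ₊} {σ₋} (trans (ℓ.⟦⟧-cong {HH.tail σ₊} {Hom.⟦ translate (+ 1) ⟧ (tail σ)} (translate-1 σ)) (line-translate (+ 1) (+ 1) (+ 1) (tail σ)))
        (line-translate (+ 1) (+ 1) -[1+ 0 ] σ))
      (ℓ.image-* {σ₊} {HH.tail σ₋} (line-translate (+ 1) (+ 1) (+ 1) σ)
        (trans (ℓ.⟦⟧-cong {HH.tail σ₋} {HHᴿ.- Hom.⟦ translate -[1+ 0 ] ⟧ (tail σ)} (translate--1 σ))
          (trans (ℓ.neg-homo (Hom.⟦ translate -[1+ 0 ] ⟧ (tail σ))) (-‿cong (line-translate (+ 1) (+ 1) -[1+ 0 ] (tail σ))))))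
    right : ℓ.⟦ HH.tail Ψ ⟧ ≋ (# 0 * Q + S * tail Q) - (tail S * Q + S * # 0)
    right = ℓ.image-minus {HH.tail S₁ HHᴿ.* Q₂ HHᴿ.+ S₁ HHᴿ.* HH.tail Q₂} {HH.tail S₂ HHᴿ.* Q₁ HHᴿ.+ S₂ HHᴿ.* HH.tail Q₁}
      (ℓ.image-+ {HH.tail S₁ HHᴿ.* Q₂} {S₁ HHᴿ.* HH.tail Q₂}
        (ℓ.image-* {HH.tail S₁} {Q₂} (trans (ℓ.⟦⟧-cong {HH.tail S₁} {HHᴿ.0#} (inner-∂ᵛ S)) ℓ.0-homo) (outer-1 Q))
        (ℓ.image-* {S₁} {HH.tail Q₂} (inner-1 S) (outer-1 (tail Q))))
      (ℓ.image-+ {HH.tail S₂ HHᴿ.* Q₁} {S₂ HHᴿ.* HH.tail Q₁}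
        (ℓ.image-* {HH.tail S₂} {Q₁} (outer-1 (tail S)) (inner-1 Q))
        (ℓ.image-* {S₂} {HH.tail Q₁} (outer-1 S) (trans (ℓ.⟦⟧-cong {HH.tail Q₁} {HHᴿ.0#} (inner-∂ᵛ Q)) ℓ.0-homo)))
      where
      inner-1 : ∀ f → ℓ.⟦ Hom.⟦ inner ⟧ f ⟧ ≋ f
      inner-1 f = trans (line-inner (+ 1) (+ 1) f) (scale-1 f)
      outer-1 : ∀ f → ℓ.⟦ Hom.⟦ outer ⟧ f ⟧ ≋ f
      outer-1 f = trans (line-outer (+ 1) (+ 1) f) (scale-1 f)

  -- The recursions satisfied by σ(nz)

  private
    ℤ-sum : ∀ y x → + y ℤ.+ + x ℤ.* + 1 ≡ + (y ℕ.+ x)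
    ℤ-sum y x = ≡.cong (λ a → + y ℤ.+ a) (ℤₚ.*-identityʳ (+ x))

    ℤ-difference : ∀ d x → + (d ℕ.+ x) ℤ.+ + x ℤ.* -[1+ 0 ] ≡ + d
    ℤ-difference d x = begin
      + (d ℕ.+ x) ℤ.+ + x ℤ.* -[1+ 0 ]  ≡⟨ ≡.cong (λ a → + (d ℕ.+ x) ℤ.+ a) (≡.trans (ℤₚ.*-comm (+ x) -[1+ 0 ]) (ℤₚ.-1*i≡-i (+ x))) ⟩
      (+ d ℤ.+ + x) ℤ.+ (ℤ.- + x)       ≡⟨ ℤₚ.+-assoc (+ d) (+ x) (ℤ.- + x) ⟩
      + d ℤ.+ (+ x ℤ.+ (ℤ.- + x))       ≡⟨ ≡.cong (λ a → + d ℤ.+ a) (ℤₚ.+-inverseʳ (+ x)) ⟩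
      + d ℤ.+ + 0                       ≡⟨ ℤₚ.+-identityʳ (+ d) ⟩
      + d ∎
      where open ≡.≡-Reasoning

  multiple : ℕ → Sequence
  multiple n = σ ⟪ + n ⟫

  -- Indexed by the difference d, so that no truncated subtraction enters.
  addition-ℕ : ∀ d x {y i} → d ℕ.+ x ≡ y → y ℕ.+ x ≡ i →
    multiple i * multiple d ≋ S ⟪ + y ⟫ * Q ⟪ + x ⟫ - S ⟪ + x ⟫ * Q ⟪ + y ⟫
  addition-ℕ d x ≡.refl ≡.refl = addition (+ (d ℕ.+ x)) (+ x) (ℤ-sum (d ℕ.+ x) x) (ℤ-difference d x)

  open SemiringExp semiring using (_^_)

  private
    S⟪⟫ : ∀ z → S ⟪ z ⟫ ≋ σ ⟪ z ⟫ * σ ⟪ z ⟫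
    S⟪⟫ z = Hom.*-homo (scale z) σ σ

    suc≡+1 : ∀ n → suc n ≡ n ℕ.+ 1
    suc≡+1 n = ℕₚ.+-comm 1 n

    suc²≡+2 : ∀ n → suc n ℕ.+ 1 ≡ n ℕ.+ 2
    suc²≡+2 n = ≡.sym (ℕₚ.+-suc n 1)

  -- The minors [a,b] = S(a)Q(b) - S(b)Q(a) satisfy [a,b]S(c) = [a,c]S(b) - [b,c]S(a); take a = m +
  -- 1, b = m, c = 1. The third power of σ(z) is made of the σ(z) in [m+1,m] and of S(1).
  multiple-odd : ∀ m → 1 ℕ.≤ m → multiple (suc (2 ℕ.* m)) * multiple 1 ^ 3 ≋
    multiple (m ℕ.+ 2) * multiple m ^ 3 - multiple (m ℕ.∸ 1) * multiple (m ℕ.+ 1) ^ 3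
  multiple-odd m@(suc n) _ = begin
    multiple (suc (2 ℕ.* m)) * s₁ ^ 3
      ≈⟨ solve 2 (λ x y → x :* y :^ 3 := (x :* y) :* (y :* y)) refl (multiple (suc (2 ℕ.* m))) s₁ ⟩
    (multiple (suc (2 ℕ.* m)) * s₁) * (s₁ * s₁)
      ≈⟨ *-cong (addition-ℕ 1 m ≡.refl (≡.cong (λ k → suc m ℕ.+ k) (≡.sym (ℕₚ.+-identityʳ m)))) (sym (S⟪⟫ (+ 1))) ⟩
    (S ⟪ + suc m ⟫ * Q ⟪ + m ⟫ - S ⟪ + m ⟫ * Q ⟪ + suc m ⟫) * S ⟪ + 1 ⟫
      ≈⟨ solve 6 (λ a a′ b b′ c c′ → (a :* b′ :- b :* a′) :* c := (a :* c′ :- c :* a′) :* b :- (b :* c′ :- c :* b′) :* a) refl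
           (S ⟪ + suc m ⟫) (Q ⟪ + suc m ⟫) (S ⟪ + m ⟫) (Q ⟪ + m ⟫) (S ⟪ + 1 ⟫) (Q ⟪ + 1 ⟫) ⟩
    (S ⟪ + suc m ⟫ * Q ⟪ + 1 ⟫ - S ⟪ + 1 ⟫ * Q ⟪ + suc m ⟫) * S ⟪ + m ⟫ - (S ⟪ + m ⟫ * Q ⟪ + 1 ⟫ - S ⟪ + 1 ⟫ * Q ⟪ + m ⟫) * S ⟪ + suc m ⟫
      ≈⟨ +-cong (*-cong (addition-ℕ m 1 (≡.sym (suc≡+1 m)) (suc²≡+2 m)) (sym (S⟪⟫ (+ m))))
           (-‿cong (*-cong (addition-ℕ n 1 (≡.sym (suc≡+1 n)) (≡.sym (suc≡+1 m))) (sym (S⟪⟫ (+ suc m))))) ⟨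
    (multiple (m ℕ.+ 2) * multiple m) * (multiple m * multiple m) - (multiple (suc m) * multiple n) * (multiple (suc m) * multiple (suc m))
      ≈⟨ solve 4 (λ a b c d → (a :* b) :* (b :* b) :- (d :* c) :* (d :* d) := a :* b :^ 3 :- c :* d :^ 3) refl
           (multiple (m ℕ.+ 2)) (multiple m) (multiple n) (multiple (suc m)) ⟩
    multiple (m ℕ.+ 2) * multiple m ^ 3 - multiple n * multiple (suc m) ^ 3
      ≡⟨ ≡.cong (λ k → multiple (m ℕ.+ 2) * multiple m ^ 3 - multiple n * multiple k ^ 3) (suc≡+1 m) ⟩
    multiple (m ℕ.+ 2) * multiple m ^ 3 - multiple n * multiple (m ℕ.+ 1) ^ 3 ∎
    where
    open SetoidReasoning setoid
    open FH.Solver using (solve; _:=_; _:*_; _:-_; _:^_)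
    s₁ = multiple 1

  -- The same three-term relation with a = m + 1, b = m - 1, c = 1, where [a,b] = σ(2mz)σ(2z).
  multiple-even : ∀ m → 2 ℕ.≤ m → multiple 2 * multiple (2 ℕ.* m) * multiple 1 ^ 2 ≋
    multiple (m ℕ.∸ 1) ^ 2 * multiple m * multiple (m ℕ.+ 2) - multiple (m ℕ.∸ 2) * multiple m * multiple (m ℕ.+ 1) ^ 2
  multiple-even m@(suc (suc n)) (s≤s (s≤s _)) = begin
    multiple 2 * multiple (2 ℕ.* m) * s₁ ^ 2
      ≈⟨ solve 3 (λ x y z → x :* y :* z :^ 2 := (y :* x) :* (z :* z)) refl (multiple 2) (multiple (2 ℕ.* m)) s₁ ⟩
    (multiple (2 ℕ.* m) * multiple 2) * (s₁ * s₁)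
      ≈⟨ *-cong (addition-ℕ 2 (suc n) ≡.refl index) (sym (S⟪⟫ (+ 1))) ⟩
    (S ⟪ + suc m ⟫ * Q ⟪ + suc n ⟫ - S ⟪ + suc n ⟫ * Q ⟪ + suc m ⟫) * S ⟪ + 1 ⟫
      ≈⟨ solve 6 (λ a a′ b b′ c c′ → (a :* b′ :- b :* a′) :* c := (a :* c′ :- c :* a′) :* b :- (b :* c′ :- c :* b′) :* a) refl
           (S ⟪ + suc m ⟫) (Q ⟪ + suc m ⟫) (S ⟪ + suc n ⟫) (Q ⟪ + suc n ⟫) (S ⟪ + 1 ⟫) (Q ⟪ + 1 ⟫) ⟩
    (S ⟪ + suc m ⟫ * Q ⟪ + 1 ⟫ - S ⟪ + 1 ⟫ * Q ⟪ + suc m ⟫) * S ⟪ + suc n ⟫ - (S ⟪ + suc n ⟫ * Q ⟪ + 1 ⟫ - S ⟪ + 1 ⟫ * Q ⟪ + suc n ⟫) * S ⟪ + suc m ⟫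
      ≈⟨ +-cong (*-cong (addition-ℕ m 1 (≡.sym (suc≡+1 m)) (suc²≡+2 m)) (sym (S⟪⟫ (+ suc n))))
           (-‿cong (*-cong (addition-ℕ n 1 (≡.sym (suc≡+1 n)) (≡.sym (suc≡+1 (suc n)))) (sym (S⟪⟫ (+ suc m))))) ⟨
    (multiple (m ℕ.+ 2) * multiple m) * (multiple (suc n) * multiple (suc n)) - (multiple m * multiple n) * (multiple (suc m) * multiple (suc m))
      ≈⟨ solve 5 (λ a b c d e → (a :* b) :* (c :* c) :- (b :* d) :* (e :* e) := c :^ 2 :* b :* a :- d :* b :* e :^ 2) refl
           (multiple (m ℕ.+ 2)) (multiple m) (multiple (suc n)) (multiple n) (multiple (suc m)) ⟩
    multiple (suc n) ^ 2 * multiple m * multiple (m ℕ.+ 2) - multiple n * multiple m * multiple (suc m) ^ 2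
      ≡⟨ ≡.cong (λ k → multiple (suc n) ^ 2 * multiple m * multiple (m ℕ.+ 2) - multiple n * multiple m * multiple k ^ 2) (suc≡+1 m) ⟩
    multiple (suc n) ^ 2 * multiple m * multiple (m ℕ.+ 2) - multiple n * multiple m * multiple (m ℕ.+ 1) ^ 2 ∎
    where
    open SetoidReasoning setoid
    open FH.Solver using (solve; _:=_; _:*_; _:-_; _:^_)
    s₁ = multiple 1
    index : 2 ℕ.+ suc n ℕ.+ suc n ≡ 2 ℕ.* m
    index = ℕS.solve 1 (λ k → ℕS.con 2 ℕS.:+ (ℕS.con 1 ℕS.:+ k) ℕS.:+ (ℕS.con 1 ℕS.:+ k)
      ℕS.:= ℕS.con 2 ℕS.:* (ℕS.con 2 ℕS.:+ k)) ≡.refl n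

  -- Closed forms of σ(nz) for n up to 4

  multiple-0 : multiple 0 ≋ 0#
  multiple-0 = trans (scale-0 σ) (unit-0 σ≈₀)

  multiple-1 : multiple 1 ≋ σ
  multiple-1 = scale-1 σ

  private
    module SM = SmallMultiples H shift isSystem
    ⟨_⟩ : Expr 7 → Sequence
    ⟨_⟩ = EH.eval ρ

  multiple-2 : multiple 2 ≋ EH.eval ρ σ₂ᵉ
  multiple-2 = trans duplication (trans (+-cong (*-congʳ (∂≈ Sᵉ)) (-‿cong (*-congˡ (∂≈ Qᵉ))))
    (trans (solve 4 (λ a b c d → a :* b :- c :* d := a :* b :+ con -[1+ 0 ] :* (c :* d)) refl ⟨ D Sᵉ ⟩ Q S ⟨ D Qᵉ ⟩) SM.σ₂≈))
    where open FH.Solver using (solve; _:=_; con; _:+_; _:*_; _:-_)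

  private
    ∂-of : ∀ {f} e → f ≋ ⟨ e ⟩ → tail f ≋ ⟨ D e ⟩
    ∂-of e p = trans (tail-cong p) (∂≈ e)

    cancel-# : ∀ n {f g} → FH.# suc n * f ≋ FH.# suc n * g → f ≋ g
    cancel-# n {f} {g} e = x∙y⁻¹≈ε⇒x≈y f g (torsionFreeᴴ n (trans (x[y-z]≈xy-xz (FH.# suc n) f g) (x≈y⇒x∙y⁻¹≈ε e)))
      where open RingProperties (CommutativeRing.ring H)

    χ⁸q : Expr 7
    χ⁸q = var 5F ⟨^⟩ 8 ⟨*⟩ q₂ᵉ

  -- Evaluating Q = σ′² - σσ″ at 2z with derivatives taken in z gives four times the wanted value;
  -- torsion-freeness removes the 4.
  Q⟪2⟫ : Q ⟪ + 2 ⟫ ≋ ⟨ χ⁸q ⟩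
  Q⟪2⟫ = cancel-# 3 (begin
    # 4 * Q ⟪ + 2 ⟫            ≈⟨ *-congˡ Q⟪2⟫≈ ⟩
    # 4 * (a * a - b * a″)      ≈⟨ solve 3 (λ a b a″ → con (+ 4) :* (a :* a :- b :* a″) := (con (+ 2) :* a) :* (con (+ 2) :* a) :+ con -[1+ 0 ] :* (b :* (con (+ 2) :* (con (+ 2) :* a″)))) refl a b a″ ⟩
    (# 2 * a) * (# 2 * a) + fromℤ -[1+ 0 ] * (b * (# 2 * (# 2 * a″)))
      ≈⟨ +-cong (*-cong tail-b tail-b) (*-congˡ (*-cong multiple-2 tail²-b)) ⟩
    ⟨ D σ₂ᵉ ⟨*⟩ D σ₂ᵉ ⟨-⟩ σ₂ᵉ ⟨*⟩ D (D σ₂ᵉ) ⟩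
      ≈⟨ SM.4Q₂≈ ⟩
    # 4 * ⟨ χ⁸q ⟩              ∎)
    where
    open SetoidReasoning setoid
    open FH using (#_; fromℤ)
    open FH.Solver using (solve; _:=_; con; _:+_; _:*_; _:-_)
    a b a″ : Sequence
    a = tail σ ⟪ + 2 ⟫
    b = σ ⟪ + 2 ⟫
    a″ = tail (tail σ) ⟪ + 2 ⟫
    Q≈ : Q ≋ tail σ * tail σ - σ * tail (tail σ)
    Q≈ = trans SM.Q≈ (trans (solve 3 (λ x y z → x :* x :+ con -[1+ 0 ] :* (y :* z) := x :* x :- y :* z) refl ⟨ D σᵉ ⟩ σ ⟨ D (D σᵉ) ⟩)
      (sym (+-cong (*-cong (∂≈ σᵉ) (∂≈ σᵉ)) (-‿cong (*-congˡ (∂-of (D σᵉ) (∂≈ σᵉ)))))))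
    module s = Hom (scale (+ 2))
    Q⟪2⟫≈ : Q ⟪ + 2 ⟫ ≋ a * a - b * a″
    Q⟪2⟫≈ = trans (s.⟦⟧-cong Q≈) (s.image-minus (s.*-homo (tail σ) (tail σ)) (s.*-homo σ (tail (tail σ))))
    tail-b : # 2 * a ≋ ⟨ D σ₂ᵉ ⟩
    tail-b = trans (sym (scale-tail (+ 2) σ)) (∂-of σ₂ᵉ multiple-2)
    tail²-b : # 2 * (# 2 * a″) ≋ ⟨ D (D σ₂ᵉ) ⟩
    tail²-b = trans (*-congˡ (sym (scale-tail (+ 2) (tail σ))))
      (trans (sym (Derivation.∂-constˡ shift (Derivation.∂-# shift 2) a)) (∂-of (D σ₂ᵉ) tail-b))

  S⟪2⟫ : S ⟪ + 2 ⟫ ≋ ⟨ σ₂ᵉ ⟨*⟩ σ₂ᵉ ⟩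
  S⟪2⟫ = trans (S⟪⟫ (+ 2)) (*-cong multiple-2 multiple-2)

  private
    cancel-σ : ∀ {f g} → f * σ ≋ g * σ → f ≋ g
    cancel-σ {f} {g} e = x∙y⁻¹≈ε⇒x≈y f g (regular-σ (trans ([y-z]x≈yx-zx σ f g) (x≈y⇒x∙y⁻¹≈ε e)))
      where open RingProperties (CommutativeRing.ring H)

    minusᵉ : ∀ x y → x - y ≋ x + FH.fromℤ -[1+ 0 ] * y
    minusᵉ = solve 2 (λ x y → x :- y := x :+ con -[1+ 0 ] :* y) refl
      where open FH.Solver using (solve; _:=_; con; _:+_; _:*_; _:-_)

  multiple-3 : multiple 3 ≋ ⟨ σ₃ᵉ ⟩
  multiple-3 = cancel-σ (begin
    multiple 3 * σ                                  ≈⟨ *-congˡ multiple-1 ⟨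
    multiple 3 * multiple 1                         ≈⟨ addition-ℕ 1 1 ≡.refl ≡.refl ⟩
    S ⟪ + 2 ⟫ * Q ⟪ + 1 ⟫ - S ⟪ + 1 ⟫ * Q ⟪ + 2 ⟫   ≈⟨ +-cong (*-cong S⟪2⟫ (scale-1 Q)) (-‿cong (*-cong (scale-1 S) Q⟪2⟫)) ⟩
    ⟨ σ₂ᵉ ⟨*⟩ σ₂ᵉ ⟩ * Q - S * ⟨ χ⁸q ⟩               ≈⟨ minusᵉ _ _ ⟩
    ⟨ σ₂ᵉ ⟨*⟩ σ₂ᵉ ⟨*⟩ Qᵉ ⟨-⟩ Sᵉ ⟨*⟩ χ⁸q ⟩           ≈⟨ SM.σ₃σ≈ ⟩
    ⟨ σ₃ᵉ ⟩ * σ ∎)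
    where open SetoidReasoning setoid

  -- Duplication applied at 2z. The derivatives of S(2z) and Q(2z) in z carry a factor 2, which is
  -- cancelled at the end.
  multiple-4 : multiple 4 ≋ ⟨ σ₄ᵉ ⟩
  multiple-4 = cancel-# 1 (begin
    # 2 * multiple 4
      ≈⟨ *-congˡ (scale-scale (+ 2) (+ 2) σ) ⟨
    # 2 * σ ⟪ + 2 ⟫ ⟪ + 2 ⟫
      ≈⟨ *-congˡ (trans (s.⟦⟧-cong duplication) (s.image-minus (s.*-homo (tail S) Q) (s.*-homo S (tail Q)))) ⟩
    # 2 * (tail S ⟪ + 2 ⟫ * Q ⟪ + 2 ⟫ - S ⟪ + 2 ⟫ * tail Q ⟪ + 2 ⟫)
      ≈⟨ solve 4 (λ a b c d → con (+ 2) :* (a :* b :- c :* d) := (con (+ 2) :* a) :* b :+ con -[1+ 0 ] :* (c :* (con (+ 2) :* d))) refl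
           (tail S ⟪ + 2 ⟫) (Q ⟪ + 2 ⟫) (S ⟪ + 2 ⟫) (tail Q ⟪ + 2 ⟫) ⟩
    (# 2 * tail S ⟪ + 2 ⟫) * Q ⟪ + 2 ⟫ + fromℤ -[1+ 0 ] * (S ⟪ + 2 ⟫ * (# 2 * tail Q ⟪ + 2 ⟫))
      ≈⟨ +-cong (*-cong (trans (sym (scale-tail (+ 2) S)) (∂-of (σ₂ᵉ ⟨*⟩ σ₂ᵉ) S⟪2⟫)) Q⟪2⟫)
           (*-congˡ (*-cong S⟪2⟫ (trans (sym (scale-tail (+ 2) Q)) (∂-of χ⁸q Q⟪2⟫)))) ⟩
    ⟨ D (σ₂ᵉ ⟨*⟩ σ₂ᵉ) ⟨*⟩ χ⁸q ⟨-⟩ σ₂ᵉ ⟨*⟩ σ₂ᵉ ⟨*⟩ D χ⁸q ⟩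
      ≈⟨ SM.2σ₄≈ ⟩
    # 2 * ⟨ σ₄ᵉ ⟩ ∎)
    where
    open SetoidReasoning setoid
    open FH using (#_; fromℤ)
    open FH.Solver using (solve; _:=_; con; _:+_; _:*_; _:-_)
    module s = Hom (scale (+ 2))

-- Localisation and evaluation of polynomials

module _ {c ℓ} (H : CommutativeRing c ℓ) where
  open CommutativeRing H

  -- Only t has to be inverted to make room for x = 1/t² and y = w/t³. Regularity of t keeps the
  -- series embedded.
  module Localisation (t : Carrier) (regular : ∀ {f} → f * t ≈ 0# → f ≈ 0#) where
    open FromIntegers H
    open Solver using (solve; _:=_; _:+_; _:*_)
    open SemiringExp semiring using (_^_; ^-homo-*)
    open RingProperties ring
    open SetoidReasoning setoid

    regular-^ : ∀ n {f} → f * t ^ n ≈ 0# → f ≈ 0#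
    regular-^ zero e = trans (sym (*-identityʳ _)) e
    regular-^ (suc n) {f} e = regular (regular-^ n (trans (*-assoc f t (t ^ n)) e))

    cancel-^ : ∀ n {f g} → f * t ^ n ≈ g * t ^ n → f ≈ g
    cancel-^ n {f} {g} e = x∙y⁻¹≈ε⇒x≈y f g (regular-^ n (trans ([y-z]x≈yx-zx (t ^ n) f g) (x≈y⇒x∙y⁻¹≈ε e)))

    infix 5 _/t^_
    record Fraction : Set c where
      constructor _/t^_
      field
        numerator : Carrier
        order : ℕ
    open Fraction

    infix 4 _≃_
    record _≃_ (u v : Fraction) : Set ℓ where
      constructor cross
      field uncross : numerator u * t ^ order v ≈ numerator v * t ^ order u
    open _≃_ public

    private
      split : ∀ k l → t ^ (k ℕ.+ l) ≈ t ^ k * t ^ l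
      split = ^-homo-* t

      _⊞_ _⊠_ : Fraction → Fraction → Fraction
      (f /t^ k) ⊞ (g /t^ l) = f * t ^ l + g * t ^ k /t^ k ℕ.+ l
      (f /t^ k) ⊠ (g /t^ l) = f * g /t^ k ℕ.+ l

      ≃-refl : ∀ {u} → u ≃ u
      ≃-refl = cross refl

      ≃-sym : ∀ {u v} → u ≃ v → v ≃ u
      ≃-sym (cross e) = cross (sym e)

      -- Transitivity of cross-multiplied equality is where t has to be regular.
      ≃-trans : ∀ {u v x} → u ≃ v → v ≃ x → u ≃ x
      ≃-trans {f /t^ k} {g /t^ l} {h /t^ m} (cross p) (cross q) = cross (cancel-^ l (begin
        (f * t ^ m) * t ^ l  ≈⟨ swap f (t ^ m) (t ^ l) ⟩
        (f * t ^ l) * t ^ m  ≈⟨ *-congʳ p ⟩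
        (g * t ^ k) * t ^ m  ≈⟨ swap g (t ^ k) (t ^ m) ⟩
        (g * t ^ m) * t ^ k  ≈⟨ *-congʳ q ⟩
        (h * t ^ l) * t ^ k  ≈⟨ swap h (t ^ l) (t ^ k) ⟩
        (h * t ^ k) * t ^ l  ∎))
        where
        swap : ∀ x y z → (x * y) * z ≈ (x * z) * y
        swap = solve 3 (λ x y z → (x :* y) :* z := (x :* z) :* y) refl

      ⊞-cong : ∀ {u u′ v v′} → u ≃ u′ → v ≃ v′ → u ⊞ v ≃ u′ ⊞ v′
      ⊞-cong {f /t^ k} {f′ /t^ k′} {g /t^ l} {g′ /t^ l′} (cross p) (cross q) = cross (begin
        (f * t ^ l + g * t ^ k) * t ^ (k′ ℕ.+ l′)   ≈⟨ *-congˡ (split k′ l′) ⟩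
        (f * t ^ l + g * t ^ k) * (t ^ k′ * t ^ l′)
          ≈⟨ solve 6 (λ f g k l k′ l′ → (f :* l :+ g :* k) :* (k′ :* l′) := (f :* k′) :* (l :* l′) :+ (g :* l′) :* (k :* k′)) refl f g (t ^ k) (t ^ l) (t ^ k′) (t ^ l′) ⟩
        (f * t ^ k′) * (t ^ l * t ^ l′) + (g * t ^ l′) * (t ^ k * t ^ k′)
          ≈⟨ +-cong (*-congʳ p) (*-congʳ q) ⟩
        (f′ * t ^ k) * (t ^ l * t ^ l′) + (g′ * t ^ l) * (t ^ k * t ^ k′)
          ≈⟨ solve 6 (λ f g k l k′ l′ → (f :* k) :* (l :* l′) :+ (g :* l) :* (k :* k′) := (f :* l′ :+ g :* k′) :* (k :* l)) refl f′ g′ (t ^ k) (t ^ l) (t ^ k′) (t ^ l′) ⟩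
        (f′ * t ^ l′ + g′ * t ^ k′) * (t ^ k * t ^ l) ≈⟨ *-congˡ (split k l) ⟨
        (f′ * t ^ l′ + g′ * t ^ k′) * t ^ (k ℕ.+ l) ∎)

      ⊠-cong : ∀ {u u′ v v′} → u ≃ u′ → v ≃ v′ → u ⊠ v ≃ u′ ⊠ v′
      ⊠-cong {f /t^ k} {f′ /t^ k′} {g /t^ l} {g′ /t^ l′} (cross p) (cross q) = cross (begin
        (f * g) * t ^ (k′ ℕ.+ l′)       ≈⟨ *-congˡ (split k′ l′) ⟩
        (f * g) * (t ^ k′ * t ^ l′)     ≈⟨ solve 4 (λ f g k l → (f :* g) :* (k :* l) := (f :* k) :* (g :* l)) refl f g (t ^ k′) (t ^ l′) ⟩
        (f * t ^ k′) * (g * t ^ l′)     ≈⟨ *-cong p q ⟩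
        (f′ * t ^ k) * (g′ * t ^ l)     ≈⟨ solve 4 (λ f g k l → (f :* k) :* (g :* l) := (f :* g) :* (k :* l)) refl f′ g′ (t ^ k) (t ^ l) ⟩
        (f′ * g′) * (t ^ k * t ^ l)     ≈⟨ *-congˡ (split k l) ⟨
        (f′ * g′) * t ^ (k ℕ.+ l) ∎)

      same-order : ∀ {f g k l} → f ≈ g → k ≡ l → (f /t^ k) ≃ (g /t^ l)
      same-order p ≡.refl = cross (*-congʳ p)

      ⊞-comm : ∀ u v → u ⊞ v ≃ v ⊞ u
      ⊞-comm (f /t^ k) (g /t^ l) = same-order (+-comm _ _) (ℕₚ.+-comm k l)

      ⊞-assoc : ∀ u v x → (u ⊞ v) ⊞ x ≃ u ⊞ (v ⊞ x)
      ⊞-assoc (f /t^ k) (g /t^ l) (h /t^ m) = same-order (begin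
        (f * t ^ l + g * t ^ k) * t ^ m + h * t ^ (k ℕ.+ l)     ≈⟨ +-congˡ (*-congˡ (split k l)) ⟩
        (f * t ^ l + g * t ^ k) * t ^ m + h * (t ^ k * t ^ l)
          ≈⟨ solve 6 (λ f g h k l m → (f :* l :+ g :* k) :* m :+ h :* (k :* l) := f :* (l :* m) :+ (g :* m :+ h :* l) :* k) refl f g h (t ^ k) (t ^ l) (t ^ m) ⟩
        f * (t ^ l * t ^ m) + (g * t ^ m + h * t ^ l) * t ^ k   ≈⟨ +-congʳ (*-congˡ (split l m)) ⟨
        f * t ^ (l ℕ.+ m) + (g * t ^ m + h * t ^ l) * t ^ k     ∎) (ℕₚ.+-assoc k l m)

      ⊠-comm : ∀ u v → u ⊠ v ≃ v ⊠ u
      ⊠-comm (f /t^ k) (g /t^ l) = same-order (*-comm _ _) (ℕₚ.+-comm k l)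

      ⊞-identityˡ : ∀ u → (0# /t^ 0) ⊞ u ≃ u
      ⊞-identityˡ (f /t^ k) = same-order (trans (+-cong (zeroˡ _) (*-identityʳ f)) (+-identityˡ f)) ≡.refl

      ⊠-identityˡ : ∀ u → (1# /t^ 0) ⊠ u ≃ u
      ⊠-identityˡ (f /t^ k) = same-order (*-identityˡ f) ≡.refl

      inverseˡ : ∀ u → (- numerator u /t^ order u) ⊞ u ≃ (0# /t^ 0)
      inverseˡ (f /t^ k) = cross (trans (*-identityʳ _)
        (trans (trans (sym (distribʳ (t ^ k) (- f) f)) (*-congʳ (-‿inverseˡ f))) (trans (zeroˡ _) (sym (zeroˡ _)))))

      distribˡ′ : ∀ u v x → u ⊠ (v ⊞ x) ≃ (u ⊠ v) ⊞ (u ⊠ x)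
      distribˡ′ (f /t^ k) (g /t^ l) (h /t^ m) = cross (begin
        (f * (g * t ^ m + h * t ^ l)) * t ^ ((k ℕ.+ l) ℕ.+ (k ℕ.+ m))
          ≈⟨ *-congˡ (trans (split (k ℕ.+ l) (k ℕ.+ m)) (*-cong (split k l) (split k m))) ⟩
        (f * (g * t ^ m + h * t ^ l)) * ((t ^ k * t ^ l) * (t ^ k * t ^ m))
          ≈⟨ solve 6 (λ f g h k l m → (f :* (g :* m :+ h :* l)) :* ((k :* l) :* (k :* m)) := ((f :* g) :* (k :* m) :+ (f :* h) :* (k :* l)) :* (k :* (l :* m))) refl f g h (t ^ k) (t ^ l) (t ^ m) ⟩
        ((f * g) * (t ^ k * t ^ m) + (f * h) * (t ^ k * t ^ l)) * (t ^ k * (t ^ l * t ^ m))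
          ≈⟨ *-cong (+-cong (*-congˡ (split k m)) (*-congˡ (split k l))) (trans (split k (l ℕ.+ m)) (*-congˡ (split l m))) ⟨
        ((f * g) * t ^ (k ℕ.+ m) + (f * h) * t ^ (k ℕ.+ l)) * t ^ (k ℕ.+ (l ℕ.+ m)) ∎)

    localisation : CommutativeRing c ℓ
    localisation = record
      { Carrier = Fraction
      ; _≈_ = _≃_
      ; _+_ = _⊞_
      ; _*_ = _⊠_
      ; -_ = λ u → - numerator u /t^ order u
      ; 0# = 0# /t^ 0
      ; 1# = 1# /t^ 0
      ; isCommutativeRing = record
        { isRing = record
          { +-isAbelianGroup = record
            { isGroup = record
              { isMonoid = record
                { isSemigroup = record
                  { isMagma = record
                    { isEquivalence = record { refl = ≃-refl ; sym = ≃-sym ; trans = ≃-trans }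
                    ; ∙-cong = ⊞-cong }
                  ; assoc = ⊞-assoc }
                ; identity = ⊞-identityˡ , λ u → ≃-trans (⊞-comm u _) (⊞-identityˡ u) }
              ; inverse = inverseˡ , λ u → ≃-trans (⊞-comm u _) (inverseˡ u)
              ; ⁻¹-cong = λ { {f /t^ k} {g /t^ l} (cross p) → cross (trans (sym (-‿distribˡ-* f (t ^ l))) (trans (-‿cong p) (-‿distribˡ-* g (t ^ k)))) } }
            ; comm = ⊞-comm }
          ; *-cong = ⊠-cong
          ; *-assoc = λ { (f /t^ k) (g /t^ l) (h /t^ m) → same-order (*-assoc f g h) (ℕₚ.+-assoc k l m) }
          ; *-identity = ⊠-identityˡ , λ u → ≃-trans (⊠-comm u _) (⊠-identityˡ u)
          ; distrib = distribˡ′ , λ u v x → ≃-trans (⊠-comm (v ⊞ x) u) (≃-trans (distribˡ′ u v x) (⊞-cong (⊠-comm u v) (⊠-comm u x))) }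
        ; *-comm = ⊠-comm } }

    private module L = CommutativeRing localisation

    embed : Hom H localisation
    embed = record
      { ⟦_⟧ = _/t^ 0
      ; ⟦⟧-cong = λ e → same-order e ≡.refl
      ; +-homo = λ f g → same-order (sym (+-cong (*-identityʳ f) (*-identityʳ g))) ≡.refl
      ; *-homo = λ f g → same-order refl ≡.refl
      ; 1-homo = same-order refl ≡.refl }

    embed-injective : ∀ {f g} → (f /t^ 0) ≃ (g /t^ 0) → f ≈ g
    embed-injective (cross e) = cancel-^ 0 e

    1/t : Fraction
    1/t = 1# /t^ 1

    t*1/t : (t /t^ 0) L.* 1/t L.≈ L.1#
    t*1/t = cross (trans (*-identityʳ _) (trans (*-comm t 1#) (*-congˡ (sym (*-identityʳ t)))))

    embed-regular : ∀ {f} → (∀ {g} → g * f ≈ 0# → g ≈ 0#) → ∀ {u} → u L.* (f /t^ 0) L.≈ L.0# → u L.≈ L.0#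
    embed-regular {f} f-regular {g /t^ k} (cross e) =
      cross (trans (*-congʳ (f-regular (trans (sym (*-identityʳ _)) (trans e (zeroˡ _))))) (trans (zeroˡ _) (sym (zeroˡ _))))

-- Homomorphisms out of coefficient lists

module _ {C : Set} (0ᶜ : C) (_+ᶜ_ _*ᶜ_ : C → C → C) (-ᶜ_ : C → C) where
  -- Because of trailing zeros the lists do not form a ring under propositional equality, so
  -- homomorphisms are stated for the raw operations.
  record RawHom {c ℓ} (R : CommutativeRing c ℓ) : Set (c ⊔ ℓ) where
    open CommutativeRing R
    field
      φ : C → Carrier
      φ-0 : φ 0ᶜ ≈ 0#
      φ-+ : ∀ a b → φ (a +ᶜ b) ≈ φ a + φ b
      φ-* : ∀ a b → φ (a *ᶜ b) ≈ φ a * φ b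
      φ-neg : ∀ a → φ (-ᶜ a) ≈ - φ a

module PolynomialHoms {C : Set} (0ᶜ : C) (_+ᶜ_ _*ᶜ_ : C → C → C) (-ᶜ_ : C → C)
  {c ℓ} (R : CommutativeRing c ℓ) (hom : RawHom 0ᶜ _+ᶜ_ _*ᶜ_ -ᶜ_ R) where
  open CommutativeRing R
  open RawHom hom
  open RingProperties ring
  private module P = PolyOps 0ᶜ _+ᶜ_ _*ᶜ_ -ᶜ_
  open P using (Poly; _⊕_; _⊗_; neg; coeff) renaming (scale to scaleᴾ)

  coefficient : Poly → ℕ → Carrier
  coefficient p n = φ (coeff p n)

  private
    coefficient-⊕ : ∀ p q n → coefficient (p ⊕ q) n ≈ coefficient p n + coefficient q n
    coefficient-⊕ [] q n = sym (trans (+-congʳ φ-0) (+-identityˡ _))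
    coefficient-⊕ (a ∷ p) [] n = sym (trans (+-congˡ φ-0) (+-identityʳ _))
    coefficient-⊕ (a ∷ p) (b ∷ q) zero = φ-+ a b
    coefficient-⊕ (a ∷ p) (b ∷ q) (suc n) = coefficient-⊕ p q n

    coefficient-neg : ∀ p n → coefficient (neg p) n ≈ - coefficient p n
    coefficient-neg [] n = trans φ-0 (trans (sym -0#≈0#) (-‿cong (sym φ-0)))
    coefficient-neg (a ∷ p) zero = φ-neg a
    coefficient-neg (a ∷ p) (suc n) = coefficient-neg p n

    coefficient-scale : ∀ a p n → coefficient (scaleᴾ a p) n ≈ φ a * coefficient p n
    coefficient-scale a [] n = trans φ-0 (trans (sym (zeroʳ _)) (*-congˡ (sym φ-0)))
    coefficient-scale a (b ∷ p) zero = φ-* a b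
    coefficient-scale a (b ∷ p) (suc n) = coefficient-scale a p n

  module PS = PowerSeries R
  open Sequences R

  private
    coefficient-⊗ : ∀ p q n → coefficient (p ⊗ q) n ≈ (coefficient p PS.⊠ coefficient q) n
    coefficient-⊗ [] q n = trans φ-0 (sym (at (S.trans (S.*-congʳ {y = S.0#} (pointwise (λ _ → φ-0))) (S.zeroˡ (coefficient q))) n))
      where module S = CommutativeRing PS.powerSeriesRing
    coefficient-⊗ (a ∷ p) q zero = trans (coefficient-⊕ (scaleᴾ a q) _ 0)
      (trans (+-cong (coefficient-scale a q 0) φ-0) (+-identityʳ _))
    coefficient-⊗ (a ∷ p) q (suc n) = trans (coefficient-⊕ (scaleᴾ a q) _ (suc n))
      (+-cong (coefficient-scale a q (suc n)) (coefficient-⊗ p q n))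

  coefficients : RawHom [] _⊕_ _⊗_ neg PS.powerSeriesRing
  coefficients = record
    { φ = coefficient
    ; φ-0 = pointwise (λ _ → φ-0)
    ; φ-+ = λ p q → pointwise (coefficient-⊕ p q)
    ; φ-* = λ p q → pointwise (coefficient-⊗ p q)
    ; φ-neg = λ p → pointwise (coefficient-neg p) }

  module _ (x : Carrier) where
    evaluate : Poly → Carrier
    evaluate [] = 0#
    evaluate (a ∷ p) = φ a + x * evaluate p

    open FromIntegers R using (module Solver)
    open Solver using (solve; _:=_; _:+_; _:*_; :-_)

    evaluate-⊕ : ∀ p q → evaluate (p ⊕ q) ≈ evaluate p + evaluate q
    evaluate-⊕ [] q = sym (+-identityˡ _)
    evaluate-⊕ (a ∷ p) [] = sym (+-identityʳ _)
    evaluate-⊕ (a ∷ p) (b ∷ q) = trans (+-cong (φ-+ a b) (*-congˡ (evaluate-⊕ p q)))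
      (solve 5 (λ a b x p q → (a :+ b) :+ x :* (p :+ q) := (a :+ x :* p) :+ (b :+ x :* q)) refl (φ a) (φ b) x _ _)

    evaluate-neg : ∀ p → evaluate (neg p) ≈ - evaluate p
    evaluate-neg [] = sym -0#≈0#
    evaluate-neg (a ∷ p) = trans (+-cong (φ-neg a) (*-congˡ (evaluate-neg p)))
      (solve 3 (λ a x p → (:- a) :+ x :* (:- p) := :- (a :+ x :* p)) refl (φ a) x _)

    evaluate-scale : ∀ a p → evaluate (scaleᴾ a p) ≈ φ a * evaluate p
    evaluate-scale a [] = sym (zeroʳ _)
    evaluate-scale a (b ∷ p) = trans (+-cong (φ-* a b) (*-congˡ (evaluate-scale a p)))
      (solve 4 (λ a b x p → a :* b :+ x :* (a :* p) := a :* (b :+ x :* p)) refl (φ a) (φ b) x _)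

    evaluate-⊗ : ∀ p q → evaluate (p ⊗ q) ≈ evaluate p * evaluate q
    evaluate-⊗ [] q = sym (zeroˡ _)
    evaluate-⊗ (a ∷ p) q = trans (evaluate-⊕ (scaleᴾ a q) (0ᶜ ∷ (p ⊗ q)))
      (trans (+-cong (evaluate-scale a q) (trans (+-congʳ φ-0) (trans (+-identityˡ _) (*-congˡ (evaluate-⊗ p q)))))
        (solve 4 (λ a x p q → a :* q :+ x :* (p :* q) := (a :+ x :* p) :* q) refl (φ a) x _ _))

    -- Lists of different lengths may have the same coefficients, so surplus entries must be seen to
    -- contribute 0.
    evaluate-cong : ∀ p q → (∀ n → coefficient p n ≈ coefficient q n) → evaluate p ≈ evaluate q
    evaluate-cong [] [] e = refl
    evaluate-cong [] (b ∷ q) e = sym (trans (+-cong (trans (sym (e 0)) φ-0) (*-congˡ (sym (evaluate-cong [] q (λ n → e (suc n))))))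
      (trans (+-identityˡ _) (zeroʳ x)))
    evaluate-cong (a ∷ p) [] e = trans (+-cong (trans (e 0) φ-0) (*-congˡ (evaluate-cong p [] (λ n → e (suc n)))))
      (trans (+-identityˡ _) (zeroʳ x))
    evaluate-cong (a ∷ p) (b ∷ q) e = +-cong (e 0) (*-congˡ (evaluate-cong p q (λ n → e (suc n))))

fromℤ-ℤ : ∀ z → FromIntegers.fromℤ ℤₚ.+-*-commutativeRing z ≡ z
fromℤ-ℤ (+ n) = go n
  where
  open FromIntegers ℤₚ.+-*-commutativeRing
  go : ∀ n → # n ≡ + n
  go zero = ≡.refl
  go (suc n) = ≡.cong (λ z → + 1 ℤ.+ z) (go n)
fromℤ-ℤ -[1+ n ] = ≡.cong ℤ.-_ (fromℤ-ℤ (+ suc n))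

torsionFree-ℤ : Divisibility.TorsionFree ℤₚ.+-*-commutativeRing
torsionFree-ℤ n {x} e = ℤₚ.*-cancelˡ-≡ (+ suc n) x (+ 0)
  (≡.trans (≡.cong (ℤ._* x) (≡.sym (fromℤ-ℤ (+ suc n)))) (≡.trans e (≡.sym (ℤₚ.*-zeroʳ (+ suc n)))))

module PowerSeriesIntegers {c ℓ} (C : CommutativeRing c ℓ) where
  open CommutativeRing C
  open Sequences C
  open PowerSeries C
  open FromIntegers C
  open FromIntegers powerSeriesRing using () renaming (#_ to #ᴾ_)

  constant : Hom C powerSeriesRing
  constant = record
    { ⟦_⟧ = unit
    ; ⟦⟧-cong = λ e → pointwise (λ { zero → e ; (suc n) → refl })
    ; +-homo = λ a b → pointwise (λ { zero → refl ; (suc n) → sym (+-identityˡ 0#) })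
    ; *-homo = λ a b → pointwise (λ { zero → refl ; (suc n) → sym (trans (scalar-⊠ a (unit b) (suc n)) (zeroʳ a)) })
    ; 1-homo = pointwise (λ n → refl) }

  #-at : ∀ k f n → (#ᴾ k ⊠ f) n ≈ # k * f n
  #-at k f n = trans (at (P.*-congʳ {f} (P.sym (Hom.#-homo constant k))) n) (scalar-⊠ (# k) f n)
    where module P = CommutativeRing powerSeriesRing

  torsionFree : Divisibility.TorsionFree C → Divisibility.TorsionFree powerSeriesRing
  torsionFree tf n {f} e = pointwise (λ i → tf n (trans (sym (#-at (suc n) f i)) (at e i)))

-- Values of division polynomials at a point of the curve

module SmallDivisionPolynomials {c ℓ} (L : CommutativeRing c ℓ) where
  open CommutativeRing L
  open FromIntegers L
  open SemiringExp semiring using (_^_)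

  ψ₃ : (A B x : Carrier) → Carrier
  ψ₃ A B x = # 3 * x ^ 4 + # 6 * A * x ^ 2 + # 12 * B * x - A ^ 2

  ψ₄ : (A B x y : Carrier) → Carrier
  ψ₄ A B x y = # 2 * y *
    ( # 2 * x ^ 6 + # 10 * A * x ^ 4 + # 40 * B * x ^ 3
      - # 10 * A ^ 2 * x ^ 2 - # 8 * A * B * x
      - # 2 * (A ^ 3 + # 8 * B ^ 2) )

module _ {c ℓ} (L : CommutativeRing c ℓ) (hom : RawHom [] P2._⊕_ P2._⊗_ P2.neg L) where
  open CommutativeRing L
  open RawHom hom
  open PolynomialHoms [] P2._⊕_ P2._⊗_ P2.neg L hom

  module EvaluateAt (φ-constant : ∀ n → φ ((n ∷ []) ∷ []) ≈ FromIntegers.fromℤ L n) (x : Carrier) where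
    open FromIntegers L
    open SemiringExp semiring using (_^_)

    evaluate-constant : ∀ f → evaluate x (f ∷ []) ≈ φ f
    evaluate-constant f = trans (+-congˡ (zeroʳ x)) (+-identityʳ _)

    evaluate-constP : ∀ n → evaluate x (constP n) ≈ fromℤ n
    evaluate-constP n = trans (evaluate-constant _) (φ-constant n)

    evaluate-xP : evaluate x xP ≈ x
    evaluate-xP = trans (+-cong φ-0 (trans (*-congˡ (trans (evaluate-constP (+ 1)) #1≈1)) (*-identityʳ x))) (+-identityˡ x)

    evaluate-powP : ∀ g n → evaluate x (powP g n) ≈ evaluate x g ^ n
    evaluate-powP g zero = trans (evaluate-constP (+ 1)) #1≈1
    evaluate-powP g (suc n) = trans (evaluate-⊗ x g (powP g n)) (*-congˡ (evaluate-powP g n))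

    a b : Carrier
    a = evaluate x AP
    b = evaluate x BP

    evaluate-fP : evaluate x fP ≈ x * (x * x) + (a * x + b)
    evaluate-fP = trans (evaluate-⊕ x (xP P3.⊗ (xP P3.⊗ xP)) ((AP P3.⊗ xP) P3.⊕ BP)) (+-cong
      (trans (evaluate-⊗ x xP (xP P3.⊗ xP)) (*-cong evaluate-xP (trans (evaluate-⊗ x xP xP) (*-cong evaluate-xP evaluate-xP))))
      (trans (evaluate-⊕ x (AP P3.⊗ xP) BP) (+-congʳ (trans (evaluate-⊗ x AP xP) (*-congˡ evaluate-xP)))))

module _ {c ℓ} (L : CommutativeRing c ℓ) (hom : RawHom [] P2._⊕_ P2._⊗_ P2.neg L) where
  open CommutativeRing L
  open RawHom hom
  open PolynomialHoms [] P2._⊕_ P2._⊗_ P2.neg L hom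

  module CurveEvaluation (φ-constant : ∀ n → φ ((n ∷ []) ∷ []) ≈ FromIntegers.fromℤ L n)
    (x y : Carrier) (y²≈ : y * y ≈ evaluate x fP) where
    open SmallDivisionPolynomials L
    open EvaluateAt L hom φ-constant x
    open FromIntegers L
    open Solver using (solve; _:=_; _:+_; _:*_; :-_)
    open SemiringExp semiring using (_^_; ^-cong)
    open SetoidReasoning setoid

    opaque
     value : E → Carrier
     value (a , b) = evaluate x a + evaluate x b * y

     value-unfold : ∀ a b → value (a , b) ≈ evaluate x a + evaluate x b * y
     value-unfold a b = refl

     value-+ : ∀ u v → value (u +ᴱ v) ≈ value u + value v
     value-+ (a , b) (a′ , b′) = trans (+-cong (evaluate-⊕ x a a′) (*-congʳ (evaluate-⊕ x b b′)))
       (solve 5 (λ a a′ b b′ y → (a :+ a′) :+ (b :+ b′) :* y := (a :+ b :* y) :+ (a′ :+ b′ :* y)) refl _ _ _ _ y)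

     value-neg : ∀ u → value (-ᴱ u) ≈ - value u
     value-neg (a , b) = trans (+-cong (evaluate-neg x a) (*-congʳ (evaluate-neg x b)))
       (solve 3 (λ a b y → (:- a) :+ (:- b) :* y := :- (a :+ b :* y)) refl _ _ y)

     value-minus : ∀ u v → value (u -ᴱ v) ≈ value u - value v
     value-minus u v = trans (value-+ u (-ᴱ v)) (+-congˡ (value-neg v))

     value-* : ∀ u v → value (u *ᴱ v) ≈ value u * value v
     value-* (a , b) (c , d) = begin
       evaluate x ((a P3.⊗ c) P3.⊕ (fP P3.⊗ (b P3.⊗ d))) + evaluate x ((a P3.⊗ d) P3.⊕ (b P3.⊗ c)) * y
         ≈⟨ +-cong (trans (evaluate-⊕ x (a P3.⊗ c) _) (+-cong (evaluate-⊗ x a c) (trans (evaluate-⊗ x fP (b P3.⊗ d)) (*-cong (sym y²≈) (evaluate-⊗ x b d)))))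
              (*-congʳ (trans (evaluate-⊕ x (a P3.⊗ d) _) (+-cong (evaluate-⊗ x a d) (evaluate-⊗ x b c)))) ⟩
       (evaluate x a * evaluate x c + (y * y) * (evaluate x b * evaluate x d)) + (evaluate x a * evaluate x d + evaluate x b * evaluate x c) * y
         ≈⟨ solve 5 (λ a b c d y → (a :* c :+ (y :* y) :* (b :* d)) :+ (a :* d :+ b :* c) :* y := (a :+ b :* y) :* (c :+ d :* y)) refl _ _ _ _ y ⟩
       value (a , b) * value (c , d) ∎

     value-cong : ∀ {u v} → (∀ f g → (∀ j k → coeffAB f j k ≡ coeffAB g j k) → φ f ≈ φ g) → u ≈ᴱ v → value u ≈ value v
     value-cong {a , b} {c , d} φ-cong (p , q) =
       +-cong (evaluate-cong x a c (λ i → φ-cong _ _ (p i))) (*-congʳ (evaluate-cong x b d (λ i → φ-cong _ _ (q i))))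

     value-pure : ∀ a → value (a , []) ≈ evaluate x a
     value-pure a = trans (+-congˡ (zeroˡ y)) (+-identityʳ _)

    value-κ : ∀ n → value (κ n) ≈ fromℤ n
    value-κ n = trans (value-pure (constP n)) (evaluate-constP n)

    value-x : value xE ≈ x
    value-x = trans (value-pure xP) evaluate-xP

    value-y : value yE ≈ y
    value-y = trans (value-unfold [] (constP (+ 1))) (trans (+-identityˡ _) (trans (*-congʳ (trans (evaluate-constP (+ 1)) #1≈1)) (*-identityˡ y)))

    value-^ : ∀ u n → value (u ^ᴱ n) ≈ value u ^ n
    value-^ u zero = trans (value-pure (constP (+ 1))) (trans (evaluate-constP (+ 1)) #1≈1)
    value-^ u (suc n) = trans (value-* u (u ^ᴱ n)) (*-congˡ (value-^ u n))

    value-a : value AE ≈ a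
    value-a = value-pure AP

    value-b : value BE ≈ b
    value-b = value-pure BP

    infixl 7 _*ᵗ_
    infixl 6 _+ᵗ_ _-ᵗ_
    infixr 8 _^ᵗ_
    -- Reified expressions: the single induction `sound` replaces a congruence chain for each of the
    -- long formulas, whose readings in `E` are recovered by computation.
    data Term : Set (c ⊔ ℓ) where
      atom : ∀ u l → value u ≈ l → Term
      _+ᵗ_ _-ᵗ_ _*ᵗ_ : Term → Term → Term
      _^ᵗ_ : Term → ℕ → Term

    ⟦_⟧ᴱ : Term → E
    ⟦ atom u l e ⟧ᴱ = u
    ⟦ s +ᵗ t ⟧ᴱ = ⟦ s ⟧ᴱ +ᴱ ⟦ t ⟧ᴱ
    ⟦ s -ᵗ t ⟧ᴱ = ⟦ s ⟧ᴱ -ᴱ ⟦ t ⟧ᴱ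
    ⟦ s *ᵗ t ⟧ᴱ = ⟦ s ⟧ᴱ *ᴱ ⟦ t ⟧ᴱ
    ⟦ s ^ᵗ n ⟧ᴱ = ⟦ s ⟧ᴱ ^ᴱ n

    ⟦_⟧ᴸ : Term → Carrier
    ⟦ atom u l e ⟧ᴸ = l
    ⟦ s +ᵗ t ⟧ᴸ = ⟦ s ⟧ᴸ + ⟦ t ⟧ᴸ
    ⟦ s -ᵗ t ⟧ᴸ = ⟦ s ⟧ᴸ - ⟦ t ⟧ᴸ
    ⟦ s *ᵗ t ⟧ᴸ = ⟦ s ⟧ᴸ * ⟦ t ⟧ᴸ
    ⟦ s ^ᵗ n ⟧ᴸ = ⟦ s ⟧ᴸ ^ n

    sound : ∀ t → value ⟦ t ⟧ᴱ ≈ ⟦ t ⟧ᴸ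
    sound (atom u l e) = e
    sound (s +ᵗ t) = trans (value-+ ⟦ s ⟧ᴱ ⟦ t ⟧ᴱ) (+-cong (sound s) (sound t))
    sound (s -ᵗ t) = trans (value-minus ⟦ s ⟧ᴱ ⟦ t ⟧ᴱ) (+-cong (sound s) (-‿cong (sound t)))
    sound (s *ᵗ t) = trans (value-* ⟦ s ⟧ᴱ ⟦ t ⟧ᴱ) (*-cong (sound s) (sound t))
    sound (s ^ᵗ n) = trans (value-^ ⟦ s ⟧ᴱ n) (^-cong (sound s) (≡.refl {x = n}))

    private
      κᵗ : ℤ → Term
      κᵗ n = atom (κ n) (fromℤ n) (value-κ n)

      xᵗ yᵗ Aᵗ Bᵗ : Term
      xᵗ = atom xE x value-x
      yᵗ = atom yE y value-y
      Aᵗ = atom AE a value-a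
      Bᵗ = atom BE b value-b

      ψ3ᵗ ψ4ᵗ : Term
      ψ3ᵗ = κᵗ (+ 3) *ᵗ xᵗ ^ᵗ 4 +ᵗ κᵗ (+ 6) *ᵗ Aᵗ *ᵗ xᵗ ^ᵗ 2 +ᵗ κᵗ (+ 12) *ᵗ Bᵗ *ᵗ xᵗ -ᵗ Aᵗ ^ᵗ 2
      ψ4ᵗ = κᵗ (+ 2) *ᵗ yᵗ *ᵗ
        ( κᵗ (+ 2) *ᵗ xᵗ ^ᵗ 6 +ᵗ κᵗ (+ 10) *ᵗ Aᵗ *ᵗ xᵗ ^ᵗ 4 +ᵗ κᵗ (+ 40) *ᵗ Bᵗ *ᵗ xᵗ ^ᵗ 3
          -ᵗ κᵗ (+ 10) *ᵗ Aᵗ ^ᵗ 2 *ᵗ xᵗ ^ᵗ 2 -ᵗ κᵗ (+ 8) *ᵗ Aᵗ *ᵗ Bᵗ *ᵗ xᵗ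
          -ᵗ κᵗ (+ 2) *ᵗ (Aᵗ ^ᵗ 3 +ᵗ κᵗ (+ 8) *ᵗ Bᵗ ^ᵗ 2) )

      ψ3ᵗ≡ : ⟦ ψ3ᵗ ⟧ᴱ ≡ ψ3def
      ψ3ᵗ≡ = ≡.refl

      ψ4ᵗ≡ : ⟦ ψ4ᵗ ⟧ᴱ ≡ ψ4def
      ψ4ᵗ≡ = ≡.refl

    value-ψ3 : value ψ3def ≈ ψ₃ a b x
    value-ψ3 = trans (reflexive (≡.cong value (≡.sym ψ3ᵗ≡))) (sound ψ3ᵗ)

    value-ψ4 : value ψ4def ≈ ψ₄ a b x y
    value-ψ4 = trans (reflexive (≡.cong value (≡.sym ψ4ᵗ≡))) (sound ψ4ᵗ)

    module OfDivisionPolynomials (φ-cong : ∀ f g → (∀ j k → coeffAB f j k ≡ coeffAB g j k) → φ f ≈ φ g)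
      (ψ : ℕ → E) (isψ : IsDivisionPolySeq ψ) where
      open IsDivisionPolySeq isψ

      z : ℕ → Carrier
      z n = value (ψ n)

      private
        ψᵗ : ℕ → Term
        ψᵗ n = atom (ψ n) (z n) refl

        by : ∀ {u} t → u ≈ᴱ ⟦ t ⟧ᴱ → value u ≈ ⟦ t ⟧ᴸ
        by {u} t e = trans (value-cong {u} {⟦ t ⟧ᴱ} φ-cong e) (sound t)

      z0 : z 0 ≈ 0#
      z0 = by {ψ 0} (κᵗ (+ 0)) ψ0
      z1 : z 1 ≈ # 1
      z1 = by {ψ 1} (κᵗ (+ 1)) ψ1
      z2 : z 2 ≈ # 2 * y
      z2 = by {ψ 2} (κᵗ (+ 2) *ᵗ yᵗ) ψ2
      z3 : z 3 ≈ ψ₃ a b x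
      z3 = trans (value-cong {ψ 3} {ψ3def} φ-cong ψ3) value-ψ3
      z4 : z 4 ≈ ψ₄ a b x y
      z4 = trans (value-cong {ψ 4} {ψ4def} φ-cong ψ4) value-ψ4

      z-odd : ∀ m → 2 ≤ m → z (suc (2 ℕ.* m)) ≈ z (m ℕ.+ 2) * z m ^ 3 - z (m ℕ.∸ 1) * z (m ℕ.+ 1) ^ 3
      z-odd m h = by {ψ (suc (2 ℕ.* m))} (ψᵗ (m ℕ.+ 2) *ᵗ ψᵗ m ^ᵗ 3 -ᵗ ψᵗ (m ℕ.∸ 1) *ᵗ ψᵗ (m ℕ.+ 1) ^ᵗ 3) (ψodd m h)

      -- The factor 2y is written as `z 2`, which makes the recursion homogeneous and comparable
      -- with the one for σ(nz).
      z-even : ∀ m → 2 ≤ m → z 2 * z (2 ℕ.* m) ≈ z (m ℕ.∸ 1) ^ 2 * z m * z (m ℕ.+ 2) - z (m ℕ.∸ 2) * z m * z (m ℕ.+ 1) ^ 2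
      z-even m h = trans (*-congʳ z2) (trans (sym (sound (κᵗ (+ 2) *ᵗ yᵗ *ᵗ ψᵗ (2 ℕ.* m))))
        (by {κ (+ 2) *ᴱ yE *ᴱ ψ (2 ℕ.* m)} (ψᵗ (m ℕ.∸ 1) ^ᵗ 2 *ᵗ ψᵗ m *ᵗ ψᵗ (m ℕ.+ 2) -ᵗ ψᵗ (m ℕ.∸ 2) *ᵗ ψᵗ m *ᵗ ψᵗ (m ℕ.+ 1) ^ᵗ 2) (ψeven m h)))

-- Uniqueness of division sequences

even-or-odd : ∀ n → (∃ λ m → n ≡ 2 ℕ.* m) ⊎ (∃ λ m → n ≡ suc (2 ℕ.* m))
even-or-odd zero = inj₁ (0 , ≡.refl)
even-or-odd (suc n) with even-or-odd n
... | inj₁ (m , ≡.refl) = inj₂ (m , ≡.refl)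
... | inj₂ (m , ≡.refl) = inj₁ (suc m , ≡.cong suc (≡.sym (ℕₚ.+-suc m (m ℕ.+ 0))))

module DivisionRecursion {c ℓ} (L : CommutativeRing c ℓ) where
  open CommutativeRing L
  open FromIntegers L
  open Solver using (solve; _:=_; con; _:*_; _:^_)
  open SemiringExp semiring using (_^_; ^-congˡ; ^-homo-*; ^-assocʳ)
  open CommutativeSemiringExp commutativeSemiring using (^-distrib-*)
  open RingProperties ring
  open SetoidReasoning setoid

  record Recursion (z : ℕ → Carrier) : Set ℓ where
    field
      odd : ∀ m → 2 ≤ m → z (suc (2 ℕ.* m)) ≈ z (m ℕ.+ 2) * z m ^ 3 - z (m ℕ.∸ 1) * z (m ℕ.+ 1) ^ 3
      even : ∀ m → 2 ≤ m → z 2 * z (2 ℕ.* m) ≈ z (m ℕ.∸ 1) ^ 2 * z m * z (m ℕ.+ 2) - z (m ℕ.∸ 2) * z m * z (m ℕ.+ 1) ^ 2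

  -- From n = 5 on, the recursions reach only smaller indices, and the even one determines its term
  -- because `W 2` is regular. Values up to 4 are initial data because for n = 3 and n = 4 the index
  -- m + 2 is n itself.
  unique : ∀ {z W} → Recursion z → Recursion W → (∀ {u} → u * W 2 ≈ 0# → u ≈ 0#) →
    (∀ n → n ≤ 4 → z n ≈ W n) → ∀ n → z n ≈ W n
  unique {z} {W} Rz RW regular initial = <-rec _ step
    where
    module Rz = Recursion Rz
    module RW = Recursion RW
    step : ∀ n → (∀ {k} → k < n → z k ≈ W k) → z n ≈ W n
    step n ih with n ℕₚ.≤? 4
    ... | yes n≤4 = initial n n≤4
    ... | no n≰4 = go (even-or-odd n) (ℕₚ.≰⇒> n≰4)
      where
      bound : ∀ m → 5 ≤ suc (2 ℕ.* m) → 2 ≤ m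
      bound zero (s≤s ())
      bound (suc zero) (s≤s (s≤s (s≤s ())))
      bound (suc (suc m)) _ = s≤s (s≤s z≤n)
      3≤ : ∀ m → 5 ≤ 2 ℕ.* m → 3 ≤ m
      3≤ zero ()
      3≤ (suc zero) (s≤s (s≤s ()))
      3≤ (suc (suc zero)) (s≤s (s≤s (s≤s (s≤s ()))))
      3≤ (suc (suc (suc m))) _ = s≤s (s≤s (s≤s z≤n))
      double : ∀ m → m ℕ.+ m ≡ 2 ℕ.* m
      double m = ≡.cong (m ℕ.+_) (≡.sym (ℕₚ.+-identityʳ m))
      go : (∃ λ m → n ≡ 2 ℕ.* m) ⊎ (∃ λ m → n ≡ suc (2 ℕ.* m)) → 5 ≤ n → z n ≈ W n
      go (inj₂ (m , ≡.refl)) 5≤n = trans (Rz.odd m 2≤m) (trans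
          (+-cong (*-cong (ih m+2<n) (^-congˡ 3 (ih (ℕₚ.≤-<-trans (ℕₚ.m≤m+n m 2) m+2<n))))
            (-‿cong (*-cong (ih (ℕₚ.≤-<-trans (ℕₚ.m∸n≤m m 1) (ℕₚ.≤-<-trans (ℕₚ.m≤m+n m 2) m+2<n)))
              (^-congˡ 3 (ih (ℕₚ.<-trans (ℕₚ.+-monoʳ-< m (s≤s (s≤s z≤n))) m+2<n))))))
          (sym (RW.odd m 2≤m)))
        where
        2≤m = bound m 5≤n
        m+2<n : m ℕ.+ 2 < suc (2 ℕ.* m)
        m+2<n = s≤s (ℕₚ.≤-trans (ℕₚ.+-monoʳ-≤ m 2≤m) (ℕₚ.≤-reflexive (double m)))
      go (inj₁ (m , ≡.refl)) 5≤n = x∙y⁻¹≈ε⇒x≈y _ _ (regular (begin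
        (z (2 ℕ.* m) - W (2 ℕ.* m)) * W 2      ≈⟨ *-comm _ _ ⟩
        W 2 * (z (2 ℕ.* m) - W (2 ℕ.* m))      ≈⟨ x[y-z]≈xy-xz _ _ _ ⟩
        W 2 * z (2 ℕ.* m) - W 2 * W (2 ℕ.* m)  ≈⟨ x≈y⇒x∙y⁻¹≈ε (trans (*-congʳ (sym (initial 2 (s≤s (s≤s z≤n))))) (trans (Rz.even m 2≤m) (trans rhs (sym (RW.even m 2≤m))))) ⟩
        0# ∎))
        where
        3≤m = 3≤ m 5≤n
        2≤m = ℕₚ.≤-trans (s≤s (s≤s z≤n)) 3≤m
        m+2<n : m ℕ.+ 2 < 2 ℕ.* m
        m+2<n = ℕₚ.<-≤-trans (ℕₚ.+-monoʳ-< m 3≤m) (ℕₚ.≤-reflexive (double m))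
        m<n = ℕₚ.≤-<-trans (ℕₚ.m≤m+n m 2) m+2<n
        rhs : z (m ℕ.∸ 1) ^ 2 * z m * z (m ℕ.+ 2) - z (m ℕ.∸ 2) * z m * z (m ℕ.+ 1) ^ 2 ≈
              W (m ℕ.∸ 1) ^ 2 * W m * W (m ℕ.+ 2) - W (m ℕ.∸ 2) * W m * W (m ℕ.+ 1) ^ 2
        rhs = +-cong
          (*-cong (*-cong (^-congˡ 2 (ih (ℕₚ.≤-<-trans (ℕₚ.m∸n≤m m 1) m<n))) (ih m<n)) (ih m+2<n))
          (-‿cong (*-cong (*-cong (ih (ℕₚ.≤-<-trans (ℕₚ.m∸n≤m m 2) m<n)) (ih m<n))
            (^-congˡ 2 (ih (ℕₚ.<-trans (ℕₚ.+-monoʳ-< m (s≤s (s≤s z≤n))) m+2<n)))))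

  -- The recursions are homogeneous: they persist when the n-th term is multiplied by ω^(n²), up to powers of a₁ = 1/ω.
  module Rescaled (a : ℕ → Carrier) (ω : Carrier) (a₁ω≈1 : a 1 * ω ≈ 1#)
    (odd : ∀ m → 1 ≤ m → a (suc (2 ℕ.* m)) * a 1 ^ 3 ≈ a (m ℕ.+ 2) * a m ^ 3 - a (m ℕ.∸ 1) * a (m ℕ.+ 1) ^ 3)
    (even : ∀ m → 2 ≤ m → a 2 * a (2 ℕ.* m) * a 1 ^ 2 ≈ a (m ℕ.∸ 1) ^ 2 * a m * a (m ℕ.+ 2) - a (m ℕ.∸ 2) * a m * a (m ℕ.+ 1) ^ 2)
    where

    W : ℕ → Carrier
    W n = a n * ω ^ (n ℕ.* n)

    private
      -- Inserting (a₁ω)^k = 1 supplies the powers of a₁ present in the homogeneous recursions.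
      normalise : ∀ k x → x ≈ x * a 1 ^ k * ω ^ k
      normalise k x = begin
        x                      ≈⟨ *-identityʳ x ⟨
        x * 1#                 ≈⟨ *-congˡ (1^ k) ⟨
        x * 1# ^ k             ≈⟨ *-congˡ (^-congˡ k a₁ω≈1) ⟨
        x * (a 1 * ω) ^ k      ≈⟨ *-congˡ (^-distrib-* (a 1) ω k) ⟩
        x * (a 1 ^ k * ω ^ k)  ≈⟨ *-assoc x _ _ ⟨
        x * a 1 ^ k * ω ^ k    ∎
        where
        1^ : ∀ k → 1# ^ k ≈ 1#
        1^ zero = refl
        1^ (suc k) = trans (*-identityˡ _) (1^ k)

      merge : ∀ i j k {n} → i ℕ.+ j ℕ.* k ≡ n → ω ^ i * (ω ^ j) ^ k ≈ ω ^ n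
      merge i j k ≡.refl = trans (*-congˡ (^-assocʳ ω j k)) (sym (^-homo-* ω i (j ℕ.* k)))

      odd-term : ∀ i j {n} → i ℕ.* i ℕ.+ j ℕ.* j ℕ.* 3 ≡ n → W i * W j ^ 3 ≈ (a i * a j ^ 3) * ω ^ n
      odd-term i j {n} e = begin
        (a i * ω ^ (i ℕ.* i)) * (a j * ω ^ (j ℕ.* j)) ^ 3
          ≈⟨ solve 4 (λ a b x y → (a :* x) :* (b :* y) :^ 3 := (a :* b :^ 3) :* (x :* y :^ 3)) refl (a i) (a j) (ω ^ (i ℕ.* i)) (ω ^ (j ℕ.* j)) ⟩
        (a i * a j ^ 3) * (ω ^ (i ℕ.* i) * (ω ^ (j ℕ.* j)) ^ 3)  ≈⟨ *-congˡ (merge (i ℕ.* i) (j ℕ.* j) 3 e) ⟩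
        (a i * a j ^ 3) * ω ^ n ∎

      even-term : ∀ i j k {n} → (i ℕ.* i ℕ.+ j ℕ.* j) ℕ.+ k ℕ.* k ℕ.* 2 ≡ n → W i * W j * W k ^ 2 ≈ (a i * a j * a k ^ 2) * ω ^ n
      even-term i j k {n} e = begin
        (a i * ω ^ (i ℕ.* i)) * (a j * ω ^ (j ℕ.* j)) * (a k * ω ^ (k ℕ.* k)) ^ 2
          ≈⟨ solve 6 (λ a b c x y z → (a :* x) :* (b :* y) :* (c :* z) :^ 2 := (a :* b :* c :^ 2) :* ((x :* y) :* z :^ 2)) refl (a i) (a j) (a k) (ω ^ (i ℕ.* i)) (ω ^ (j ℕ.* j)) (ω ^ (k ℕ.* k)) ⟩
        (a i * a j * a k ^ 2) * ((ω ^ (i ℕ.* i) * ω ^ (j ℕ.* j)) * (ω ^ (k ℕ.* k)) ^ 2)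
          ≈⟨ *-congˡ (trans (*-congʳ (sym (^-homo-* ω (i ℕ.* i) (j ℕ.* j)))) (merge (i ℕ.* i ℕ.+ j ℕ.* j) (k ℕ.* k) 2 e)) ⟩
        (a i * a j * a k ^ 2) * ω ^ n ∎

      difference : ∀ x y n → x * ω ^ n - y * ω ^ n ≈ (x - y) * ω ^ n
      difference x y n = sym ([y-z]x≈yx-zx (ω ^ n) x y)

    W-recursion : Recursion W
    W-recursion = record { odd = W-odd ; even = W-even }
      where
      open ℕS renaming (solve to solveℕ; _:=_ to _≔_; con to conℕ; _:+_ to _⊹_; _:*_ to _⊛_) using ()
      -- All terms carry the same power of ω: (m+2)² + 3m² = (m-1)² + 3(m+1)² = (2m+1)² + 3.
      W-odd : ∀ m → 2 ≤ m → W (suc (2 ℕ.* m)) ≈ W (m ℕ.+ 2) * W m ^ 3 - W (m ℕ.∸ 1) * W (m ℕ.+ 1) ^ 3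
      W-odd m@(suc n) 2≤m = begin
        a k * ω ^ (k ℕ.* k)                       ≈⟨ normalise 3 _ ⟩
        a k * ω ^ (k ℕ.* k) * a 1 ^ 3 * ω ^ 3     ≈⟨ solve 4 (λ a x b y → a :* x :* b :* y := (a :* b) :* (x :* y)) refl (a k) _ _ _ ⟩
        (a k * a 1 ^ 3) * (ω ^ (k ℕ.* k) * ω ^ 3) ≈⟨ *-cong (odd m (s≤s z≤n)) (sym (^-homo-* ω (k ℕ.* k) 3)) ⟩
        (a (m ℕ.+ 2) * a m ^ 3 - a n * a (m ℕ.+ 1) ^ 3) * ω ^ (k ℕ.* k ℕ.+ 3)
          ≈⟨ difference _ _ (k ℕ.* k ℕ.+ 3) ⟨
        (a (m ℕ.+ 2) * a m ^ 3) * ω ^ (k ℕ.* k ℕ.+ 3) - (a n * a (m ℕ.+ 1) ^ 3) * ω ^ (k ℕ.* k ℕ.+ 3)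
          ≈⟨ +-cong (odd-term (m ℕ.+ 2) m
                (solveℕ 1 (λ n → let m = conℕ 1 ⊹ n in (m ⊹ conℕ 2) ⊛ (m ⊹ conℕ 2) ⊹ m ⊛ m ⊛ conℕ 3 ≔ (conℕ 1 ⊹ conℕ 2 ⊛ m) ⊛ (conℕ 1 ⊹ conℕ 2 ⊛ m) ⊹ conℕ 3) ≡.refl n))
              (-‿cong (odd-term n (m ℕ.+ 1)
                (solveℕ 1 (λ n → let m = conℕ 1 ⊹ n in n ⊛ n ⊹ (m ⊹ conℕ 1) ⊛ (m ⊹ conℕ 1) ⊛ conℕ 3 ≔ (conℕ 1 ⊹ conℕ 2 ⊛ m) ⊛ (conℕ 1 ⊹ conℕ 2 ⊛ m) ⊹ conℕ 3) ≡.refl n))) ⟨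
        W (m ℕ.+ 2) * W m ^ 3 - W n * W (m ℕ.+ 1) ^ 3 ∎
        where k = suc (2 ℕ.* m)
      -- The weights are m² + (m+2)² + 2(m-1)² = (m-2)² + m² + 2(m+1)² = 4 + (2m)² + 2.
      W-even : ∀ m → 2 ≤ m → W 2 * W (2 ℕ.* m) ≈ W (m ℕ.∸ 1) ^ 2 * W m * W (m ℕ.+ 2) - W (m ℕ.∸ 2) * W m * W (m ℕ.+ 1) ^ 2
      W-even (suc zero) (s≤s ())
      W-even m@(suc (suc n)) 2≤m = begin
        (a 2 * ω ^ 4) * (a k * ω ^ (k ℕ.* k))                       ≈⟨ normalise 2 _ ⟩
        (a 2 * ω ^ 4) * (a k * ω ^ (k ℕ.* k)) * a 1 ^ 2 * ω ^ 2
          ≈⟨ solve 6 (λ a x b y c z → (a :* x) :* (b :* y) :* c :* z := (a :* b :* c) :* ((x :* y) :* z)) refl (a 2) (ω ^ 4) (a k) _ _ _ ⟩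
        (a 2 * a k * a 1 ^ 2) * ((ω ^ 4 * ω ^ (k ℕ.* k)) * ω ^ 2)
          ≈⟨ *-cong (even m 2≤m) (trans (*-congʳ (sym (^-homo-* ω 4 (k ℕ.* k)))) (sym (^-homo-* ω (4 ℕ.+ k ℕ.* k) 2))) ⟩
        (a (suc n) ^ 2 * a m * a (m ℕ.+ 2) - a n * a m * a (m ℕ.+ 1) ^ 2) * ω ^ (4 ℕ.+ k ℕ.* k ℕ.+ 2)
          ≈⟨ difference _ _ (4 ℕ.+ k ℕ.* k ℕ.+ 2) ⟨
        (a (suc n) ^ 2 * a m * a (m ℕ.+ 2)) * ω ^ (4 ℕ.+ k ℕ.* k ℕ.+ 2) - (a n * a m * a (m ℕ.+ 1) ^ 2) * ω ^ (4 ℕ.+ k ℕ.* k ℕ.+ 2)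
          ≈⟨ +-cong
              (trans (*-congʳ (solve 3 (λ x y z → x :^ 2 :* y :* z := y :* z :* x :^ 2) refl (a (suc n)) (a m) (a (m ℕ.+ 2))))
                (sym (even-term m (m ℕ.+ 2) (suc n)
                  (solveℕ 1 (λ n → let m = conℕ 2 ⊹ n in (m ⊛ m ⊹ (m ⊹ conℕ 2) ⊛ (m ⊹ conℕ 2)) ⊹ (conℕ 1 ⊹ n) ⊛ (conℕ 1 ⊹ n) ⊛ conℕ 2 ≔ conℕ 4 ⊹ (conℕ 2 ⊛ m) ⊛ (conℕ 2 ⊛ m) ⊹ conℕ 2) ≡.refl n))))
              (-‿cong (sym (even-term n m (m ℕ.+ 1)
                  (solveℕ 1 (λ n → let m = conℕ 2 ⊹ n in (n ⊛ n ⊹ m ⊛ m) ⊹ (m ⊹ conℕ 1) ⊛ (m ⊹ conℕ 1) ⊛ conℕ 2 ≔ conℕ 4 ⊹ (conℕ 2 ⊛ m) ⊛ (conℕ 2 ⊛ m) ⊹ conℕ 2) ≡.refl n)))) ⟩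
        W m * W (m ℕ.+ 2) * W (suc n) ^ 2 - W n * W m * W (m ℕ.+ 1) ^ 2
          ≈⟨ +-congʳ (solve 3 (λ x y z → y :* z :* x :^ 2 := x :^ 2 :* y :* z) refl (W (suc n)) (W m) (W (m ℕ.+ 2))) ⟩
        W (suc n) ^ 2 * W m * W (m ℕ.+ 2) - W n * W m * W (m ℕ.+ 1) ^ 2 ∎
        where k = 2 ℕ.* m

-- From t, w and χ back to coordinates on the curve

module _ {c ℓ} (L : CommutativeRing c ℓ) where
  open CommutativeRing L

  module Uniformisation (A B t w r χ χ⁻¹ s : Carrier) (ts≈1 : t * s ≈ 1#) (χχ⁻¹≈1 : χ * χ⁻¹ ≈ 1#) where
    open SmallDivisionPolynomials L
    open Evaluation L
    open FromIntegers L
    open Solver using (solve; _:=_; con; _:+_; _:*_; _:-_; :-_; _:^_)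
    open SemiringExp semiring using (_^_)
    open SetoidReasoning setoid

    ρ : Vec Carrier 7
    ρ = A ∷ B ∷ t ∷ w ∷ r ∷ χ ∷ χ⁻¹ ∷ []

    x y ω : Carrier
    x = s * s
    y = w * (s * (s * s))
    ω = χ⁻¹ * s

    private
      unit-power : ∀ {u} → u ≈ 1# → ∀ k → u ^ k ≈ # 1
      unit-power e zero = sym #1≈1
      unit-power e (suc k) = trans (*-cong e (unit-power e k)) (*-identityˡ _)

    curve-equation : eval ρ relation ≈ 0# → y * y ≈ x * (x * x) + (A * x + B)
    curve-equation rel = begin
      y * y
        ≈⟨ solve 5 (λ A B t w s →
             (w :* (s :* (s :* s))) :* (w :* (s :* (s :* s))) :=
             s :^ 6 :* (w :* w :+ con -[1+ 0 ] :* (con (+ 1) :+ A :* (t :* (t :* (t :* t))) :+ B :* (t :* (t :* (t :* (t :* (t :* t)))))))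
             :+ (s :^ 6 :+ A :* ((t :* s) :^ 4 :* s :^ 2) :+ B :* (t :* s) :^ 6)) refl A B t w s ⟩
      s ^ 6 * eval ρ relation + (s ^ 6 + A * ((t * s) ^ 4 * s ^ 2) + B * (t * s) ^ 6)
        ≈⟨ +-cong (*-congˡ rel) (+-cong (+-congˡ (*-congˡ (*-congʳ (unit-power ts≈1 4)))) (*-congˡ (unit-power ts≈1 6))) ⟩
      s ^ 6 * # 0 + (s ^ 6 + A * (# 1 * s ^ 2) + B * # 1)
        ≈⟨ solve 3 (λ A B s → s :^ 6 :* con (+ 0) :+ (s :^ 6 :+ A :* (con (+ 1) :* s :^ 2) :+ B :* con (+ 1)) :=
             (s :* s) :* ((s :* s) :* (s :* s)) :+ (A :* (s :* s) :+ B)) refl A B s ⟩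
      x * (x * x) + (A * x + B) ∎

    σω≈1 : t * χ * ω ≈ 1#
    σω≈1 = trans (solve 4 (λ t χ k s → t :* χ :* (k :* s) := (t :* s) :* (χ :* k)) refl t χ χ⁻¹ s)
      (trans (*-cong ts≈1 χχ⁻¹≈1) (*-identityˡ 1#))

    -- ω = 1/σ undoes the factor σ(z)^(n²). Grouping into powers of t s = 1 and χ χ⁻¹ = 1 leaves the
    -- polynomial in x and y; the same grouping serves n = 3 and n = 4.
    σ₂ω⁴ : eval ρ σ₂ᵉ * ω ^ 4 ≈ # 2 * y
    σ₂ω⁴ = begin
      eval ρ σ₂ᵉ * ω ^ 4
        ≈⟨ solve 5 (λ t w s χ k → con (+ 2) :* (t :* w) :* (χ :* (χ :* (χ :* χ))) :* (k :* s) :^ 4 :=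
             con (+ 2) :* (w :* (s :* (s :* s))) :* ((t :* s) :^ 1 :* (χ :* k) :^ 4)) refl t w s χ χ⁻¹ ⟩
      # 2 * y * ((t * s) ^ 1 * (χ * χ⁻¹) ^ 4)   ≈⟨ *-congˡ (*-cong (unit-power ts≈1 1) (unit-power χχ⁻¹≈1 4)) ⟩
      # 2 * y * (# 1 * # 1)                     ≈⟨ solve 1 (λ y → con (+ 2) :* y :* (con (+ 1) :* con (+ 1)) := con (+ 2) :* y) refl y ⟩
      # 2 * y ∎

    private
      -- `pow p k` is the power k + 1, nested to the right in the way `_⟨^⟩_` evaluates, so that the
      -- solver expressions match `eval` definitionally.
      pow : ∀ {n} → Solver.Polynomial n → ℕ → Solver.Polynomial n
      pow p zero = p
      pow p (suc k) = p :* pow p k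

    σ₃ω⁹ : eval ρ σ₃ᵉ * ω ^ 9 ≈ ψ₃ A B x
    σ₃ω⁹ = begin
      eval ρ σ₃ᵉ * ω ^ 9
        ≈⟨ solve 6 (λ A B t s χ k → t :* (con (+ 3) :+ con (+ 6) :* (A :* pow t 3) :+ con (+ 12) :* (B :* pow t 5) :+ con -[1+ 0 ] :* (pow A 1 :* pow t 7)) :* pow χ 8 :* (k :* s) :^ 9 :=
             (con (+ 3) :* ((t :* s) :* (s :* s) :^ 4) :+ con (+ 6) :* A :* ((t :* s) :^ 5 :* (s :* s) :^ 2) :+ con (+ 12) :* B :* ((t :* s) :^ 7 :* (s :* s)) :- A :^ 2 :* (t :* s) :^ 9)
             :* (χ :* k) :^ 9) refl A B t s χ χ⁻¹ ⟩
      (# 3 * ((t * s) * x ^ 4) + # 6 * A * ((t * s) ^ 5 * x ^ 2) + # 12 * B * ((t * s) ^ 7 * x) - A ^ 2 * (t * s) ^ 9) * (χ * χ⁻¹) ^ 9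
        ≈⟨ *-cong (+-cong (+-cong (+-cong (*-congˡ (*-congʳ (trans ts≈1 (sym #1≈1)))) (*-congˡ (*-congʳ (unit-power ts≈1 5)))) (*-congˡ (*-congʳ (unit-power ts≈1 7))))
             (-‿cong (*-congˡ (unit-power ts≈1 9)))) (unit-power χχ⁻¹≈1 9) ⟩
      (# 3 * (# 1 * x ^ 4) + # 6 * A * (# 1 * x ^ 2) + # 12 * B * (# 1 * x) - A ^ 2 * # 1) * # 1
        ≈⟨ solve 3 (λ A B x → (con (+ 3) :* (con (+ 1) :* x :^ 4) :+ con (+ 6) :* A :* (con (+ 1) :* x :^ 2) :+ con (+ 12) :* B :* (con (+ 1) :* x) :- A :^ 2 :* con (+ 1)) :* con (+ 1) :=
             con (+ 3) :* x :^ 4 :+ con (+ 6) :* A :* x :^ 2 :+ con (+ 12) :* B :* x :- A :^ 2) refl A B x ⟩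
      ψ₃ A B x ∎

    σ₄ω¹⁶ : eval ρ σ₄ᵉ * ω ^ 16 ≈ ψ₄ A B x y
    σ₄ω¹⁶ = begin
      eval ρ σ₄ᵉ * ω ^ 16
        ≈⟨ solve 7 (λ A B t w s χ k → con (+ 4) :* (t :* w) :*
             (con (+ 1) :+ con (+ 5) :* (A :* pow t 3) :+ con (+ 20) :* (B :* pow t 5)
               :+ con -[1+ 0 ] :* (con (+ 5) :* (pow A 1 :* pow t 7)) :+ con -[1+ 0 ] :* (con (+ 4) :* (A :* B :* pow t 9))
               :+ con -[1+ 0 ] :* ((pow A 2 :+ con (+ 8) :* pow B 1) :* pow t 11)) :* pow χ 15 :* (k :* s) :^ 16 :=
             (con (+ 2) :* (w :* (s :* (s :* s))) :*
               ( con (+ 2) :* ((t :* s) :* (s :* s) :^ 6) :+ con (+ 10) :* A :* ((t :* s) :^ 5 :* (s :* s) :^ 4) :+ con (+ 40) :* B :* ((t :* s) :^ 7 :* (s :* s) :^ 3)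
                 :- con (+ 10) :* A :^ 2 :* ((t :* s) :^ 9 :* (s :* s) :^ 2) :- con (+ 8) :* A :* B :* ((t :* s) :^ 11 :* (s :* s))
                 :- con (+ 2) :* (A :^ 3 :+ con (+ 8) :* B :^ 2) :* (t :* s) :^ 13)) :* (χ :* k) :^ 16) refl A B t w s χ χ⁻¹ ⟩
      (# 2 * y * ( # 2 * ((t * s) * x ^ 6) + # 10 * A * ((t * s) ^ 5 * x ^ 4) + # 40 * B * ((t * s) ^ 7 * x ^ 3)
        - # 10 * A ^ 2 * ((t * s) ^ 9 * x ^ 2) - # 8 * A * B * ((t * s) ^ 11 * x)
        - # 2 * (A ^ 3 + # 8 * B ^ 2) * (t * s) ^ 13)) * (χ * χ⁻¹) ^ 16
        ≈⟨ *-cong (*-congˡ (+-cong (+-cong (+-cong (+-cong (+-cong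
             (*-congˡ (*-congʳ (trans ts≈1 (sym #1≈1)))) (*-congˡ (*-congʳ (unit-power ts≈1 5)))) (*-congˡ (*-congʳ (unit-power ts≈1 7))))
             (-‿cong (*-congˡ (*-congʳ (unit-power ts≈1 9))))) (-‿cong (*-congˡ (*-congʳ (unit-power ts≈1 11))))) (-‿cong (*-congˡ (unit-power ts≈1 13)))))
             (unit-power χχ⁻¹≈1 16) ⟩
      (# 2 * y * ( # 2 * (# 1 * x ^ 6) + # 10 * A * (# 1 * x ^ 4) + # 40 * B * (# 1 * x ^ 3)
        - # 10 * A ^ 2 * (# 1 * x ^ 2) - # 8 * A * B * (# 1 * x)
        - # 2 * (A ^ 3 + # 8 * B ^ 2) * # 1)) * # 1
        ≈⟨ solve 4 (λ A B x y → (con (+ 2) :* y :* ( con (+ 2) :* (con (+ 1) :* x :^ 6) :+ con (+ 10) :* A :* (con (+ 1) :* x :^ 4) :+ con (+ 40) :* B :* (con (+ 1) :* x :^ 3)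
             :- con (+ 10) :* A :^ 2 :* (con (+ 1) :* x :^ 2) :- con (+ 8) :* A :* B :* (con (+ 1) :* x)
             :- con (+ 2) :* (A :^ 3 :+ con (+ 8) :* B :^ 2) :* con (+ 1))) :* con (+ 1) :=
             con (+ 2) :* y :* ( con (+ 2) :* x :^ 6 :+ con (+ 10) :* A :* x :^ 4 :+ con (+ 40) :* B :* x :^ 3
             :- con (+ 10) :* A :^ 2 :* x :^ 2 :- con (+ 8) :* A :* B :* x
             :- con (+ 2) :* (A :^ 3 :+ con (+ 8) :* B :^ 2))) refl A B x y ⟩
      ψ₄ A B x y ∎

-- Extraction of coefficients

module Extraction {c ℓ} (R : CommutativeRing c ℓ) (torsionFree : Divisibility.TorsionFree R) (A B : CommutativeRing.Carrier R) where
  private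
    module R = CommutativeRing R
    module FR = FromIntegers R
  open Hurwitz R
  open HurwitzCoefficients R
  open Sigma R torsionFree A B
  open CommutativeRing H
  open Derivation shift using (∂-^)
  open FromIntegers H using (#_; #-*; #1≈1; module Solver)
  open Divisibility R
  open SemiringExp semiring using (_^_)
  open RingProperties (CommutativeRing.ring H) using (x∙y⁻¹≈ε⇒x≈y; x≈y⇒x∙y⁻¹≈ε; [y-z]x≈yx-zx)

  T : Sequence
  T = t * t

  -- G M α = Σ_{i ≤ M} αᵢ t^(2(M - i)), that is, t^(2M) Σ αᵢ xⁱ for x = 1/t².
  G : ℕ → (ℕ → R.Carrier) → Sequence
  G zero α = unit (α 0)
  G (suc M) α = unit (α (suc M)) + T * G M α

  -- The definition of `G` splits off the top coefficient, as the extraction needs; this splits off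
  -- the bottom one, as recursion on coefficient lists needs.
  G-suc : ∀ M α → G (suc M) α ≋ unit (α 0) * T ^ suc M + G M (λ i → α (suc i))
  G-suc zero α = trans (+-comm _ _) (+-congʳ (trans (*-comm T _) (*-congˡ (sym (*-identityʳ T)))))
  G-suc (suc M) α = trans (+-congˡ (*-congˡ (G-suc M α)))
    (solve 5 (λ u T a P g → u :+ T :* (a :* P :+ g) := a :* (T :* P) :+ (u :+ T :* g)) refl
      (unit (α (suc (suc M)))) T (unit (α 0)) (T ^ suc M) (G M (λ i → α (suc i))))
    where open Solver using (solve; _:=_; _:+_; _:*_)

  G-0 : ∀ M α → (∀ i → α i R.≈ R.0#) → G M α ≋ 0#
  G-0 zero α e = unit-0 (e 0)
  G-0 (suc M) α e = trans (+-cong (unit-0 (e (suc M))) (trans (*-congˡ (G-0 M α e)) (zeroʳ T))) (+-identityˡ 0#)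

  t₀≈0 : t 0 R.≈ R.0#
  t₀≈0 = R.refl

  t₁≈1 : t 1 R.≈ R.1#
  t₁≈1 = FR.#1≈1

  G₀ : ∀ M α → G M α 0 R.≈ α M
  G₀ zero α = R.refl
  G₀ (suc M) α = R.trans (R.+-congˡ (R.trans (R.*-congʳ (R.zeroˡ _)) (R.zeroˡ _))) (R.+-identityʳ _)

  *-t^-at : ∀ n f → (f * t ^ n) n R.≈ FR.# (n !) R.* f 0
  *-t^-at n f = R.trans (at (*-comm f (t ^ n)) n) (R.trans (⊠-at n f (below-^ t₀≈0 n)) (R.*-congʳ (^-at t₀≈0 t₁≈1 n)))

  private
    cancel-T : ∀ {f g} → T * f ≋ T * g → f ≋ g
    cancel-T {f} {g} e = x∙y⁻¹≈ε⇒x≈y f g (regular-t (regular-t (trans (trans (*-assoc _ t t) ([y-z]x≈yx-zx T f g))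
      (x≈y⇒x∙y⁻¹≈ε (trans (*-comm f T) (trans e (*-comm T g)))))))

  -- The length of a list only bounds the degree. The factor T^e forces the top e coefficients to
  -- vanish one at a time: the coefficient of z on the left is the leading one, while the right side
  -- starts at order 2 or higher.
  descend : ∀ e N α X → G (e ℕ.+ N) α * t ≋ X * T ^ e → G N α * t ≋ X
  descend zero N α X h = trans h (*-identityʳ X)
  descend (suc e) N α X h = descend e N α X (cancel-T (begin
    T * (G (e ℕ.+ N) α * t)        ≈⟨ *-assoc T _ t ⟨
    T * G (e ℕ.+ N) α * t          ≈⟨ *-congʳ (trans (+-congʳ (unit-0 leading≈0)) (+-identityˡ _)) ⟨
    G (suc e ℕ.+ N) α * t          ≈⟨ h ⟩
    X * (T * T ^ e)                ≈⟨ solve 3 (λ X T P → X :* (T :* P) := T :* (X :* P)) refl X T (T ^ e) ⟩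
    T * (X * T ^ e)                ∎))
    where
    open SetoidReasoning setoid
    open Solver using (solve; _:=_; _:*_)
    leading≈0 : α (suc e ℕ.+ N) R.≈ R.0#
    leading≈0 = R.trans (R.sym (G₀ (suc e ℕ.+ N) α)) (R.trans (R.sym (R.*-identityˡ _)) (R.trans (R.*-congʳ (R.sym FR.#1≈1))
      (R.trans (R.sym (*-t^-at 1 (G (suc e ℕ.+ N) α)))
      (R.trans (at (*-congˡ {G (suc e ℕ.+ N) α} (*-identityʳ t)) 1)
      (R.trans (at h 1)
      (R.trans (at (trans (sym (*-assoc X T (T ^ e))) (trans (*-congʳ (*-comm X T)) (trans (*-assoc T X (T ^ e)) (*-congʳ (*-congˡ (sym (*-identityʳ t)))))) ) 1)
        (below-⊠ {f = t ^ 2} (X * T ^ e) (below-^ t₀≈0 2) 1 (s≤s (s≤s z≤n)))))))))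

  private
    unit-# : ∀ n {a b} → a R.≈ FR.# n R.* b → unit a ≋ # n * unit b
    unit-# n e = trans (Hom.⟦⟧-cong constant e) (trans (Hom.*-homo constant _ _) (*-congʳ (Hom.#-homo constant n)))

    peel : ∀ M α f → T * (G M α * f) ≋ G (suc M) α * f - unit (α (suc M)) * f
    peel M α f = solve 4 (λ T g u f → T :* (g :* f) := (u :+ T :* g) :* f :- u :* f) refl T (G M α) (unit (α (suc M))) f
      where open Solver using (solve; _:=_; _:+_; _:*_; _:-_)

    rotate : ∀ g m → g * t ^ suc (suc m) ≋ T * (g * t ^ m)
    rotate g m = solve 3 (λ g t P → g :* (t :* (t :* P)) := (t :* t) :* (g :* P)) refl g t (t ^ m)
      where open Solver using (solve; _:=_; _:*_)

    shift-index : ∀ e m {n} → suc e ℕ.+ (suc e ℕ.+ m) ≡ n → e ℕ.+ (e ℕ.+ suc (suc m)) ≡ n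
    shift-index e m ≡.refl = ≡.trans (≡.cong (λ k → e ℕ.+ k) (≡.trans (ℕₚ.+-suc e (suc m)) (≡.cong suc (ℕₚ.+-suc e m)))) (ℕₚ.+-suc e (suc (e ℕ.+ m)))

    index< : ∀ e m {n} → suc e ℕ.+ (suc e ℕ.+ m) ≡ n → m < n
    index< e m ≡.refl = s≤s (ℕₚ.≤-trans (ℕₚ.m≤n+m m (suc e)) (ℕₚ.m≤n+m (suc e ℕ.+ m) e))

    w₀≈1 : w 0 R.≈ R.1#
    w₀≈1 = FR.#1≈1

  module _ {g : ℕ} (p-prime : Prime (suc (2 ℕ.* suc g))) where
    private
      h p : ℕ
      h = suc g
      p = suc (2 ℕ.* h)

    -- Both outer terms of the binomial formula contain a vanishing constant term.
    t^-at-prime : ∀ n → p ∣# (t ^ suc (suc n)) p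
    t^-at-prime n = ⊠-at-prime p-prime t (t ^ suc n) (∣#-resp (R.sym (R.trans
      (R.+-cong (R.zeroˡ _) (R.trans (R.*-congˡ (below-^ t₀≈0 (suc n) 0 (s≤s z≤n))) (R.zeroʳ _))) (R.+-identityˡ _))) ∣#-0)

    private
      -- σ(pz)/p is integral: its constant term is 0 and the derivative of σ(pz) is p σ′(pz).
      multiple-p-quotient : Sequence
      multiple-p-quotient zero = R.0#
      multiple-p-quotient (suc n) = (tail σ ⟪ + p ⟫) n

      multiple-p : multiple p ≋ # p * multiple-p-quotient
      multiple-p = ≋-by-∂
        (R.trans (scale-at-0 (+ p) σ) (R.trans (R.zeroˡ _) (R.sym (R.zeroʳ _))))
        (trans (scale-tail (+ p) σ) (sym (Derivation.∂-constˡ shift (Derivation.∂-# shift p) multiple-p-quotient)))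

      -- A second differentiation of σ(pz) brings down another p. Together with the p already
      -- divided out this is the divisibility by p².
      multiple-p-quotient-at : p ∣# multiple-p-quotient p
      multiple-p-quotient-at = (tail (tail σ) ⟪ + p ⟫) n by
        R.trans (at (scale-tail (+ p) (tail σ)) n) (#-at p (tail (tail σ) ⟪ + p ⟫) n)
        where n = g ℕ.+ suc (g ℕ.+ 0)

      quotient-*-at : ∀ K → p ∣# (multiple-p-quotient * K) p
      quotient-*-at K = ⊠-at-prime p-prime multiple-p-quotient K
        (∣#-+ (∣#-resp (R.sym (R.zeroˡ _)) ∣#-0) (∣#-*ʳ (K 0) multiple-p-quotient-at))

      σ′₀≈1 : tail σ 0 R.≈ R.1#
      σ′₀≈1 = R.trans (R.+-cong (R.trans (R.*-cong FR.#1≈1 FR.#1≈1) (R.*-identityˡ _)) (R.zeroˡ _)) (R.+-identityʳ _)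

      multiple-p-at-1 : ∀ K → K 0 R.≈ R.1# → (multiple p * K) 1 R.≈ FR.# p
      multiple-p-at-1 K K₀≈1 = R.trans (R.+-cong
          (R.trans (R.*-cong (R.trans (at (scale-tail (+ p) σ) 0) (R.trans (#-at p (tail σ ⟪ + p ⟫) 0)
            (R.trans (R.*-congˡ (R.trans (scale-at-0 (+ p) (tail σ)) σ′₀≈1)) (R.*-identityʳ _)))) K₀≈1) (R.*-identityʳ _))
          (R.trans (R.*-congʳ (R.trans (scale-at-0 (+ p) σ) (R.zeroˡ _))) (R.zeroˡ _)))
        (R.+-identityʳ _)

    -- All coefficients of G * t ^ m are divisible by p; peeling off the top one at a time
    -- down to m = p exposes α b, since the p-th coefficient of t ^ m is divisible by p for 1 < m < p.
    private
      module _ (b : ℕ) (α : ℕ → R.Carrier) (v : R.Carrier) where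
        peel-to-p : ∀ e m Y → 1 < m → e ℕ.+ (e ℕ.+ m) ≡ p → G (e ℕ.+ b) α * t ^ m ≋ # p * Y → p ∣# (Y p R.+ v) →
          p ∣# (FR.# ((2 ℕ.* h) !) R.* α b R.+ v)
        -- Here m = p, and the p-th coefficient is p! α_b = p Y_p; cancelling p leaves (p - 1)! α_b
        -- = Y_p.
        peel-to-p zero m Y _ ≡.refl eq d = ∣#-resp (R.+-congʳ (R.sym (RP.x∙y⁻¹≈ε⇒x≈y _ _
            (torsionFree (2 ℕ.* h) (R.trans (RP.x[y-z]≈xy-xz _ _ _) (RP.x≈y⇒x∙y⁻¹≈ε p!α≈))))))
            d
          where
          module RP = RingProperties R.ring
          p!α≈ : FR.# p R.* (FR.# ((2 ℕ.* h) !) R.* α b) R.≈ FR.# p R.* Y p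
          p!α≈ = R.trans (R.sym (R.*-assoc _ _ _)) (R.trans (R.*-congʳ (R.sym (FR.#-* p ((2 ℕ.* h) !))))
            (R.trans (R.*-congˡ (R.sym (G₀ b α))) (R.trans (R.sym (*-t^-at p (G b α))) (R.trans (at eq p) (#-at p Y p)))))
        peel-to-p (suc e) (suc zero) Y (s≤s ()) _ _ _
        peel-to-p (suc e) m@(suc (suc m′)) Y _ i eq d = continue (prime-∣#-cancel-! p-prime m (index< e m i) p∣m!α)
          where
          M = e ℕ.+ b
          -- The coefficient of order m is m! times the top coefficient and a multiple of p, and m!
          -- is prime to p since m < p.
          p∣m!α : p ∣# (FR.# (m !) R.* α (suc M))
          p∣m!α = ∣#-resp (R.trans (R.sym (#-at p Y m)) (R.trans (R.sym (at eq m)) (R.trans (*-t^-at m (G (suc M) α)) (R.*-congˡ (G₀ (suc M) α)))))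
            (∣#-*ʳ (Y m) (∣#-self p))
          -- With the top coefficient equal to pβ, its term is p β t^m. Dividing by p changes Y by β
          -- t^m, whose p-th coefficient is again divisible by p.
          continue : p ∣# α (suc M) → p ∣# (FR.# ((2 ℕ.* h) !) R.* α b R.+ v)
          continue (β by α≈pβ) = peel-to-p e (suc (suc m)) (Y - unit β * t ^ m) (s≤s (s≤s z≤n)) (shift-index e m i)
            (trans (rotate (G M α) m) (trans (peel M α (t ^ m)) (trans (+-cong eq (-‿cong (trans (*-congʳ (unit-# p α≈pβ)) (*-assoc _ _ _))))
              (sym (x[y-z]≈xy-xz _ _ _)))))
            (∣#-resp (solve 3 (λ y u v → (y :+ v) :- u := (y :- u) :+ v) R.refl (Y p) ((unit β * t ^ m) p) v)
              (∣#-minus d (∣#-resp (R.sym (scalar-⊠ β (t ^ m) p)) (∣#-*ˡ β (t^-at-prime m′)))))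
            where
            open RingProperties (CommutativeRing.ring H) using (x[y-z]≈xy-xz)
            open FR.Solver using (solve; _:=_; _:+_; _:-_)

        -- (m + 1) t^m w is the derivative of t^(m+1), so for m + 1 < p the coefficient of t^m w of
        -- order p - 1 is divisible by p. The coefficients peeled off may therefore be arbitrary,
        -- and the descent runs modulo p only.
        peel-to-2h : ∀ e m Z → 0 < m → e ℕ.+ (e ℕ.+ m) ≡ 2 ℕ.* h → G (e ℕ.+ b) α * (t ^ m * w) ≋ Z → p ∣# (Z (2 ℕ.* h) R.+ v) →
          p ∣# (FR.# ((2 ℕ.* h) !) R.* α b R.+ v)
        peel-to-2h zero m Z _ ≡.refl eq d = ∣#-resp (R.+-congʳ (R.trans (R.sym (at eq m)) (R.trans
            (at (trans (*-congˡ (*-comm (t ^ m) w)) (sym (*-assoc (G b α) w (t ^ m)))) m)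
            (R.trans (*-t^-at m (G b α * w)) (R.*-congˡ (R.trans (R.*-cong (G₀ b α) w₀≈1) (R.*-identityʳ _))))))) d
        peel-to-2h (suc e) m@(suc m′) Z _ i eq d = peel-to-2h e (suc (suc m)) (Z - unit (α (suc M)) * (t ^ m * w)) (s≤s z≤n) (shift-index e m i)
            (trans (solve 4 (λ g t P w → g :* ((t :* (t :* P)) :* w) := (t :* t) :* (g :* (P :* w))) refl (G M α) t (t ^ m) w)
              (trans (peel M α (t ^ m * w)) (+-congʳ eq)))
            (∣#-resp (FR.Solver.solve 3 (λ y u v → (y FR.Solver.:+ v) FR.Solver.:- u FR.Solver.:= (y FR.Solver.:- u) FR.Solver.:+ v) R.refl (Z (2 ℕ.* h)) _ v)
              (∣#-minus d (∣#-resp (R.sym (scalar-⊠ (α (suc M)) (t ^ m * w) (2 ℕ.* h))) (∣#-*ˡ (α (suc M)) p∣tᵐw))))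
          where
          open Solver using (solve; _:=_; _:*_)
          M = e ℕ.+ b
          p∣tᵐw : p ∣# (t ^ m * w) (2 ℕ.* h)
          p∣tᵐw = prime-∣#-cancel p-prime (s≤s (index< e m i))
            (∣#-resp (R.trans (at (∂-^ t m) (2 ℕ.* h)) (#-at (suc m) (t ^ m * w) (2 ℕ.* h))) (t^-at-prime m′))

    -- The coefficient of z shows that the leading coefficient is p. Its term p t is removed at once
    -- and, after division by p, leaves -t, whose p-th coefficient is -w_{p-1} because dt/dz = w.
    -- The descent then starts at t³.
    ψ-coefficient : ∀ b α K → K 0 R.≈ R.1# → G (h ℕ.+ b) α * t ≋ multiple p * K →
      p ∣# (FR.# ((2 ℕ.* h) !) R.* α b R.+ w (2 ℕ.* h))
    ψ-coefficient b α K K₀≈1 eq = peel-to-p b α (w (2 ℕ.* h)) g 3 (multiple-p-quotient * K - t) (s≤s (s≤s z≤n)) index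
      (trans refl (trans (rotate (G M α) 1) (trans (peel M α (t ^ 1))
        (trans (+-cong (trans (*-congˡ (*-identityʳ t)) (trans eq (trans (*-congʳ multiple-p) (*-assoc _ _ K)))) (-‿cong (*-cong (unit-# p leading) (*-identityʳ t))))
          (trans (+-congˡ (-‿cong (trans (*-assoc _ _ t) (*-congˡ (trans (*-congʳ (Hom.1-homo constant)) (*-identityˡ t))))))
            (sym (x[y-z]≈xy-xz _ _ _)))))))
      (∣#-resp (solve 2 (λ y u → y := (y :- u) :+ u) R.refl ((multiple-p-quotient * K) p) (t p)) (quotient-*-at K))
      where
      open RingProperties (CommutativeRing.ring H) using (x[y-z]≈xy-xz)
      open FR.Solver using (solve; _:=_; _:+_; _:-_)
      M = g ℕ.+ b
      leading : α (suc M) R.≈ FR.# p R.* R.1#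
      leading = R.trans (R.sym (G₀ (suc M) α)) (R.trans (R.sym (R.*-identityˡ _)) (R.trans (R.*-congʳ (R.sym FR.#1≈1))
        (R.trans (R.sym (*-t^-at 1 (G (suc M) α))) (R.trans (at (*-congˡ {G (suc M) α} (*-identityʳ t)) 1)
        (R.trans (at eq 1) (R.trans (multiple-p-at-1 K K₀≈1) (R.sym (R.*-identityʳ _))))))))
      index : g ℕ.+ (g ℕ.+ 3) ≡ p
      index = ℕS.solve 1 (λ g → g ℕS.:+ (g ℕS.:+ ℕS.con 3) ℕS.:= ℕS.con 1 ℕS.:+ ℕS.con 2 ℕS.:* (ℕS.con 1 ℕS.:+ g)) ≡.refl g

    -- Multiplying by w gives w^p on the right, whose derivative is p w^(p-1) w′, so its coefficient
    -- of order p - 1 vanishes modulo p. The leading coefficient is 1, and its term w is what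
    -- remains.
    hasse-coefficient : ∀ b γ → G (h ℕ.+ b) γ ≋ w ^ (2 ℕ.* h) → p ∣# (FR.# ((2 ℕ.* h) !) R.* γ b R.+ w (2 ℕ.* h))
    hasse-coefficient b γ eq = peel-to-2h b γ (w (2 ℕ.* h)) g 2 (w ^ p - w) (s≤s z≤n) index
      (trans (solve 3 (λ g t w → g :* ((t :^ 2) :* w) := (t :* t) :* (g :* w)) refl (G M γ) t w)
        (trans (peel M γ w) (+-cong (trans (*-congʳ eq) (*-comm _ w)) (-‿cong (trans (*-congʳ (trans (Hom.⟦⟧-cong constant leading) (Hom.1-homo constant))) (*-identityˡ w))))))
      (∣#-resp (FR.Solver.solve 2 (λ y u → y FR.Solver.:= (y FR.Solver.:- u) FR.Solver.:+ u) R.refl ((w ^ p) (2 ℕ.* h)) (w (2 ℕ.* h)))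
        ((w ^ (2 ℕ.* h) * tail w) n by R.trans (at (∂-^ w (2 ℕ.* h)) n) (#-at p _ n)))
      where
      open Solver using (solve; _:=_; _:*_; con; _:^_)
      n = g ℕ.+ suc (g ℕ.+ 0)
      M = g ℕ.+ b
      leading : γ (suc M) R.≈ R.1#
      leading = R.trans (R.sym (G₀ (suc M) γ)) (R.trans (at eq 0) (head-^ (2 ℕ.* h)))
        where
        head-^ : ∀ k → (w ^ k) 0 R.≈ R.1#
        head-^ zero = R.refl
        head-^ (suc k) = R.trans (R.*-cong w₀≈1 (head-^ k)) (R.*-identityˡ _)
      index : g ℕ.+ (g ℕ.+ 2) ≡ 2 ℕ.* h
      index = ℕS.solve 1 (λ g → g ℕS.:+ (g ℕS.:+ ℕS.con 2) ℕS.:= ℕS.con 2 ℕS.:* (ℕS.con 1 ℕS.:+ g)) ≡.refl g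

-- Division polynomials on the universal curve

A B : PolyAB
A = [] ∷ ((+ 1) ∷ []) ∷ []
B = ((+ 0) ∷ (+ 1) ∷ []) ∷ []

hom-eval : ∀ {c ℓ c′ ℓ′} {P : CommutativeRing c ℓ} {P′ : CommutativeRing c′ ℓ′} (j : Hom P P′)
  (let module P = CommutativeRing P) (let module P′ = CommutativeRing P′) {n} {ρ : Vec P.Carrier n} {ρ′ : Vec P′.Carrier n} →
  (∀ i → Hom.⟦ j ⟧ (lookup ρ i) P′.≈ lookup ρ′ i) → ∀ e → Hom.⟦ j ⟧ (Evaluation.eval P ρ e) P′.≈ Evaluation.eval P′ ρ′ e
hom-eval j h (int z) = Hom.fromℤ-homo j z
hom-eval j h (var i) = h i
hom-eval {P′ = P′} j h (e ⟨+⟩ f) = CommutativeRing.trans P′ (Hom.+-homo j _ _) (CommutativeRing.+-cong P′ (hom-eval j h e) (hom-eval j h f))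
hom-eval {P′ = P′} j h (e ⟨*⟩ f) = CommutativeRing.trans P′ (Hom.*-homo j _ _) (CommutativeRing.*-cong P′ (hom-eval j h e) (hom-eval j h f))

substitute : (Fin 7 → Expr 7) → Expr 7 → Expr 7
substitute δ (int z) = int z
substitute δ (var i) = δ i
substitute δ (e ⟨+⟩ f) = substitute δ e ⟨+⟩ substitute δ f
substitute δ (e ⟨*⟩ f) = substitute δ e ⟨*⟩ substitute δ f

module _ {c ℓ} (P : CommutativeRing c ℓ) where
  open CommutativeRing P

  -- Changing the sign of t alone is the other choice of √x: x = 1/t² is kept and y = w/t³ changes
  -- sign. The relation is even in t, the closed forms for n = 2, 3, 4 are odd.
  module Reflection (A B t w r χ χ⁻¹ : Carrier) where
    open Evaluation P
    open FromIntegers P using () renaming (fromℤ to fromℤᴾ)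

    ρ₊ ρ₋ : Vec Carrier 7
    ρ₊ = A ∷ B ∷ t ∷ w ∷ r ∷ χ ∷ χ⁻¹ ∷ []
    ρ₋ = A ∷ B ∷ fromℤᴾ -[1+ 0 ] * t ∷ w ∷ r ∷ χ ∷ χ⁻¹ ∷ []

    reflect : Fin 7 → Expr 7
    reflect 2F = int -[1+ 0 ] ⟨*⟩ var 2F
    reflect i = var i

    even-relation : eval ρ₋ relation ≈ eval ρ₊ relation
    even-relation = identity ρ₊ (substitute reflect relation) relation refl

    odd-σ₂ : eval ρ₋ σ₂ᵉ ≈ fromℤᴾ -[1+ 0 ] * eval ρ₊ σ₂ᵉ
    odd-σ₂ = identity ρ₊ (substitute reflect σ₂ᵉ) (int -[1+ 0 ] ⟨*⟩ σ₂ᵉ) refl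

    odd-σ₃ : eval ρ₋ σ₃ᵉ ≈ fromℤᴾ -[1+ 0 ] * eval ρ₊ σ₃ᵉ
    odd-σ₃ = identity ρ₊ (substitute reflect σ₃ᵉ) (int -[1+ 0 ] ⟨*⟩ σ₃ᵉ) refl

    odd-σ₄ : eval ρ₋ σ₄ᵉ ≈ fromℤᴾ -[1+ 0 ] * eval ρ₊ σ₄ᵉ
    odd-σ₄ = identity ρ₊ (substitute reflect σ₄ᵉ) (int -[1+ 0 ] ⟨*⟩ σ₄ᵉ) refl

module _ {c ℓ} (R : CommutativeRing c ℓ) (R-torsionFree : Divisibility.TorsionFree R)
  (expand : RawHom [] P2._⊕_ P2._⊗_ P2.neg R) where
  open RawHom expand using () renaming (φ to coefficientsAB)
  private module R = CommutativeRing R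

  module Assembly (expand-constant : ∀ n → coefficientsAB ((n ∷ []) ∷ []) R.≈ FromIntegers.fromℤ R n)
    (expand-cong : ∀ f g → (∀ j k → coeffAB f j k ≡ coeffAB g j k) → coefficientsAB f R.≈ coefficientsAB g) where
    open Hurwitz R
    open Sigma R R-torsionFree (coefficientsAB A) (coefficientsAB B)
    open Extraction R R-torsionFree (coefficientsAB A) (coefficientsAB B) hiding (T)
    module H = CommutativeRing H
    module EH = Evaluation H
    module _ {cᴸ ℓᴸ} (L : CommutativeRing cᴸ ℓᴸ) (embed : Hom H L) where
      private
        module L = CommutativeRing L
        module ι = Hom embed

      -- The localisation enters only through an inverse of t, injectivity, and preservation of
      -- regular elements, so fractions do not unfold in the computations.
      module OverExtension (1/t : L.Carrier) (t*1/t : ι.⟦ t ⟧ L.* 1/t L.≈ L.1#)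
        (embed-injective : ∀ {f g} → ι.⟦ f ⟧ L.≈ ι.⟦ g ⟧ → f ≋ g)
        (embed-regular : ∀ {f} → (∀ {g} → g H.* f ≋ H.0# → g ≋ H.0#) → ∀ {u} → u L.* ι.⟦ f ⟧ L.≈ L.0# → u L.≈ L.0#) where
        open CommutativeRing L
        open FromIntegers L using (#_; fromℤ; #1≈1; fromℤ-*; module Solver)
        open SemiringExp semiring using (_^_; ^-congˡ; ^-homo-*; ^-assocʳ)
        open SemiringExp H.semiring using () renaming (_^_ to _^ᴴ_)
        open CommutativeSemiringExp commutativeSemiring using (^-distrib-*)
        open RingProperties (CommutativeRing.ring L) using (x∙y⁻¹≈ε⇒x≈y; x≈y⇒x∙y⁻¹≈ε; [y-z]x≈yx-zx)

        φ : PolyAB → Carrier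
        φ f = ι.⟦ unit (coefficientsAB f) ⟧

        homᴸ : RawHom [] P2._⊕_ P2._⊗_ P2.neg L
        homᴸ = record
          { φ = φ
          ; φ-0 = trans (j.⟦⟧-cong (RawHom.φ-0 expand)) j.0-homo
          ; φ-+ = λ f g → trans (j.⟦⟧-cong (RawHom.φ-+ expand f g)) (j.+-homo _ _)
          ; φ-* = λ f g → trans (j.⟦⟧-cong (RawHom.φ-* expand f g)) (j.*-homo _ _)
          ; φ-neg = λ f → trans (j.⟦⟧-cong (RawHom.φ-neg expand f)) (j.neg-homo _) }
          where module j = Hom (embed ∘-hom constant)

        open PolynomialHoms [] P2._⊕_ P2._⊗_ P2.neg L homᴸ using (evaluate)

        φ-constant : ∀ n → φ ((n ∷ []) ∷ []) ≈ fromℤ n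
        φ-constant n = trans (j.⟦⟧-cong (expand-constant n)) (j.fromℤ-homo n)
          where module j = Hom (embed ∘-hom constant)

        φ-cong : ∀ f g → (∀ j k → coeffAB f j k ≡ coeffAB g j k) → φ f ≈ φ g
        φ-cong f g e = Hom.⟦⟧-cong (embed ∘-hom constant) (expand-cong f g e)

        private
          regular-2 : ∀ {u} → u * # 2 ≈ 0# → u ≈ 0#
          regular-2 {u} e = embed-regular (λ {g} q → torsionFreeᴴ 1 (H.trans (H.*-comm (FH.# 2) g) q)) (trans (*-congˡ {u} (ι.#-homo 2)) e)
            where module FH = FromIntegers H

        with-t : Sequence → Vec Sequence 7
        with-t t′ = lookup ρ 0F ∷ lookup ρ 1F ∷ t′ ∷ lookup ρ 3F ∷ lookup ρ 4F ∷ lookup ρ 5F ∷ lookup ρ 6F ∷ []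

        module Branch (t′ : Sequence) (s : Carrier) (ts≈1 : ι.⟦ t′ ⟧ * s ≈ 1#) (mult : ℕ → Sequence)
          (relation≈0 : EH.eval (with-t t′) relation ≋ H.0#)
          (mult-0 : mult 0 ≋ H.0#) (mult-1 : mult 1 ≋ t′ H.* χ) (mult-2 : mult 2 ≋ EH.eval (with-t t′) σ₂ᵉ)
          (mult-3 : mult 3 ≋ EH.eval (with-t t′) σ₃ᵉ) (mult-4 : mult 4 ≋ EH.eval (with-t t′) σ₄ᵉ)
          (mult-odd : ∀ m → 1 ≤ m → mult (suc (2 ℕ.* m)) H.* mult 1 ^ᴴ 3 ≋
            mult (m ℕ.+ 2) H.* mult m ^ᴴ 3 H.- mult (m ℕ.∸ 1) H.* mult (m ℕ.+ 1) ^ᴴ 3)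
          (mult-even : ∀ m → 2 ≤ m → mult 2 H.* mult (2 ℕ.* m) H.* mult 1 ^ᴴ 2 ≋
            mult (m ℕ.∸ 1) ^ᴴ 2 H.* mult m H.* mult (m ℕ.+ 2) H.- mult (m ℕ.∸ 2) H.* mult m H.* mult (m ℕ.+ 1) ^ᴴ 2)
          (ψ : ℕ → E) (isψ : IsDivisionPolySeq ψ) where

          private
            ρ′ : Vec Sequence 7
            ρ′ = with-t t′

          x : Carrier
          x = s * s

          private
            a b : Carrier
            a = evaluate x AP
            b = evaluate x BP
            module U = Uniformisation L a b ι.⟦ t′ ⟧ ι.⟦ w ⟧ ι.⟦ lookup ρ 4F ⟧ ι.⟦ χ ⟧ ι.⟦ χ⁻¹ ⟧ s ts≈1
              (trans (sym (ι.*-homo χ χ⁻¹)) (trans (ι.⟦⟧-cong (IsSystem.χχ⁻¹≈1 isSystem)) ι.1-homo))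

            constant-term : ∀ f i → lookup ρ i ≋ unit (coefficientsAB f) → ι.⟦ lookup ρ i ⟧ ≈ evaluate x (f ∷ [])
            constant-term f i e = trans (ι.⟦⟧-cong e) (sym (EvaluateAt.evaluate-constant L homᴸ φ-constant x f))

            variables : ∀ i → ι.⟦ lookup ρ′ i ⟧ ≈ lookup U.ρ i
            variables 0F = constant-term A 0F variable-0
            variables 1F = constant-term B 1F variable-1
            variables 2F = refl
            variables 3F = refl
            variables 4F = refl
            variables 5F = refl
            variables 6F = refl

            image : ∀ {f} e → f ≋ EH.eval ρ′ e → ι.⟦ f ⟧ ≈ Evaluation.eval L U.ρ e
            image e p = trans (ι.⟦⟧-cong p) (hom-eval embed variables e)

          y ω : Carrier
          y = U.y
          ω = U.ω

          y²≈ : y * y ≈ evaluate x fP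
          y²≈ = trans (U.curve-equation (trans (sym (image relation H.refl)) (trans (ι.⟦⟧-cong relation≈0) ι.0-homo)))
            (sym (EvaluateAt.evaluate-fP L homᴸ φ-constant x))

          private
            module V = CurveEvaluation L homᴸ φ-constant x y y²≈
            module Z = V.OfDivisionPolynomials φ-cong ψ isψ
            module DR = DivisionRecursion L

            am : ℕ → Carrier
            am n = ι.⟦ mult n ⟧

            ^-image : ∀ f n {u} → ι.⟦ f ⟧ ≈ u → ι.⟦ f ^ᴴ n ⟧ ≈ u ^ n
            ^-image f n e = trans (ι.^-homo f n) (^-congˡ n e)

            module RS = DR.Rescaled am ω (trans (*-congʳ (trans (ι.⟦⟧-cong mult-1) (ι.*-homo t′ χ))) U.σω≈1)
              (λ m h → trans (sym (ι.image-* refl (^-image (mult 1) 3 refl))) (trans (ι.⟦⟧-cong (mult-odd m h))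
                (ι.image-minus (ι.image-* refl (^-image (mult m) 3 refl)) (ι.image-* refl (^-image (mult (m ℕ.+ 1)) 3 refl)))))
              (λ m h → trans (sym (ι.image-* (ι.image-* refl refl) (^-image (mult 1) 2 refl))) (trans (ι.⟦⟧-cong (mult-even m h))
                (ι.image-minus (ι.image-* (ι.image-* (^-image (mult (m ℕ.∸ 1)) 2 refl) refl) refl)
                  (ι.image-* (ι.image-* refl refl) (^-image (mult (m ℕ.+ 1)) 2 refl)))))

            W2≈ : RS.W 2 ≈ # 2 * y
            W2≈ = trans (*-congʳ (image σ₂ᵉ mult-2)) U.σ₂ω⁴

            -- 2y = 2w/t³, where 2 is regular by torsion-freeness, w by its constant term 1, and t
            -- is a unit; multiplying by t³ removes the denominator.
            regular-W2 : ∀ {u} → u * RS.W 2 ≈ 0# → u ≈ 0#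
            regular-W2 {u} e = regular-2 (embed-regular (λ {g} → regular-w {g}) (begin
              (u * # 2) * ι.⟦ w ⟧                 ≈⟨ *-identityʳ _ ⟨
              (u * # 2) * ι.⟦ w ⟧ * 1#            ≈⟨ *-congˡ {u * # 2 * ι.⟦ w ⟧} (trans (*-cong ts≈1 (trans (*-cong ts≈1 ts≈1) (*-identityˡ 1#))) (*-identityˡ 1#)) ⟨
              (u * # 2) * ι.⟦ w ⟧ * ((ι.⟦ t′ ⟧ * s) * ((ι.⟦ t′ ⟧ * s) * (ι.⟦ t′ ⟧ * s)))
                ≈⟨ solve 5 (λ u n w t s → (u :* n) :* w :* ((t :* s) :* ((t :* s) :* (t :* s))) := (u :* (n :* (w :* (s :* (s :* s))))) :* (t :* (t :* t))) refl u (# 2) ι.⟦ w ⟧ ι.⟦ t′ ⟧ s ⟩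
              (u * (# 2 * y)) * (ι.⟦ t′ ⟧ * (ι.⟦ t′ ⟧ * ι.⟦ t′ ⟧))
                ≈⟨ *-congʳ {ι.⟦ t′ ⟧ * (ι.⟦ t′ ⟧ * ι.⟦ t′ ⟧)} (trans (*-congˡ {u} (sym W2≈)) e) ⟩
              0# * (ι.⟦ t′ ⟧ * (ι.⟦ t′ ⟧ * ι.⟦ t′ ⟧)) ≈⟨ zeroˡ _ ⟩
              0# ∎))
              where
              open SetoidReasoning setoid
              open Solver using (solve; _:=_; _:*_)

            initial : ∀ n → n ≤ 4 → Z.z n ≈ RS.W n
            initial 0 _ = trans Z.z0 (sym (trans (*-congʳ (trans (ι.⟦⟧-cong mult-0) ι.0-homo)) (zeroˡ 1#)))
            initial 1 _ = trans Z.z1 (trans #1≈1 (sym (trans (*-cong (trans (ι.⟦⟧-cong mult-1) (ι.*-homo t′ χ)) (*-identityʳ ω)) U.σω≈1)))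
            initial 2 _ = trans Z.z2 (sym W2≈)
            initial 3 _ = trans Z.z3 (sym (trans (*-congʳ (image σ₃ᵉ mult-3)) U.σ₃ω⁹))
            initial 4 _ = trans Z.z4 (sym (trans (*-congʳ (image σ₄ᵉ mult-4)) U.σ₄ω¹⁶))
            initial (suc (suc (suc (suc (suc n))))) (s≤s (s≤s (s≤s (s≤s ()))))

          ψ-value : ∀ n → evaluate x (proj₁ (ψ n)) + evaluate x (proj₂ (ψ n)) * y ≈ ι.⟦ mult n ⟧ * ω ^ (n ℕ.* n)
          ψ-value n = trans (sym (V.value-unfold (proj₁ (ψ n)) (proj₂ (ψ n))))
            (DR.unique (record { odd = Z.z-odd ; even = Z.z-even }) RS.W-recursion regular-W2 initial n)

        private
          module FH = FromIntegers H
          -1ᴴ : Sequence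
          -1ᴴ = FH.fromℤ -[1+ 0 ]
          -1ᴸ : Carrier
          -1ᴸ = fromℤ -[1+ 0 ]

          t⁻ : Sequence
          t⁻ = -1ᴴ H.* t

          mult⁻ : ℕ → Sequence
          mult⁻ n = -1ᴴ H.* multiple n

          -1*-1≈1 : -1ᴸ * -1ᴸ ≈ 1#
          -1*-1≈1 = trans (sym (fromℤ-* -[1+ 0 ] -[1+ 0 ])) #1≈1

        module WithDivisionPolynomials (ψ : ℕ → E) (isψ : IsDivisionPolySeq ψ) where
          private
            module Plus = Branch t 1/t t*1/t multiple (IsSystem.w²≈ isSystem)
              multiple-0 multiple-1 multiple-2 multiple-3 multiple-4 multiple-odd (λ m h → multiple-even m h) ψ isψ

            module Rf = Reflection H (lookup ρ 0F) (lookup ρ 1F) t (lookup ρ 3F) (lookup ρ 4F) (lookup ρ 5F) (lookup ρ 6F)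

            s⁻ : Carrier
            s⁻ = -1ᴸ * 1/t

            t⁻s⁻≈1 : ι.⟦ t⁻ ⟧ * s⁻ ≈ 1#
            t⁻s⁻≈1 = begin
              ι.⟦ t⁻ ⟧ * s⁻                     ≈⟨ *-congʳ (trans (ι.*-homo -1ᴴ t) (*-congʳ (ι.fromℤ-homo -[1+ 0 ]))) ⟩
              (-1ᴸ * ι.⟦ t ⟧) * (-1ᴸ * 1/t) ≈⟨ solve 3 (λ n t s → (n :* t) :* (n :* s) := (n :* n) :* (t :* s)) refl -1ᴸ ι.⟦ t ⟧ 1/t ⟩
              (-1ᴸ * -1ᴸ) * (ι.⟦ t ⟧ * 1/t) ≈⟨ *-cong -1*-1≈1 t*1/t ⟩
              1# * 1#                           ≈⟨ *-identityˡ 1# ⟩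
              1# ∎
              where
              open SetoidReasoning setoid
              open Solver using (solve; _:=_; _:*_)

            mult⁻-odd : ∀ m → 1 ≤ m → mult⁻ (suc (2 ℕ.* m)) H.* mult⁻ 1 ^ᴴ 3 ≋
              mult⁻ (m ℕ.+ 2) H.* mult⁻ m ^ᴴ 3 H.- mult⁻ (m ℕ.∸ 1) H.* mult⁻ (m ℕ.+ 1) ^ᴴ 3
            mult⁻-odd m h = H.trans
              (solve 3 (λ n x y → (n :* x) :* (n :* y) :^ 3 := n :^ 4 :* (x :* y :^ 3)) H.refl -1ᴴ (multiple (suc (2 ℕ.* m))) (multiple 1))
              (H.trans (H.*-congˡ (multiple-odd m h))
                (solve 5 (λ n a b c d → n :^ 4 :* (a :* b :^ 3 :- c :* d :^ 3) := (n :* a) :* (n :* b) :^ 3 :- (n :* c) :* (n :* d) :^ 3)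
                  H.refl -1ᴴ (multiple (m ℕ.+ 2)) (multiple m) (multiple (m ℕ.∸ 1)) (multiple (m ℕ.+ 1))))
              where open FH.Solver using (solve; _:=_; _:*_; _:-_; _:^_)

            mult⁻-even : ∀ m → 2 ≤ m → mult⁻ 2 H.* mult⁻ (2 ℕ.* m) H.* mult⁻ 1 ^ᴴ 2 ≋
              mult⁻ (m ℕ.∸ 1) ^ᴴ 2 H.* mult⁻ m H.* mult⁻ (m ℕ.+ 2) H.- mult⁻ (m ℕ.∸ 2) H.* mult⁻ m H.* mult⁻ (m ℕ.+ 1) ^ᴴ 2
            mult⁻-even m h = H.trans
              (solve 4 (λ n x y z → (n :* x) :* (n :* y) :* (n :* z) :^ 2 := n :^ 4 :* (x :* y :* z :^ 2)) H.refl -1ᴴ (multiple 2) (multiple (2 ℕ.* m)) (multiple 1))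
              (H.trans (H.*-congˡ (multiple-even m h))
                (solve 6 (λ n a b c d e → n :^ 4 :* (a :^ 2 :* b :* c :- d :* b :* e :^ 2) :=
                    (n :* a) :^ 2 :* (n :* b) :* (n :* c) :- (n :* d) :* (n :* b) :* (n :* e) :^ 2)
                  H.refl -1ᴴ (multiple (m ℕ.∸ 1)) (multiple m) (multiple (m ℕ.+ 2)) (multiple (m ℕ.∸ 2)) (multiple (m ℕ.+ 1))))
              where open FH.Solver using (solve; _:=_; _:*_; _:-_; _:^_)

            module Minus = Branch t⁻ s⁻ t⁻s⁻≈1 mult⁻ (H.trans Rf.even-relation (IsSystem.w²≈ isSystem))
              (H.trans (H.*-congˡ multiple-0) (H.zeroʳ -1ᴴ))
              (H.trans (H.*-congˡ multiple-1) (H.sym (H.*-assoc -1ᴴ t χ)))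
              (H.trans (H.*-congˡ multiple-2) (H.sym Rf.odd-σ₂))
              (H.trans (H.*-congˡ multiple-3) (H.sym Rf.odd-σ₃))
              (H.trans (H.*-congˡ multiple-4) (H.sym Rf.odd-σ₄))
              mult⁻-odd mult⁻-even ψ isψ

          private
            T̂ : Carrier
            T̂ = ι.⟦ t H.* t ⟧

            xT̂≈1 : Plus.x * T̂ ≈ 1#
            xT̂≈1 = trans (*-congˡ {Plus.x} (ι.*-homo t t)) (trans
              (solve 2 (λ s t → (s :* s) :* (t :* t) := (t :* s) :* (t :* s)) refl 1/t ι.⟦ t ⟧)
              (trans (*-cong t*1/t t*1/t) (*-identityˡ 1#)))
              where open Solver using (solve; _:=_; _:*_)

          -- Any exponent from the length of the list upwards clears the denominators; the slack e
          -- will be the degree N at which `descend` stops.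
          evaluate-G : ∀ q e → evaluate Plus.x q * T̂ ^ (length q ℕ.+ e) ≈ ι.⟦ G (length q ℕ.+ e) (λ i → coefficientsAB (P3.coeff q i)) ⟧
          evaluate-G [] e = trans (zeroˡ _) (sym (trans (ι.⟦⟧-cong (G-0 e (λ i → coefficientsAB []) (λ i → RawHom.φ-0 expand))) ι.0-homo))
          evaluate-G (a ∷ q) e = begin
            (φ a + Plus.x * evaluate Plus.x q) * (T̂ * T̂ ^ M)
              ≈⟨ solve 5 (λ a x q T P → (a :+ x :* q) :* (T :* P) := a :* (T :* P) :+ (x :* T) :* (q :* P)) refl (φ a) Plus.x (evaluate Plus.x q) T̂ (T̂ ^ M) ⟩
            φ a * T̂ ^ suc M + (Plus.x * T̂) * (evaluate Plus.x q * T̂ ^ M)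
              ≈⟨ +-cong (sym (ι.image-* refl (ι.^-homo (t H.* t) (suc M)))) (trans (*-cong xT̂≈1 (evaluate-G q e)) (*-identityˡ _)) ⟩
            ι.⟦ unit (coefficientsAB a) H.* (t H.* t) ^ᴴ suc M ⟧ + ι.⟦ G M (λ i → coefficientsAB (P3.coeff q i)) ⟧
              ≈⟨ trans (ι.⟦⟧-cong (G-suc M (λ i → coefficientsAB (P3.coeff (a ∷ q) i)))) (ι.+-homo _ _) ⟨
            ι.⟦ G (suc M) (λ i → coefficientsAB (P3.coeff (a ∷ q) i)) ⟧ ∎
            where
            open SetoidReasoning setoid
            open Solver using (solve; _:=_; _:+_; _:*_)
            M = length q ℕ.+ e

          evaluate-congˣ : ∀ {x x′} → x ≈ x′ → ∀ q → evaluate x q ≈ evaluate x′ q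
          evaluate-congˣ e [] = refl
          evaluate-congˣ e (a ∷ q) = +-congˡ (*-cong e (evaluate-congˣ e q))

          -- Averaging over the two square roots ± y removes the y-component.
          ψ-odd-value : ∀ p N → p ℕ.* p ≡ suc (2 ℕ.* N) → evaluate Plus.x (proj₁ (ψ p)) ≈ ι.⟦ multiple p ⟧ * Plus.ω ^ suc (2 ℕ.* N)
          ψ-odd-value p N p²≡ = x∙y⁻¹≈ε⇒x≈y _ _ (regular-2 (trans ([y-z]x≈yx-zx (# 2) f g) (x≈y⇒x∙y⁻¹≈ε (begin
            f * # 2                                 ≈⟨ solve 3 (λ f h y → f :* con (+ 2) := (f :+ h :* y) :+ (f :+ h :* (con -[1+ 0 ] :* y))) refl f f′ Plus.y ⟩
            (f + f′ * Plus.y) + (f + f′ * (-1ᴸ * Plus.y)) ≈⟨ +-cong plus minus ⟩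
            g + g                                   ≈⟨ solve 1 (λ g → g :+ g := g :* con (+ 2)) refl g ⟩
            g * # 2                                 ∎))))
            where
            open SetoidReasoning setoid
            open Solver using (solve; _:=_; con; _:+_; _:*_)
            f f′ g : Carrier
            f = evaluate Plus.x (proj₁ (ψ p))
            f′ = evaluate Plus.x (proj₂ (ψ p))
            g = ι.⟦ multiple p ⟧ * Plus.ω ^ suc (2 ℕ.* N)
            plus : f + f′ * Plus.y ≈ g
            plus = trans (Plus.ψ-value p) (reflexive (≡.cong (λ n → ι.⟦ multiple p ⟧ * Plus.ω ^ n) p²≡))
            x≈x⁻ : Plus.x ≈ Minus.x
            x≈x⁻ = trans (sym (trans (*-congʳ -1*-1≈1) (*-identityˡ _))) (solve 2 (λ n s → (n :* n) :* (s :* s) := (n :* s) :* (n :* s)) refl -1ᴸ 1/t)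
            -y≈y⁻ : -1ᴸ * Plus.y ≈ Minus.y
            -y≈y⁻ = solve 2 (λ w s → con -[1+ 0 ] :* (w :* (s :* (s :* s))) := w :* ((con -[1+ 0 ] :* s) :* ((con -[1+ 0 ] :* s) :* (con -[1+ 0 ] :* s)))) refl ι.⟦ w ⟧ 1/t
            -1-power : ∀ k → (-1ᴸ ^ 2) ^ k ≈ 1#
            -1-power zero = refl
            -1-power (suc k) = trans (*-cong (trans (*-congˡ (*-identityʳ -1ᴸ)) -1*-1≈1) (-1-power k)) (*-identityˡ 1#)
            -- On the other branch σ(pz) and ω both change sign; ω enters with the odd exponent p²,
            -- so the signs cancel.
            minus : f + f′ * (-1ᴸ * Plus.y) ≈ g
            minus = begin
              f + f′ * (-1ᴸ * Plus.y)
                ≈⟨ +-cong (evaluate-congˣ x≈x⁻ (proj₁ (ψ p))) (*-cong (evaluate-congˣ x≈x⁻ (proj₂ (ψ p))) -y≈y⁻) ⟩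
              evaluate Minus.x (proj₁ (ψ p)) + evaluate Minus.x (proj₂ (ψ p)) * Minus.y
                ≈⟨ Minus.ψ-value p ⟩
              ι.⟦ mult⁻ p ⟧ * Minus.ω ^ (p ℕ.* p)
                ≈⟨ *-cong (trans (ι.*-homo -1ᴴ (multiple p)) (*-congʳ (ι.fromℤ-homo -[1+ 0 ])))
                     (trans (reflexive (≡.cong (Minus.ω ^_) p²≡)) (trans (^-congˡ (suc (2 ℕ.* N)) ω⁻) (^-distrib-* -1ᴸ Plus.ω (suc (2 ℕ.* N))))) ⟩
              (-1ᴸ * ι.⟦ multiple p ⟧) * (-1ᴸ * -1ᴸ ^ (2 ℕ.* N) * Plus.ω ^ suc (2 ℕ.* N))
                ≈⟨ solve 4 (λ n m q w → (n :* m) :* (n :* q :* w) := ((n :* n) :* q) :* (m :* w)) refl -1ᴸ ι.⟦ multiple p ⟧ (-1ᴸ ^ (2 ℕ.* N)) (Plus.ω ^ suc (2 ℕ.* N)) ⟩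
              ((-1ᴸ * -1ᴸ) * -1ᴸ ^ (2 ℕ.* N)) * g
                ≈⟨ *-congʳ (*-cong -1*-1≈1 (trans (sym (^-assocʳ -1ᴸ 2 N)) (-1-power N))) ⟩
              (1# * 1#) * g ≈⟨ trans (*-congʳ (*-identityˡ 1#)) (*-identityˡ g) ⟩
              g ∎
              where
              ω⁻ : Minus.ω ≈ -1ᴸ * Plus.ω
              ω⁻ = solve 3 (λ k n s → k :* (n :* s) := n :* (k :* s)) refl ι.⟦ χ⁻¹ ⟧ -1ᴸ 1/t

          private
            1^ : ∀ {u} → u ≈ 1# → ∀ n → u ^ n ≈ 1#
            1^ e zero = refl
            1^ e (suc n) = trans (*-cong e (1^ e n)) (*-identityˡ 1#)

          -- Multiplication by t^(p²) turns ω^(p²) = σ^(-p²) into χ^(-p²), a series with constant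
          -- term 1.
          ψ-series : ∀ p N → p ℕ.* p ≡ suc (2 ℕ.* N) →
            G N (λ i → coefficientsAB (P3.coeff (proj₁ (ψ p)) i)) H.* t ≋ multiple p H.* χ⁻¹ ^ᴴ suc (2 ℕ.* N)
          ψ-series p N p²≡ = descend l N α X (embed-injective (begin
            ι.⟦ G (l ℕ.+ N) α H.* t ⟧                    ≈⟨ ι.*-homo _ t ⟩
            ι.⟦ G (l ℕ.+ N) α ⟧ * t̂                      ≈⟨ *-congʳ (evaluate-G q N) ⟨
            (evaluate Plus.x q * T̂ ^ (l ℕ.+ N)) * t̂      ≈⟨ *-congʳ (*-cong (ψ-odd-value p N p²≡) (^-homo-* T̂ l N)) ⟩
            ((m * Plus.ω ^ n) * (T̂ ^ l * T̂ ^ N)) * t̂     ≈⟨ *-congʳ (*-congʳ (*-congˡ (^-distrib-* ι.⟦ χ⁻¹ ⟧ 1/t n))) ⟩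
            ((m * (ι.⟦ χ⁻¹ ⟧ ^ n * (1/t * 1/t ^ (2 ℕ.* N)))) * (T̂ ^ l * T̂ ^ N)) * t̂
              ≈⟨ solve 7 (λ m k s S L P t → ((m :* (k :* (s :* S))) :* (L :* P)) :* t := ((m :* k) :* L) :* ((t :* s) :* (S :* P))) refl m (ι.⟦ χ⁻¹ ⟧ ^ n) 1/t (1/t ^ (2 ℕ.* N)) (T̂ ^ l) (T̂ ^ N) t̂ ⟩
            ((m * ι.⟦ χ⁻¹ ⟧ ^ n) * T̂ ^ l) * ((t̂ * 1/t) * (1/t ^ (2 ℕ.* N) * T̂ ^ N))
              ≈⟨ *-congˡ (trans (*-cong t*1/t sT) (*-identityˡ 1#)) ⟩
            ((m * ι.⟦ χ⁻¹ ⟧ ^ n) * T̂ ^ l) * 1#           ≈⟨ *-identityʳ _ ⟩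
            (m * ι.⟦ χ⁻¹ ⟧ ^ n) * T̂ ^ l                  ≈⟨ ι.image-* (ι.image-* refl (ι.^-homo χ⁻¹ n)) (ι.^-homo (t H.* t) l) ⟨
            ι.⟦ X H.* (t H.* t) ^ᴴ l ⟧                   ∎))
            where
            open SetoidReasoning setoid
            open Solver using (solve; _:=_; _:*_)
            q = proj₁ (ψ p)
            l = length q
            n = suc (2 ℕ.* N)
            m t̂ : Carrier
            m = ι.⟦ multiple p ⟧
            t̂ = ι.⟦ t ⟧
            α : ℕ → R.Carrier
            α i = coefficientsAB (P3.coeff q i)
            X : Sequence
            X = multiple p H.* χ⁻¹ ^ᴴ n
            sT : 1/t ^ (2 ℕ.* N) * T̂ ^ N ≈ 1#
            sT = trans (*-congʳ (trans (sym (^-assocʳ 1/t 2 N)) (^-congˡ N (*-congˡ (*-identityʳ 1/t)))))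
              (trans (sym (^-distrib-* Plus.x T̂ N)) (1^ xT̂≈1 N))

          -- Since w² = t⁶ y², the factor t^(6h) turns f(x)^h = y^(2h) into w^(2h). An extra t is
          -- put in to reuse `descend` and is cancelled again.
          hasse-series : ∀ h → G (3 ℕ.* h) (λ i → coefficientsAB (P3.coeff (powP fP h) i)) ≋ w ^ᴴ (2 ℕ.* h)
          hasse-series h = HR.x∙y⁻¹≈ε⇒x≈y _ _ (regular-t (H.trans (HR.[y-z]x≈yx-zx t (G N γ) X) (HR.x≈y⇒x∙y⁻¹≈ε (descend l N γ (X H.* t) (embed-injective (begin
            ι.⟦ G (l ℕ.+ N) γ H.* t ⟧                     ≈⟨ ι.*-homo _ t ⟩
            ι.⟦ G (l ℕ.+ N) γ ⟧ * t̂                       ≈⟨ *-congʳ (evaluate-G q N) ⟨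
            (evaluate Plus.x q * T̂ ^ (l ℕ.+ N)) * t̂       ≈⟨ *-congʳ (*-cong value (trans (^-homo-* T̂ l N) (*-congˡ (sym (^-assocʳ T̂ 3 h))))) ⟩
            ((Plus.y * Plus.y) ^ h * (T̂ ^ l * (T̂ ^ 3) ^ h)) * t̂
              ≈⟨ solve 4 (λ Y L P t → (Y :* (L :* P)) :* t := ((Y :* P) :* t) :* L) refl _ _ _ t̂ ⟩
            (((Plus.y * Plus.y) ^ h * (T̂ ^ 3) ^ h) * t̂) * T̂ ^ l
              ≈⟨ *-congʳ (*-congʳ power) ⟩
            (ι.⟦ w ⟧ ^ (2 ℕ.* h) * t̂) * T̂ ^ l             ≈⟨ ι.image-* (ι.image-* (ι.^-homo w (2 ℕ.* h)) refl) (ι.^-homo (t H.* t) l) ⟨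
            ι.⟦ (X H.* t) H.* (t H.* t) ^ᴴ l ⟧            ∎))))))
            where
            open SetoidReasoning setoid
            open Solver using (solve; _:=_; _:*_; _:^_)
            module HR = RingProperties H.ring
            q = powP fP h
            l = length q
            N = 3 ℕ.* h
            t̂ : Carrier
            t̂ = ι.⟦ t ⟧
            γ : ℕ → R.Carrier
            γ i = coefficientsAB (P3.coeff q i)
            X : Sequence
            X = w ^ᴴ (2 ℕ.* h)
            value : evaluate Plus.x q ≈ (Plus.y * Plus.y) ^ h
            value = trans (EvaluateAt.evaluate-powP L homᴸ φ-constant Plus.x fP h) (^-congˡ h (sym Plus.y²≈))
            power : (Plus.y * Plus.y) ^ h * (T̂ ^ 3) ^ h ≈ ι.⟦ w ⟧ ^ (2 ℕ.* h)
            power = begin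
              (Plus.y * Plus.y) ^ h * (T̂ ^ 3) ^ h           ≈⟨ ^-distrib-* (Plus.y * Plus.y) (T̂ ^ 3) h ⟨
              ((Plus.y * Plus.y) * T̂ ^ 3) ^ h
                ≈⟨ ^-congˡ h (solve 3 (λ w s T → ((w :* (s :* (s :* s))) :* (w :* (s :* (s :* s)))) :* T :^ 3 := w :^ 2 :* ((s :* s) :* T) :^ 3) refl ι.⟦ w ⟧ 1/t T̂) ⟩
              (ι.⟦ w ⟧ ^ 2 * (Plus.x * T̂) ^ 3) ^ h          ≈⟨ ^-congˡ h (trans (*-congˡ (1^ xT̂≈1 3)) (*-identityʳ _)) ⟩
              (ι.⟦ w ⟧ ^ 2) ^ h                              ≈⟨ ^-assocʳ ι.⟦ w ⟧ 2 h ⟩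
              ι.⟦ w ⟧ ^ (2 ℕ.* h)                            ∎

          open Divisibility R

          -- The degrees split as 3h = h + (p - 1) and (p² - 1)/2 = h + p(p - 1)/2, so both
          -- coefficients sit h places below the top. The common term w_{p-1} drops out of the
          -- difference, and (p - 1)! is prime to p.
          congruence : ∀ g (let h = suc g) (let p = suc (2 ℕ.* h)) → Prime p →
            p ∣# (coefficientsAB (P3.coeff (powP fP h) (2 ℕ.* h)) R.- coefficientsAB (P3.coeff (proj₁ (ψ p)) (p ℕ.* h)))
          congruence g p-prime = prime-∣#-cancel-! p-prime (2 ℕ.* h) (ℕₚ.n<1+n (2 ℕ.* h))
            (∣#-resp (solve 4 (λ f c l v → (f :* c :+ v) :- (f :* l :+ v) := f :* (c :- l)) R.refl _ _ _ (w (2 ℕ.* h)))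
              (∣#-minus (hasse-coefficient p-prime (2 ℕ.* h) _ (hasse-series h))
                (ψ-coefficient p-prime (p ℕ.* h) _ (χ⁻¹ ^ᴴ suc (2 ℕ.* (h ℕ.+ p ℕ.* h))) (head-^ (suc (2 ℕ.* (h ℕ.+ p ℕ.* h))))
                  (ψ-series p (h ℕ.+ p ℕ.* h) p²≡))))
            where
            open FromIntegers.Solver R using (solve; _:=_; _:+_; _:*_; _:-_)
            h = suc g
            p = suc (2 ℕ.* h)
            head-^ : ∀ k → (χ⁻¹ ^ᴴ k) 0 R.≈ R.1#
            head-^ zero = R.refl
            head-^ (suc k) = R.trans (R.*-cong (FromIntegers.#1≈1 R) (head-^ k)) (R.*-identityˡ _)
            p²≡ : p ℕ.* p ≡ suc (2 ℕ.* (h ℕ.+ p ℕ.* h))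
            p²≡ = ℕS.solve 1 (λ h → let p = ℕS.con 1 ℕS.:+ ℕS.con 2 ℕS.:* h in
              p ℕS.:* p ℕS.:= ℕS.con 1 ℕS.:+ ℕS.con 2 ℕS.:* (h ℕS.:+ p ℕS.:* h)) ≡.refl h

    private module Loc = Localisation H t regular-t

    module _ (ψ : ℕ → E) (isψ : IsDivisionPolySeq ψ) where
      open OverExtension Loc.localisation Loc.embed Loc.1/t Loc.t*1/t Loc.embed-injective Loc.embed-regular
      open WithDivisionPolynomials ψ isψ public using (congruence)

-- The congruence over ℤ[A,B]

ℤ-id : RawHom (+ 0) ℤ._+_ ℤ._*_ ℤ.-_ ℤₚ.+-*-commutativeRing
ℤ-id = record { φ = λ z → z ; φ-0 = ≡.refl ; φ-+ = λ _ _ → ≡.refl ; φ-* = λ _ _ → ≡.refl ; φ-neg = λ _ → ≡.refl }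

module ℤ[B] = PolynomialHoms (+ 0) ℤ._+_ ℤ._*_ ℤ.-_ ℤₚ.+-*-commutativeRing ℤ-id
module ℤ[B][A] = PolynomialHoms [] P1._⊕_ P1._⊗_ P1.neg ℤ[B].PS.powerSeriesRing ℤ[B].coefficients

-- In power series equality is coefficientwise, so lists differing by trailing zeros have equal
-- images, and divisibility by p can be read off coefficient by coefficient.
ℤ⟦B⟧ R : CommutativeRing _ _
ℤ⟦B⟧ = ℤ[B].PS.powerSeriesRing
R = ℤ[B][A].PS.powerSeriesRing

module R = CommutativeRing R

expand : RawHom [] P2._⊕_ P2._⊗_ P2.neg R
expand = ℤ[B][A].coefficients


R-torsionFree : Divisibility.TorsionFree R
R-torsionFree = PowerSeriesIntegers.torsionFree ℤ⟦B⟧ (PowerSeriesIntegers.torsionFree ℤₚ.+-*-commutativeRing torsionFree-ℤ)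

open RawHom expand using () renaming (φ to coefficientsAB)

expand-constant : ∀ n → coefficientsAB ((n ∷ []) ∷ []) R.≈ FromIntegers.fromℤ R n
expand-constant n = R.trans (Sequences.pointwise λ
    { zero → Sequences.pointwise λ { zero → ≡.sym (fromℤ-ℤ n) ; (suc k) → ≡.refl }
    ; (suc j) → Sequences.pointwise λ k → ≡.refl })
  (Hom.fromℤ-homo (PowerSeriesIntegers.constant ℤ⟦B⟧ ∘-hom PowerSeriesIntegers.constant ℤₚ.+-*-commutativeRing) n)

expand-cong : ∀ f g → (∀ j k → coeffAB f j k ≡ coeffAB g j k) → coefficientsAB f R.≈ coefficientsAB g
expand-cong f g e = Sequences.pointwise λ j → Sequences.pointwise (e j)

odd-prime : ∀ p → Prime p → 3 ≤ p → ∃ λ g → p ≡ suc (2 ℕ.* suc g)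
odd-prime p p-prime 3≤p with even-or-odd p
... | inj₂ (suc g , p≡) = g , p≡
odd-prime p p-prime (s≤s ()) | inj₂ (zero , ≡.refl)
odd-prime p p-prime 3≤p | inj₁ (m , p≡) with prime⇒irreducible p-prime (ℕ∣.divides m (≡.trans p≡ (ℕₚ.*-comm 2 m)))
... | inj₂ ≡.refl = ⊥-elim (ℕₚ.<-irrefl ≡.refl 3≤p)

open import Data.Nat.DivMod using (_/_; m*n/n≡m)
open import Data.Integer using (_-_)
open import Data.Integer.Divisibility using (_∣_)

mainTheorem1 : (p : ℕ) → Prime p → 3 ≤ p →
    (ψ : ℕ → E) → IsDivisionPolySeq ψ →
    ∀ j k → (+ p) ∣ (coeffAB (c p) j k - coeffAB (ℓ ψ p) j k)
mainTheorem1 p p-prime 3≤p ψ isψ j k with odd-prime p p-prime 3≤p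
-- Both halvings in `c` and `ℓ` are exact: p - 1 = 2h and p(p - 1) = 2(ph).
... | g , ≡.refl = Signed.∣⇒∣ᵤ (≡.subst₂ (λ a b → + p Signed.∣ (coeffAB (P3.coeff (powP fP a) (2 ℕ.* h)) j k - coeffAB (P3.coeff (proj₁ (ψ p)) b) j k))
    (≡.sym (half h)) (≡.sym (≡.trans (≡.cong (_/ 2) p*2h) (half (p ℕ.* h)))) (from (Assembly.congruence R R-torsionFree expand expand-constant expand-cong ψ isψ g p-prime)))
  where
  h = suc g
  half : ∀ n → (2 ℕ.* n) / 2 ≡ n
  half n = ≡.trans (≡.cong (_/ 2) (ℕₚ.*-comm 2 n)) (m*n/n≡m n 2)
  p*2h : p ℕ.* (2 ℕ.* h) ≡ 2 ℕ.* (p ℕ.* h)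
  p*2h = ≡.trans (≡.sym (ℕₚ.*-assoc p 2 h)) (≡.trans (≡.cong (ℕ._* h) (ℕₚ.*-comm p 2)) (ℕₚ.*-assoc 2 p h))
  open Divisibility R using (_∣#_; _by_)
  from : ∀ {f} → p ∣# f → + p Signed.∣ f j k
  from {f} (u by e) = Signed.divides (u j k) (≡.trans (at (at e j) k) (≡.trans (at (PowerSeriesIntegers.#-at ℤ⟦B⟧ p u j) k)
    (≡.trans (PowerSeriesIntegers.#-at ℤₚ.+-*-commutativeRing p (u j) k)
      (≡.trans (≡.cong (ℤ._* u j k) (fromℤ-ℤ (+ p))) (ℤₚ.*-comm (+ p) (u j k))))))
    where
    at : ∀ {c ℓ} {C : CommutativeRing c ℓ} → let open Sequences C in ∀ {f g} → f ≋ g → ∀ n → CommutativeRing._≈_ C (f n) (g n)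
    at {C = C} = Sequences.at {C = C}
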